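{- There exists a constant $C>0$ such that for arbitrarily large values of $n$ there exists a set $S$ of $n$ points in general position in the plane such that, for every coloring of $S$ with two colors (red and blue), the coarseness of $S$ is at least $C n^{1/4}$.
   Context: General position means that no three points of $S$ are collinear. A coloring of a finite set $S\subset\mathbb{R}^2$ is a map $\mathcal{X}:S\to\{ -1,+1\}$ (points mapped to $+1$ are red, points mapped to $-1$ are blue). For $Y\subseteq S$, the discrepancy of $Y$ is $\operatorname{disc}(Y)=\left|\sum_{y\in Y}\mathcal{X}(y)\right|$, i.e. the absolute value of the number of red points minus the number of blue points in $Y$. An island of $S$ is a subset $I\subseteq S$ such that $I=C'\cap S$ for some convex set $C'\subseteq\mathbb{R}^2$. A convex partition of $S$ is a partition $\Pi=\{S_1,\dots,S_k\}$ of $S$ into (nonempty) islands with pairwise disjoint convex hulls. Its discrepancy is $\operatorname{disc}(\Pi)=\min_{1\le i\le k}\operatorname{disc}(S_i)$. The coarseness of the colored set $S$ is $\mathcal{C}(S)=\max_{\Pi}\operatorname{disc}(\Pi)$, the maximum over all convex partitions $\Pi$ of $S$. -}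

module Defs where

open import Algebra.Bundles using (AbelianGroup)
open import Data.Bool.Base using (if_then_else_)
open import Data.Fin.Base using (Fin)
open import Data.Fin.Subset using (Subset; _∈_; Nonempty)
import Data.Integer.Base as ℤ
import Data.Integer.Properties as ℤₚ
open import Data.Nat.Base as ℕ using (ℕ; zero; suc)
import Data.Nat.Properties as ℕₚ
open import Data.Product using (Σ-syntax; ∃!; ∃-syntax; _×_; _,_; proj₁; proj₂)
open import Data.Rational as ℚ using (ℚ; 0ℚ; 1ℚ; mkℚ)
import Data.Rational.Properties as ℚₚ
import Data.Rational.Unnormalised as ℚᵘ
import Data.Rational.Unnormalised.Properties as ℚᵘₚ
open import Data.Sign.Base using (Sign)
open import Data.Sum.Base using (inj₁; inj₂)
open import Data.Vec.Base using (Vec; lookup; map; foldr₁)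
open import Function.Base using (_$_)
open import Function.Bundles using (_⇔_; mk⇔)
open import Level using (0ℓ) renaming (suc to lsuc)
open import Relation.Binary.PropositionalEquality
  using (_≡_; _≢_; refl; sym; trans; cong; cong₂; subst; subst₂)
open import Relation.Nullary using (¬_; yes; no)
open import Relation.Unary using (Pred; _⊆_; _⊥_)

import Algebra.Properties.CommutativeMonoid.Sum ℤₚ.+-0-commutativeMonoid as ℤ-Sum
import Algebra.Properties.CommutativeSemigroup ℕₚ.*-commutativeSemigroup as ℕ-*
import Algebra.Properties.AbelianGroup ℚₚ.+-0-abelianGroup as ℚ-Group
import Algebra.Properties.CommutativeSemigroup
  (AbelianGroup.commutativeSemigroup ℚₚ.+-0-abelianGroup) as ℚ-+

-- ℝ consists of Cauchy sequences of rationals, taken up to _≃_.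

IsCauchy : (ℕ → ℚ) → Set
IsCauchy x = ∀ ε → 0ℚ ℚ.< ε →
  ∃[ N ] ∀ m n → N ℕ.≤ m → N ℕ.≤ n → ℚ.∣ x m ℚ.- x n ∣ ℚ.< ε

record ℝ : Set where
  constructor mkℝ
  field
    seq    : ℕ → ℚ
    cauchy : IsCauchy seq

open ℝ public

infix  4 _≃_ _≤_ _<_
infixl 6 _+_ _-_
infixl 7 _*_
infix  8 -_

_≤_ : ℝ → ℝ → Set
x ≤ y = ∀ ε → 0ℚ ℚ.< ε → ∃[ N ] ∀ n → N ℕ.≤ n → seq x n ℚ.≤ seq y n ℚ.+ ε

_≃_ : ℝ → ℝ → Set
x ≃ y = x ≤ y × y ≤ x

_<_ : ℝ → ℝ → Set
x < y = Σ[ ε ∈ ℚ ] 0ℚ ℚ.< ε × ∃[ N ] ∀ n → N ℕ.≤ n → seq x n ℚ.+ ε ℚ.≤ seq y n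

private
  halve : ∀ ε → 0ℚ ℚ.< ε → Σ[ δ ∈ ℚ ] 0ℚ ℚ.< δ × δ ℚ.+ δ ≡ ε
  halve ε 0<ε = ℚ.½ ℚ.* ε ,
    ℚₚ.positive⁻¹ _ {{ℚₚ.pos*pos⇒pos ℚ.½ ε {{ℚ.positive 0<ε}}}} ,
    trans (sym (ℚₚ.*-distribʳ-+ ε ℚ.½ ℚ.½)) (ℚₚ.*-identityˡ ε)

  ∣∣-sym : ∀ p q → ℚ.∣ p ℚ.- q ∣ ≡ ℚ.∣ q ℚ.- p ∣
  ∣∣-sym p q = trans (cong ℚ.∣_∣ (sym (ℚ-Group.⁻¹-anti-homo‿- q p))) (ℚₚ.∣-p∣≡∣p∣ (q ℚ.- p))

  eventuallyBounded : ∀ {x} → IsCauchy x →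
    Σ[ B ∈ ℚ ] 0ℚ ℚ.< B × ∃[ N ] ∀ n → N ℕ.≤ n → ℚ.∣ x n ∣ ℚ.≤ B
  eventuallyBounded {x} c with c 1ℚ (ℚₚ.positive⁻¹ 1ℚ)
  ... | N , h = 1ℚ ℚ.+ ℚ.∣ x N ∣ ,
    ℚₚ.+-mono-<-≤ (ℚₚ.positive⁻¹ 1ℚ) (ℚₚ.0≤∣p∣ (x N)) , N , bound
    where
    open ℚₚ.≤-Reasoning
    bound : ∀ n → N ℕ.≤ n → ℚ.∣ x n ∣ ℚ.≤ 1ℚ ℚ.+ ℚ.∣ x N ∣
    bound n N≤n = begin
      ℚ.∣ x n ∣                          ≡⟨ cong ℚ.∣_∣ (ℚ-Group.//-rightDividesˡ (x N) (x n)) ⟨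
      ℚ.∣ (x n ℚ.- x N) ℚ.+ x N ∣        ≤⟨ ℚₚ.∣p+q∣≤∣p∣+∣q∣ (x n ℚ.- x N) (x N) ⟩
      ℚ.∣ x n ℚ.- x N ∣ ℚ.+ ℚ.∣ x N ∣    ≤⟨ ℚₚ.+-monoˡ-≤ ℚ.∣ x N ∣ (ℚₚ.<⇒≤ (h n N N≤n ℕₚ.≤-refl)) ⟩
      1ℚ ℚ.+ ℚ.∣ x N ∣                   ∎

  const-cauchy : ∀ q → IsCauchy (λ _ → q)
  const-cauchy q ε 0<ε = 0 , λ _ _ _ _ →
    subst (ℚ._< ε) (sym (cong ℚ.∣_∣ (ℚₚ.+-inverseʳ q))) 0<ε

  +-cauchy : ∀ {x y} → IsCauchy x → IsCauchy y → IsCauchy (λ n → x n ℚ.+ y n)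
  +-cauchy {x} {y} cx cy ε 0<ε with halve ε 0<ε
  ... | δ , 0<δ , δ+δ≡ε with cx δ 0<δ | cy δ 0<δ
  ... | M , hx | N , hy = M ℕ.⊔ N , bound
    where
    open ℚₚ.≤-Reasoning
    lem : ∀ a b c d → (a ℚ.+ b) ℚ.- (c ℚ.+ d) ≡ (a ℚ.- c) ℚ.+ (b ℚ.- d)
    lem a b c d = trans (cong (a ℚ.+ b ℚ.+_) (ℚₚ.neg-distrib-+ c d))
                        (ℚ-+.interchange a b (ℚ.- c) (ℚ.- d))
    bound : ∀ m n → M ℕ.⊔ N ℕ.≤ m → M ℕ.⊔ N ℕ.≤ n →
            ℚ.∣ (x m ℚ.+ y m) ℚ.- (x n ℚ.+ y n) ∣ ℚ.< ε
    bound m n p q = begin-strict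
      ℚ.∣ (x m ℚ.+ y m) ℚ.- (x n ℚ.+ y n) ∣      ≡⟨ cong ℚ.∣_∣ (lem (x m) (y m) (x n) (y n)) ⟩
      ℚ.∣ (x m ℚ.- x n) ℚ.+ (y m ℚ.- y n) ∣      ≤⟨ ℚₚ.∣p+q∣≤∣p∣+∣q∣ (x m ℚ.- x n) (y m ℚ.- y n) ⟩
      ℚ.∣ x m ℚ.- x n ∣ ℚ.+ ℚ.∣ y m ℚ.- y n ∣    <⟨ ℚₚ.+-mono-<
        (hx m n (ℕₚ.m⊔n≤o⇒m≤o M N p) (ℕₚ.m⊔n≤o⇒m≤o M N q))
        (hy m n (ℕₚ.m⊔n≤o⇒n≤o M N p) (ℕₚ.m⊔n≤o⇒n≤o M N q)) ⟩
      δ ℚ.+ δ                                    ≡⟨ δ+δ≡ε ⟩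
      ε                                          ∎

  neg-cauchy : ∀ {x} → IsCauchy x → IsCauchy (λ n → ℚ.- x n)
  neg-cauchy {x} cx ε 0<ε with cx ε 0<ε
  ... | N , h = N , λ m n p q →
    subst (ℚ._< ε) (trans (sym (ℚₚ.∣-p∣≡∣p∣ (x m ℚ.- x n)))
      (cong ℚ.∣_∣ (ℚₚ.neg-distrib-+ (x m) (ℚ.- x n)))) (h m n p q)

  *-cauchy : ∀ {x y} → IsCauchy x → IsCauchy y → IsCauchy (λ n → x n ℚ.* y n)
  *-cauchy {x} {y} cx cy ε 0<ε =
    (M₁ ℕ.⊔ M₂) ℕ.⊔ (N₁ ℕ.⊔ N₂) , bound
    where
    boundX = eventuallyBounded {x} cx
    boundY = eventuallyBounded {y} cy
    A   = proj₁ boundX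
    0<A = proj₁ (proj₂ boundX)
    M₁  = proj₁ (proj₂ (proj₂ boundX))
    hA  = proj₂ (proj₂ (proj₂ boundX))
    B   = proj₁ boundY
    0<B = proj₁ (proj₂ boundY)
    M₂  = proj₁ (proj₂ (proj₂ boundY))
    hB  = proj₂ (proj₂ (proj₂ boundY))
    D = A ℚ.+ B
    instance
      A>0 = ℚ.positive 0<A
      B>0 = ℚ.positive 0<B
      A≥0 = ℚₚ.pos⇒nonNeg A
      B≥0 = ℚₚ.pos⇒nonNeg B
      D>0 = ℚₚ.pos+pos⇒pos A B
      D≢0 = ℚₚ.pos⇒nonZero D
      1/D>0 = ℚₚ.1/pos⇒pos D
      ε>0 = ℚ.positive 0<ε
    δ : ℚ
    δ = (ℚ.1/ D) ℚ.* ε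
    0<δ : 0ℚ ℚ.< δ
    0<δ = ℚₚ.positive⁻¹ δ {{ℚₚ.pos*pos⇒pos (ℚ.1/ D) ε}}
    open ℚₚ.≤-Reasoning
    lem : ∀ a b c d → a ℚ.* b ℚ.- c ℚ.* d ≡ a ℚ.* (b ℚ.- d) ℚ.+ d ℚ.* (a ℚ.- c)
    lem a b c d = begin-equality
      a ℚ.* b ℚ.- c ℚ.* d
        ≡⟨ cong (ℚ._- c ℚ.* d) (ℚ-Group.//-rightDividesˡ (a ℚ.* d) (a ℚ.* b)) ⟨
      ((a ℚ.* b ℚ.- a ℚ.* d) ℚ.+ a ℚ.* d) ℚ.- c ℚ.* d
        ≡⟨ ℚₚ.+-assoc (a ℚ.* b ℚ.- a ℚ.* d) (a ℚ.* d) (ℚ.- (c ℚ.* d)) ⟩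
      (a ℚ.* b ℚ.- a ℚ.* d) ℚ.+ (a ℚ.* d ℚ.- c ℚ.* d)
        ≡⟨ cong₂ ℚ._+_ (distrib a b d)
             (trans (cong₂ ℚ._-_ (ℚₚ.*-comm a d) (ℚₚ.*-comm c d)) (distrib d a c)) ⟩
      a ℚ.* (b ℚ.- d) ℚ.+ d ℚ.* (a ℚ.- c) ∎
      where
      distrib : ∀ p q r → p ℚ.* q ℚ.- p ℚ.* r ≡ p ℚ.* (q ℚ.- r)
      distrib p q r = trans (cong (p ℚ.* q ℚ.+_) (ℚₚ.neg-distribʳ-* p r))
                            (sym (ℚₚ.*-distribˡ-+ p q (ℚ.- r)))
    Dδ≡ε : A ℚ.* δ ℚ.+ B ℚ.* δ ≡ ε
    Dδ≡ε = trans (sym (ℚₚ.*-distribʳ-+ δ A B)) $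
           trans (sym (ℚₚ.*-assoc D (ℚ.1/ D) ε)) $
           trans (cong (ℚ._* ε) (ℚₚ.*-inverseʳ D)) (ℚₚ.*-identityˡ ε)
    product : ∀ p q K → .{{ℚ.Positive K}} → ℚ.∣ p ∣ ℚ.≤ K → ℚ.∣ q ∣ ℚ.< δ → ℚ.∣ p ℚ.* q ∣ ℚ.< K ℚ.* δ
    product p q K p≤K q<δ = begin-strict
      ℚ.∣ p ℚ.* q ∣          ≡⟨ ℚₚ.∣p*q∣≡∣p∣*∣q∣ p q ⟩
      ℚ.∣ p ∣ ℚ.* ℚ.∣ q ∣    ≤⟨ ℚₚ.*-monoʳ-≤-nonNeg ℚ.∣ q ∣ {{ℚ.nonNegative (ℚₚ.0≤∣p∣ q)}} p≤K ⟩
      K ℚ.* ℚ.∣ q ∣          <⟨ ℚₚ.*-monoʳ-<-pos K q<δ ⟩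
      K ℚ.* δ                ∎
    N₁ = proj₁ (cx δ 0<δ)
    hx = proj₂ (cx δ 0<δ)
    N₂ = proj₁ (cy δ 0<δ)
    hy = proj₂ (cy δ 0<δ)
    bound : ∀ m n → (M₁ ℕ.⊔ M₂) ℕ.⊔ (N₁ ℕ.⊔ N₂) ℕ.≤ m → (M₁ ℕ.⊔ M₂) ℕ.⊔ (N₁ ℕ.⊔ N₂) ℕ.≤ n →
            ℚ.∣ x m ℚ.* y m ℚ.- x n ℚ.* y n ∣ ℚ.< ε
    bound m n p q = begin-strict
      ℚ.∣ x m ℚ.* y m ℚ.- x n ℚ.* y n ∣
        ≡⟨ cong ℚ.∣_∣ (lem (x m) (y m) (x n) (y n)) ⟩
      ℚ.∣ x m ℚ.* (y m ℚ.- y n) ℚ.+ y n ℚ.* (x m ℚ.- x n) ∣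
        ≤⟨ ℚₚ.∣p+q∣≤∣p∣+∣q∣ (x m ℚ.* (y m ℚ.- y n)) (y n ℚ.* (x m ℚ.- x n)) ⟩
      ℚ.∣ x m ℚ.* (y m ℚ.- y n) ∣ ℚ.+ ℚ.∣ y n ℚ.* (x m ℚ.- x n) ∣
        <⟨ ℚₚ.+-mono-<
             (product (x m) (y m ℚ.- y n) A (hA m (M₁≤ p)) (hy m n (N₂≤ p) (N₂≤ q)))
             (product (y n) (x m ℚ.- x n) B (hB n (M₂≤ q)) (hx m n (N₁≤ p) (N₁≤ q))) ⟩
      A ℚ.* δ ℚ.+ B ℚ.* δ
        ≡⟨ Dδ≡ε ⟩
      ε ∎
      where
      M₁≤ : ∀ {k} → (M₁ ℕ.⊔ M₂) ℕ.⊔ (N₁ ℕ.⊔ N₂) ℕ.≤ k → M₁ ℕ.≤ k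
      M₁≤ r = ℕₚ.m⊔n≤o⇒m≤o M₁ M₂ (ℕₚ.m⊔n≤o⇒m≤o (M₁ ℕ.⊔ M₂) (N₁ ℕ.⊔ N₂) r)
      M₂≤ : ∀ {k} → (M₁ ℕ.⊔ M₂) ℕ.⊔ (N₁ ℕ.⊔ N₂) ℕ.≤ k → M₂ ℕ.≤ k
      M₂≤ r = ℕₚ.m⊔n≤o⇒n≤o M₁ M₂ (ℕₚ.m⊔n≤o⇒m≤o (M₁ ℕ.⊔ M₂) (N₁ ℕ.⊔ N₂) r)
      N₁≤ : ∀ {k} → (M₁ ℕ.⊔ M₂) ℕ.⊔ (N₁ ℕ.⊔ N₂) ℕ.≤ k → N₁ ℕ.≤ k
      N₁≤ r = ℕₚ.m⊔n≤o⇒m≤o N₁ N₂ (ℕₚ.m⊔n≤o⇒n≤o (M₁ ℕ.⊔ M₂) (N₁ ℕ.⊔ N₂) r)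
      N₂≤ : ∀ {k} → (M₁ ℕ.⊔ M₂) ℕ.⊔ (N₁ ℕ.⊔ N₂) ℕ.≤ k → N₂ ℕ.≤ k
      N₂≤ r = ℕₚ.m⊔n≤o⇒n≤o N₁ N₂ (ℕₚ.m⊔n≤o⇒n≤o (M₁ ℕ.⊔ M₂) (N₁ ℕ.⊔ N₂) r)

fromℚ : ℚ → ℝ
fromℚ q = mkℝ (λ _ → q) (const-cauchy q)

fromℕ : ℕ → ℝ
fromℕ n = fromℚ (ℤ.+ n ℚ./ 1)

0ℝ 1ℝ : ℝ
0ℝ = fromℚ 0ℚ
1ℝ = fromℚ 1ℚ

_+_ : ℝ → ℝ → ℝ
x + y = mkℝ (λ n → seq x n ℚ.+ seq y n) (+-cauchy {seq x} {seq y} (cauchy x) (cauchy y))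

-_ : ℝ → ℝ
- x = mkℝ (λ n → ℚ.- seq x n) (neg-cauchy {seq x} (cauchy x))

_-_ : ℝ → ℝ → ℝ
x - y = x + (- y)

_*_ : ℝ → ℝ → ℝ
x * y = mkℝ (λ n → seq x n ℚ.* seq y n) (*-cauchy {seq x} {seq y} (cauchy x) (cauchy y))

⌊⁴√_⌋ : ℕ → ℕ
⌊⁴√ zero  ⌋ = 0
⌊⁴√ suc N ⌋ with suc ⌊⁴√ N ⌋ ℕ.^ 4 ℕₚ.≤? suc N
... | yes _ = suc ⌊⁴√ N ⌋
... | no  _ = ⌊⁴√ N ⌋

⌊⁴√⌋-spec : ∀ N → ⌊⁴√ N ⌋ ℕ.^ 4 ℕ.≤ N × N ℕ.< suc ⌊⁴√ N ⌋ ℕ.^ 4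
⌊⁴√⌋-spec zero = ℕ.z≤n , ℕ.s≤s ℕ.z≤n
⌊⁴√⌋-spec (suc N) with suc ⌊⁴√ N ⌋ ℕ.^ 4 ℕₚ.≤? suc N | ⌊⁴√⌋-spec N
... | yes p | _ , N<  = p , ℕₚ.≤-<-trans N< (ℕₚ.^-monoˡ-< 4 (ℕₚ.n<1+n (suc ⌊⁴√ N ⌋)))
... | no ¬p | ≤N , _  = ℕₚ.m≤n⇒m≤1+n ≤N , ℕₚ.≰⇒> ¬p

-- The k-th term is the largest multiple of 1/(k+1) not exceeding n^(1/4).
fourthRootSeq : ℕ → ℕ → ℚ
fourthRootSeq n k = ℤ.+ ⌊⁴√ n ℕ.* suc k ℕ.^ 4 ⌋ ℚ./ suc k

private
  /-mono-≤ : ∀ a b c d → a ℕ.* suc d ℕ.≤ c ℕ.* suc b → ℤ.+ a ℚ./ suc b ℚ.≤ ℤ.+ c ℚ./ suc d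
  /-mono-≤ a b c d h = ℚₚ.toℚᵘ-cancel-≤
    (ℚᵘₚ.≤-respˡ-≃ (ℚᵘₚ.≃-sym (ℚₚ.toℚᵘ-fromℚᵘ (ℚᵘ.mkℚᵘ (ℤ.+ a) b)))
    (ℚᵘₚ.≤-respʳ-≃ (ℚᵘₚ.≃-sym (ℚₚ.toℚᵘ-fromℚᵘ (ℚᵘ.mkℚᵘ (ℤ.+ c) d)))
    (ℚᵘ.*≤* (subst₂ ℤ._≤_ (ℤₚ.pos-* a (suc d)) (ℤₚ.pos-* c (suc b)) (ℤ.+≤+ h)))))

  /-mono-< : ∀ a b c d → a ℕ.* suc d ℕ.< c ℕ.* suc b → ℤ.+ a ℚ./ suc b ℚ.< ℤ.+ c ℚ./ suc d
  /-mono-< a b c d h = ℚₚ.toℚᵘ-cancel-<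
    (ℚᵘₚ.<-respˡ-≃ (ℚᵘₚ.≃-sym (ℚₚ.toℚᵘ-fromℚᵘ (ℚᵘ.mkℚᵘ (ℤ.+ a) b)))
    (ℚᵘₚ.<-respʳ-≃ (ℚᵘₚ.≃-sym (ℚₚ.toℚᵘ-fromℚᵘ (ℚᵘ.mkℚᵘ (ℤ.+ c) d)))
    (ℚᵘ.*<* (subst₂ ℤ._<_ (ℤₚ.pos-* a (suc d)) (ℤₚ.pos-* c (suc b)) (ℤ.+<+ h)))))

  archimedean : ∀ ε → 0ℚ ℚ.< ε → ∃[ M ] ℤ.+ 1 ℚ./ suc M ℚ.< ε
  archimedean ε 0<ε with ℚ.positive 0<ε
  archimedean ε@(mkℚ ℤ.+[1+ p ] d _) 0<ε | _ = suc d ,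
    subst (ℤ.+ 1 ℚ./ suc (suc d) ℚ.<_) (ℚₚ.↥p/↧p≡p ε)
      (/-mono-< 1 (suc d) (suc p) d
        (ℕₚ.<-≤-trans (subst (ℕ._< suc (suc d)) (sym (ℕₚ.*-identityˡ (suc d))) (ℕₚ.n<1+n _))
                      (ℕₚ.m≤n*m (suc (suc d)) (suc p))))

  suc-/ : ∀ b k → ℤ.+ suc b ℚ./ suc k ≡ ℤ.+ b ℚ./ suc k ℚ.+ ℤ.+ 1 ℚ./ suc k
  suc-/ b k = ℚₚ.toℚᵘ-injective (begin-equality
      ℚ.toℚᵘ (ℤ.+ suc b ℚ./ suc k)
        ≃⟨ ℚₚ.toℚᵘ-fromℚᵘ (ℚᵘ.mkℚᵘ (ℤ.+ suc b) k) ⟩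
      ℚᵘ.mkℚᵘ (ℤ.+ suc b) k
        ≃⟨ ℚᵘ.*≡* (trans (sym (ℤₚ.pos-* (suc b) (K ℕ.* K)))
             (trans (cong ℤ.+_ (lem b K)) (trans (ℤₚ.pos-* (b ℕ.* K ℕ.+ 1 ℕ.* K) K)
             (cong (ℤ._* ℤ.+ K) (trans (ℤₚ.pos-+ (b ℕ.* K) (1 ℕ.* K)) (cong₂ ℤ._+_ (ℤₚ.pos-* b K) (ℤₚ.pos-* 1 K))))))) ⟩
      ℚᵘ.mkℚᵘ (ℤ.+ b) k ℚᵘ.+ ℚᵘ.mkℚᵘ (ℤ.+ 1) k
        ≃⟨ ℚᵘₚ.+-cong (ℚₚ.toℚᵘ-fromℚᵘ (ℚᵘ.mkℚᵘ (ℤ.+ b) k)) (ℚₚ.toℚᵘ-fromℚᵘ (ℚᵘ.mkℚᵘ (ℤ.+ 1) k)) ⟨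
      ℚ.toℚᵘ (ℤ.+ b ℚ./ suc k) ℚᵘ.+ ℚ.toℚᵘ (ℤ.+ 1 ℚ./ suc k)
        ≃⟨ ℚₚ.toℚᵘ-homo-+ (ℤ.+ b ℚ./ suc k) (ℤ.+ 1 ℚ./ suc k) ⟨
      ℚ.toℚᵘ (ℤ.+ b ℚ./ suc k ℚ.+ ℤ.+ 1 ℚ./ suc k) ∎)
    where
    open ℚᵘₚ.≤-Reasoning
    K = suc k
    lem : ∀ b K → suc b ℕ.* (K ℕ.* K) ≡ (b ℕ.* K ℕ.+ 1 ℕ.* K) ℕ.* K
    lem b K = trans (sym (ℕₚ.*-assoc (suc b) K K))
      (cong (ℕ._* K) (trans (ℕₚ.+-comm K (b ℕ.* K))
                            (cong (b ℕ.* K ℕ.+_) (sym (ℕₚ.*-identityˡ K)))))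

  ∣p-q∣≤ : ∀ {p q δ} → p ℚ.≤ q ℚ.+ δ → q ℚ.≤ p ℚ.+ δ → ℚ.∣ p ℚ.- q ∣ ℚ.≤ δ
  ∣p-q∣≤ {p} {q} {δ} p≤ q≤ with ℚₚ.∣p∣≡p∨∣p∣≡-p (p ℚ.- q)
  ... | inj₁ eq = subst₂ ℚ._≤_ (sym eq) (ℚ-Group.xyx⁻¹≈y q δ) (ℚₚ.+-monoˡ-≤ (ℚ.- q) p≤)
  ... | inj₂ eq = subst₂ ℚ._≤_ (trans (sym (ℚ-Group.⁻¹-anti-homo‿- p q)) (sym eq))
    (ℚ-Group.xyx⁻¹≈y p δ) (ℚₚ.+-monoˡ-≤ (ℚ.- p) q≤)

  ^-distribʳ-* : ∀ x y k → (x ℕ.* y) ℕ.^ k ≡ x ℕ.^ k ℕ.* y ℕ.^ k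
  ^-distribʳ-* x y zero    = refl
  ^-distribʳ-* x y (suc k) = trans (cong (x ℕ.* y ℕ.*_) (^-distribʳ-* x y k))
                                   (ℕ-*.interchange x y (x ℕ.^ k) (y ℕ.^ k))

  fourthRoot-cross : ∀ n j k →
    ⌊⁴√ n ℕ.* suc j ℕ.^ 4 ⌋ ℕ.* suc k ℕ.≤ suc ⌊⁴√ n ℕ.* suc k ℕ.^ 4 ⌋ ℕ.* suc j
  fourthRoot-cross n j k = ℕₚ.≮⇒≥ λ lt → ℕₚ.<-irrefl refl (begin-strict
      (suc b ℕ.* J) ℕ.^ 4           <⟨ ℕₚ.^-monoˡ-< 4 lt ⟩
      (a ℕ.* K) ℕ.^ 4               ≡⟨ ^-distribʳ-* a K 4 ⟩
      a ℕ.^ 4 ℕ.* K ℕ.^ 4           ≤⟨ ℕₚ.*-monoˡ-≤ (K ℕ.^ 4) (proj₁ (⌊⁴√⌋-spec (n ℕ.* J ℕ.^ 4))) ⟩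
      n ℕ.* J ℕ.^ 4 ℕ.* K ℕ.^ 4     ≡⟨ ℕ-*.xy∙z≈xz∙y n (J ℕ.^ 4) (K ℕ.^ 4) ⟩
      n ℕ.* K ℕ.^ 4 ℕ.* J ℕ.^ 4     ≤⟨ ℕₚ.*-monoˡ-≤ (J ℕ.^ 4) (ℕₚ.<⇒≤ (proj₂ (⌊⁴√⌋-spec (n ℕ.* K ℕ.^ 4)))) ⟩
      suc b ℕ.^ 4 ℕ.* J ℕ.^ 4       ≡⟨ ^-distribʳ-* (suc b) J 4 ⟨
      (suc b ℕ.* J) ℕ.^ 4           ∎)
    where
    open ℕₚ.≤-Reasoning
    J = suc j
    K = suc k
    a = ⌊⁴√ n ℕ.* J ℕ.^ 4 ⌋
    b = ⌊⁴√ n ℕ.* K ℕ.^ 4 ⌋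

  fourthRoot-cauchy : ∀ n → IsCauchy (fourthRootSeq n)
  fourthRoot-cauchy n ε 0<ε = M , λ j k M≤j M≤k →
    ℚₚ.≤-<-trans (∣p-q∣≤ {fourthRootSeq n j} {fourthRootSeq n k} {ℤ.+ 1 ℚ./ suc M}
                   (close j k M≤k) (close k j M≤j))
                 (proj₂ (archimedean ε 0<ε))
    where
    M = proj₁ (archimedean ε 0<ε)
    open ℚₚ.≤-Reasoning
    close : ∀ j k → M ℕ.≤ k → fourthRootSeq n j ℚ.≤ fourthRootSeq n k ℚ.+ ℤ.+ 1 ℚ./ suc M
    close j k M≤k = begin
      fourthRootSeq n j
        ≤⟨ /-mono-≤ ⌊⁴√ n ℕ.* suc j ℕ.^ 4 ⌋ j (suc ⌊⁴√ n ℕ.* suc k ℕ.^ 4 ⌋) k (fourthRoot-cross n j k) ⟩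
      ℤ.+ suc ⌊⁴√ n ℕ.* suc k ℕ.^ 4 ⌋ ℚ./ suc k
        ≡⟨ suc-/ ⌊⁴√ n ℕ.* suc k ℕ.^ 4 ⌋ k ⟩
      fourthRootSeq n k ℚ.+ ℤ.+ 1 ℚ./ suc k
        ≤⟨ ℚₚ.+-monoʳ-≤ (fourthRootSeq n k) (/-mono-≤ 1 k 1 M (ℕₚ.*-monoʳ-≤ 1 (ℕ.s≤s M≤k))) ⟩
      fourthRootSeq n k ℚ.+ ℤ.+ 1 ℚ./ suc M ∎

infix 9 _^¼

_^¼ : ℕ → ℝ
n ^¼ = mkℝ (fourthRootSeq n) (fourthRoot-cauchy n)

Point : Set
Point = ℝ × ℝ

infix 4 _≃ₚ_

_≃ₚ_ : Point → Point → Set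
(x , y) ≃ₚ (x′ , y′) = x ≃ x′ × y ≃ y′

Collinear : Point → Point → Point → Set
Collinear p q r = ∃[ a ] ∃[ b ] ∃[ c ]
  ¬ (a ≃ 0ℝ × b ≃ 0ℝ) × OnLine a b c p × OnLine a b c q × OnLine a b c r
  where
  OnLine : ℝ → ℝ → ℝ → Point → Set
  OnLine a b c (x , y) = a * x + b * y ≃ c

Segment : Point → Point → Pred Point 0ℓ
Segment (x₁ , y₁) (x₂ , y₂) q = ∃[ t ] 0ℝ ≤ t × t ≤ 1ℝ ×
  q ≃ₚ ((1ℝ - t) * x₁ + t * x₂ , (1ℝ - t) * y₁ + t * y₂)

-- As Segment is closed under _≃ₚ_, so is every convex set.
Convex : Pred Point 0ℓ → Set
Convex C = ∀ {p q} → C p → C q → Segment p q ⊆ C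

ConvexHull : Pred Point 0ℓ → Pred Point (lsuc 0ℓ)
ConvexHull Y q = ∀ C → Convex C → Y ⊆ C → C q

record PointSet (n : ℕ) : Set where
  field
    point    : Fin n → Point
    distinct : ∀ {i j} → point i ≃ₚ point j → i ≡ j

open PointSet public

GeneralPosition : ∀ {n} → PointSet n → Set
GeneralPosition S = ∀ {i j k} → i ≢ j → j ≢ k → i ≢ k →
  ¬ Collinear (point S i) (point S j) (point S k)

-- Subsets of S are given by subsets of its index set; this is the
-- corresponding set of points of the plane.
points : ∀ {n} → PointSet n → Subset n → Pred Point 0ℓ
points S Y q = ∃[ i ] i ∈ Y × q ≃ₚ point S i

-- Red is +, blue is -.
Coloring : ℕ → Set
Coloring n = Fin n → Sign

disc : ∀ {n} → Coloring n → Subset n → ℕ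
disc χ Y = ℤ.∣ ℤ-Sum.sum (λ i → if lookup Y i then χ i ℤ.◃ 1 else ℤ.0ℤ) ∣

IsIsland : ∀ {n} → PointSet n → Subset n → Set₁
IsIsland S I = Σ[ C ∈ Pred Point 0ℓ ] Convex C × (∀ i → i ∈ I ⇔ C (point S i))

record ConvexPartition {n} (S : PointSet n) : Set₁ where
  field
    {size-1}      : ℕ
    blocks        : Vec (Subset n) (suc size-1)
    nonempty      : ∀ b → Nonempty (lookup blocks b)
    partition     : ∀ i → ∃! _≡_ λ b → i ∈ lookup blocks b
    island        : ∀ b → IsIsland S (lookup blocks b)
    disjointHulls : ∀ {b c} → b ≢ c →
      ConvexHull (points S (lookup blocks b)) ⊥ ConvexHull (points S (lookup blocks c))

open ConvexPartition public

discᴾ : ∀ {n} {S : PointSet n} → Coloring n → ConvexPartition S → ℕ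
discᴾ χ Π = foldr₁ ℕ._⊓_ (map (disc χ) (blocks Π))

IsCoarseness : ∀ {n} → PointSet n → Coloring n → ℕ → Set₁
IsCoarseness S χ c = (Σ[ Π ∈ ConvexPartition S ] discᴾ χ Π ≡ c)
                   × (∀ (Π : ConvexPartition S) → discᴾ χ Π ℕ.≤ c)

-- Constructively the maximum of disc(Π) over Π need not be computable,
-- since the order of ℝ is undecidable. "The coarseness is at least t" is
-- therefore expressed by a partition of discrepancy at least t;
-- coarsenessAtLeast⇔ shows that this agrees with comparing t to the maximum.
CoarsenessAtLeast : ∀ {n} → PointSet n → Coloring n → ℝ → Set₁
CoarsenessAtLeast S χ t = Σ[ Π ∈ ConvexPartition S ] t ≤ fromℕ (discᴾ χ Π)

coarsenessAtLeast⇔ : ∀ {n} {S : PointSet n} {χ c} → IsCoarseness S χ c →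
  ∀ t → CoarsenessAtLeast S χ t ⇔ t ≤ fromℕ c
coarsenessAtLeast⇔ {S = S} {χ} {c} ((Π₀ , Π₀≡c) , Π≤c) t = mk⇔ to from
  where
  to : CoarsenessAtLeast S χ t → t ≤ fromℕ c
  to (Π , t≤Π) ε 0<ε = proj₁ (t≤Π ε 0<ε) , λ n N≤n →
    ℚₚ.≤-trans (proj₂ (t≤Π ε 0<ε) n N≤n) (ℚₚ.+-monoˡ-≤ ε
      (/-mono-≤ (discᴾ χ Π) 0 c 0 (ℕₚ.*-monoˡ-≤ 1 (Π≤c Π))))
  from : t ≤ fromℕ c → CoarsenessAtLeast S χ t
  from t≤c = Π₀ , subst (λ d → t ≤ fromℕ d) (sym Π₀≡c) t≤c

{-# OPTIONS --safe #-}
module Submission where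

-- A half-plane of discrepancy 2r gives coarseness at least r: either the whole set
-- has discrepancy at least r, or the half-plane and its complement both do. So it
-- suffices that every coloring of a perturbed m × m grid, n = m², has a half-plane of
-- discrepancy of order √m = n^(1/4), which is shown by Alexander's finite differencing.
-- Put w = m! and M = 4 w. For a, b < M let H(c) be the signed sum over the half-plane
-- M y + (a + b) x + 2 w ≥ c, and sum (H(c) - 2 H(c + w) + H(c + 2 w))² over a, b and c.
-- This is a quadratic form in the coloring with coefficients
--   K(dx, dy) = Σ_{a, b} κ(M dy + (a + b) dx),
-- where κ is a second difference of the hat function Λ. As dx divides w, the double sum
-- telescopes to boundary terms which vanish unless dy, dy + dx or dy + 2 dx is zero, and
-- which are small enough for the off-diagonal part of each row to be at most half of
-- K(0, 0) = 2 w M². Hence the form is at least n w M². As there are only O(w m) values of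
-- c, one of the second differences is of order √m.

-- The boundary terms are estimated by absolute values only, without using cancellation among them.
-- Under such an estimate a single averaging parameter would leave, for two points at column
-- distance d, a bound of relative size 1/d, whose sum over the columns grows like log m. Averaging
-- over a and b separately gives 1/d², whose sum is bounded. Each averaging uses up one difference
-- with step w, which is why second differences are taken: κ has exactly two to trade.
--
-- The factorial keeps everything in ℤ, since w / d is exact for every column distance d. Its size
-- costs nothing: the lower and the upper bound for the sum of squares both carry the factor w M²,
-- which cancels.
--
-- In the half-plane with parameters s = a + b and c the boundary line has slope -s / M, between -2
-- and 0, and the three exceptional conditions on (dx, dy) are the zeros of M dy + s dx at s = 0, M
-- and 2 M.

module Discrepancy where

  open import Data.Empty using (⊥-elim)
  open import Data.Fin.Base using (Fin; zero; suc; toℕ; punchIn; combine; _↑ˡ_; _↑ʳ_; remQuot)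
  open import Data.Fin.Properties using (toℕ<n; toℕ-injective; remQuot-combine; combine-remQuot; punchInᵢ≢i)
  open import Data.Integer.Base using (ℤ; +_; -[1+_]; 0ℤ; 1ℤ; _+_; _*_; _-_; -_; _≤_; ∣_∣; +≤+; -≤-)
  import Data.Integer.Properties as ℤ
  open import Data.Integer.Tactic.RingSolver using (solve-∀)
  open import Data.Nat.Base as ℕ using (ℕ; zero; suc; z≤n; s≤s; _∸_; _⊓_; _!)
  import Data.Nat.Divisibility as ℕ
  import Data.Nat.DivMod as ℕ
  import Data.Nat.Properties as ℕ
  import Data.Nat.Tactic.RingSolver as ℕ-Solver
  open import Data.Product using (_×_; _,_; proj₁; proj₂)
  open import Data.Sum.Base using (inj₁; inj₂)
  open import Function.Base using (_∘_)
  open import Relation.Binary.PropositionalEquality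
    using (_≡_; _≢_; _≗_; refl; sym; trans; cong; cong₂; subst; module ≡-Reasoning)
  open import Relation.Nullary using (¬_; yes; no)
  open import Algebra.Properties.Semiring.Sum ℤ.+-*-semiring
    using (sum; ∑-distrib-+; ∑-comm; sum-cong-≗; *-distribˡ-sum; *-distribʳ-sum; sum-remove)

  -- Finite sums of integers.

  sum-cong : ∀ n {f g : Fin n → ℤ} → (∀ i → f i ≡ g i) → sum f ≡ sum g
  sum-cong n = sum-cong-≗ {n}

  sum-mono-≤ : ∀ {n} {f g : Fin n → ℤ} → (∀ i → f i ≤ g i) → sum f ≤ sum g
  sum-mono-≤ {zero}  f≤g = ℤ.≤-refl
  sum-mono-≤ {suc n} f≤g = ℤ.+-mono-≤ (f≤g zero) (sum-mono-≤ (f≤g ∘ suc))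

  sum-const : ∀ n c → sum {n} (λ _ → c) ≡ + n * c
  sum-const zero    c = sym (ℤ.*-zeroˡ c)
  sum-const (suc n) c = trans (cong (_+_ c) (sum-const n c)) (sym (ℤ.suc-* (+ n) c))

  sum-zero : ∀ n → sum {n} (λ _ → 0ℤ) ≡ 0ℤ
  sum-zero n = trans (sum-const n 0ℤ) (ℤ.*-zeroʳ (+ n))

  sum-≤-const : ∀ {n} {f : Fin n → ℤ} c → (∀ i → f i ≤ c) → sum f ≤ + n * c
  sum-≤-const {n} c f≤c = ℤ.≤-trans (sum-mono-≤ f≤c) (ℤ.≤-reflexive (sum-const n c))

  sum-const-≤ : ∀ {n} {f : Fin n → ℤ} c → (∀ i → c ≤ f i) → + n * c ≤ sum f
  sum-const-≤ {n} c c≤f = ℤ.≤-trans (ℤ.≤-reflexive (sym (sum-const n c))) (sum-mono-≤ c≤f)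

  sum-↑ : ∀ m {n} (f : Fin (m ℕ.+ n) → ℤ) →
    sum f ≡ sum (λ i → f (i ↑ˡ n)) + sum (λ i → f (m ↑ʳ i))
  sum-↑ zero    f = sym (ℤ.+-identityˡ _)
  sum-↑ (suc m) f = trans (cong (_+_ (f zero)) (sum-↑ m (f ∘ suc))) (sym (ℤ.+-assoc (f zero) _ _))

  sum-combine : ∀ m n (f : Fin (m ℕ.* n) → ℤ) →
    sum f ≡ sum {m} (λ i → sum {n} (λ j → f (combine i j)))
  sum-combine zero    n f = refl
  sum-combine (suc m) n f = trans (sum-↑ n f)
    (cong (_+_ (sum (λ j → f (j ↑ˡ (m ℕ.* n))))) (sum-combine m n (λ k → f (n ↑ʳ k))))

  -- Sums over n terms of an arithmetic progression with step d, and their telescoping.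

  A : ℕ → ℤ → (ℤ → ℤ) → ℤ → ℤ
  A zero    d φ z = 0ℤ
  A (suc n) d φ z = φ z + A n d φ (z + d)

  Δ : ℤ → (ℤ → ℤ) → ℤ → ℤ
  Δ h φ z = φ (z + h) - φ z

  A≡sum : ∀ n d φ z → A n d φ z ≡ sum {n} (λ i → φ (z + + toℕ i * d))
  A≡sum zero    d φ z = refl
  A≡sum (suc n) d φ z = cong₂ _+_ (cong φ (lem₀ z d))
    (trans (A≡sum n d φ (z + d)) (sum-cong n (λ i → cong φ (lem z d (+ toℕ i)))))
    where
    lem₀ : ∀ z d → z ≡ z + 0ℤ * d
    lem₀ = solve-∀
    lem : ∀ z d i → z + d + i * d ≡ z + (1ℤ + i) * d
    lem = solve-∀

  A-cong : ∀ n d {φ ψ} → φ ≗ ψ → A n d φ ≗ A n d ψ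
  A-cong zero    d φ≗ψ z = refl
  A-cong (suc n) d φ≗ψ z = cong₂ _+_ (φ≗ψ z) (A-cong n d φ≗ψ (z + d))

  A-shift : ∀ n d h φ z → A n d (λ y → φ (y + h)) z ≡ A n d φ (z + h)
  A-shift zero    d h φ z = refl
  A-shift (suc n) d h φ z = cong (_+_ (φ (z + h)))
    (trans (A-shift n d h φ (z + d)) (cong (A n d φ) (lem z d h)))
    where
    lem : ∀ z d h → z + d + h ≡ z + h + d
    lem = solve-∀

  A-linear : ∀ n d α β φ ψ z → A n d (λ y → α * φ y + β * ψ y) z ≡ α * A n d φ z + β * A n d ψ z
  A-linear zero    d α β φ ψ z = lem α β
    where
    lem : ∀ α β → 0ℤ ≡ α * 0ℤ + β * 0ℤ
    lem = solve-∀
  A-linear (suc n) d α β φ ψ z = trans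
    (cong (_+_ (α * φ z + β * ψ z)) (A-linear n d α β φ ψ (z + d)))
    (lem α β (φ z) (ψ z) (A n d φ (z + d)) (A n d ψ (z + d)))
    where
    lem : ∀ α β a b c e → α * a + β * b + (α * c + β * e) ≡ α * (a + c) + β * (b + e)
    lem = solve-∀

  A-Δ : ∀ n d h φ z → A n d (Δ h φ) z ≡ Δ h (A n d φ) z
  A-Δ n d h φ z = begin
    A n d (Δ h φ) z
      ≡⟨ A-cong n d (λ y → lem (φ (y + h)) (φ y)) z ⟩
    A n d (λ y → 1ℤ * φ (y + h) + - 1ℤ * φ y) z
      ≡⟨ A-linear n d 1ℤ (- 1ℤ) (λ y → φ (y + h)) φ z ⟩
    1ℤ * A n d (λ y → φ (y + h)) z + - 1ℤ * A n d φ z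
      ≡⟨ lem (A n d (λ y → φ (y + h)) z) (A n d φ z) ⟨
    A n d (λ y → φ (y + h)) z - A n d φ z
      ≡⟨ cong (_- A n d φ z) (A-shift n d h φ z) ⟩
    Δ h (A n d φ) z ∎
    where
    open ≡-Reasoning
    lem : ∀ a b → a - b ≡ 1ℤ * a + - 1ℤ * b
    lem = solve-∀

  A-+ : ∀ m n d φ z → A (m ℕ.+ n) d φ z ≡ A m d φ z + A n d φ (z + + m * d)
  A-+ zero    n d φ z = trans (cong (A n d φ) (lem z d)) (sym (ℤ.+-identityˡ _))
    where
    lem : ∀ z d → z ≡ z + 0ℤ * d
    lem = solve-∀
  A-+ (suc m) n d φ z = begin
    φ z + A (m ℕ.+ n) d φ (z + d)                                ≡⟨ cong (_+_ (φ z)) (A-+ m n d φ (z + d)) ⟩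
    φ z + (A m d φ (z + d) + A n d φ (z + d + + m * d))          ≡⟨ ℤ.+-assoc (φ z) _ _ ⟨
    φ z + A m d φ (z + d) + A n d φ (z + d + + m * d)            ≡⟨ cong (λ y → φ z + A m d φ (z + d) + A n d φ y) (lem z d (+ m)) ⟩
    φ z + A m d φ (z + d) + A n d φ (z + + suc m * d)            ∎
    where
    open ≡-Reasoning
    lem : ∀ z d m → z + d + m * d ≡ z + (1ℤ + m) * d
    lem = solve-∀

  A-commute : ∀ m n d φ z → A m d (A n d φ) z ≡ A n d (A m d φ) z
  A-commute m n d φ z = begin
    A m d (A n d φ) z
      ≡⟨ expand m n z ⟩
    sum {m} (λ i → sum {n} (λ j → φ (z + + toℕ i * d + + toℕ j * d)))
      ≡⟨ ∑-comm {m} {n} (λ i j → φ (z + + toℕ i * d + + toℕ j * d)) ⟩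
    sum {n} (λ j → sum {m} (λ i → φ (z + + toℕ i * d + + toℕ j * d)))
      ≡⟨ sum-cong n (λ j → sum-cong m (λ i → cong φ (lem z (+ toℕ i * d) (+ toℕ j * d)))) ⟩
    sum {n} (λ j → sum {m} (λ i → φ (z + + toℕ j * d + + toℕ i * d)))
      ≡⟨ expand n m z ⟨
    A n d (A m d φ) z ∎
    where
    open ≡-Reasoning
    lem : ∀ z a b → z + a + b ≡ z + b + a
    lem = solve-∀
    expand : ∀ m n z → A m d (A n d φ) z ≡ sum {m} (λ i → sum {n} (λ j → φ (z + + toℕ i * d + + toℕ j * d)))
    expand m n z = trans (A≡sum m d (A n d φ) z) (sum-cong m (λ i → A≡sum n d φ (z + + toℕ i * d)))

  -- Both sides are A (m + n) - A m - A n.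
  A-telescope : ∀ m n d φ z → A m d (Δ (+ n * d) φ) z ≡ A n d (Δ (+ m * d) φ) z
  A-telescope m n d φ z = begin
    A m d (Δ (+ n * d) φ) z                     ≡⟨ A-Δ m d (+ n * d) φ z ⟩
    A m d φ (z + + n * d) - A m d φ z           ≡⟨ lem (A n d φ z) (A m d φ (z + + n * d)) (A m d φ z) ⟩
    A n d φ z + A m d φ (z + + n * d) - A n d φ z - A m d φ z
      ≡⟨ cong (λ t → t - A n d φ z - A m d φ z) (A-+ n m d φ z) ⟨
    A (n ℕ.+ m) d φ z - A n d φ z - A m d φ z
      ≡⟨ cong (λ k → A k d φ z - A n d φ z - A m d φ z) (ℕ.+-comm n m) ⟩
    A (m ℕ.+ n) d φ z - A n d φ z - A m d φ z
      ≡⟨ cong (λ t → t - A n d φ z - A m d φ z) (A-+ m n d φ z) ⟩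
    A m d φ z + A n d φ (z + + m * d) - A n d φ z - A m d φ z
      ≡⟨ lem′ (A m d φ z) (A n d φ (z + + m * d)) (A n d φ z) ⟩
    A n d φ (z + + m * d) - A n d φ z           ≡⟨ A-Δ n d (+ m * d) φ z ⟨
    A n d (Δ (+ m * d) φ) z                     ∎
    where
    open ≡-Reasoning
    lem : ∀ a b c → b - c ≡ a + b - a - c
    lem = solve-∀
    lem′ : ∀ a b c → a + b - c - a ≡ b - c
    lem′ = solve-∀

  A-≤ : ∀ n d φ z c → (∀ {i} → i ℕ.< n → φ (z + + i * d) ≤ c) → A n d φ z ≤ + n * c
  A-≤ n d φ z c φ≤c = subst (_≤ + n * c) (sym (A≡sum n d φ z)) (sum-≤-const c (λ i → φ≤c (toℕ<n i)))

  A-nonneg : ∀ n d φ z → (∀ y → 0ℤ ≤ φ y) → 0ℤ ≤ A n d φ z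
  A-nonneg zero    d φ z 0≤φ = ℤ.≤-refl
  A-nonneg (suc n) d φ z 0≤φ = ℤ.+-mono-≤ (0≤φ z) (A-nonneg n d φ (z + d) 0≤φ)

  -- `A-telescope` trades one sum against one difference; as sums with the same step commute, the
  -- second pair can be brought together and traded too. In use n = `M` and `e * d` = `w`, so M²
  -- terms become e² terms with differences of the long step M d.
  A²-telescope : ∀ n e d φ z →
    A n d (A n d (Δ (+ e * d) (Δ (+ e * d) φ))) z ≡ A e d (A e d (Δ (+ n * d) (Δ (+ n * d) φ))) z
  A²-telescope n e d φ z = begin
    A n d (A n d (Δ w (Δ w φ))) z   ≡⟨ A-cong n d (A-telescope n e d (Δ w φ)) z ⟩
    A n d (A e d (Δ N (Δ w φ))) z   ≡⟨ A-commute n e d (Δ N (Δ w φ)) z ⟩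
    A e d (A n d (Δ N (Δ w φ))) z   ≡⟨ A-cong e d (λ y → trans (A-Δ n d N (Δ w φ) y)
        (trans (cong₂ _-_ (A-telescope n e d φ (y + N)) (A-telescope n e d φ y)) (sym (A-Δ e d N (Δ N φ) y)))) z ⟩
    A e d (A e d (Δ N (Δ N φ))) z   ∎
    where
    open ≡-Reasoning
    w = + e * d
    N = + n * d

  -- The hat function and its second difference.

  module Kernel (w : ℕ) where

    -- The autocorrelation of the indicator of w consecutive integers. Truncated subtraction cuts it
    -- off at distance w.
    Λ : ℤ → ℤ
    Λ z = + (w ∸ ∣ z ∣)

    -- The autocorrelation of the pattern -1 on w consecutive integers, +1 on the next w. It is
    -- written with two shifted `Δ (+ w)`, and not in the symmetric form of `κ≡`, so that
    -- `A²-telescope` applies to it directly.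
    κ : ℤ → ℤ
    κ z = - Δ (+ w) (Δ (+ w) Λ) (z - + w)

    0≤Λ : ∀ z → 0ℤ ≤ Λ z
    0≤Λ z = +≤+ z≤n

    Λ≤w : ∀ z → Λ z ≤ + w
    Λ≤w z = +≤+ (ℕ.m∸n≤m w ∣ z ∣)

    Λ≡0 : ∀ {z} → w ℕ.≤ ∣ z ∣ → Λ z ≡ 0ℤ
    Λ≡0 w≤z = cong +_ (ℕ.m≤n⇒m∸n≡0 w≤z)

    κ≡ : ∀ z → κ z ≡ (Λ z + Λ z) - Λ (z + + w) - Λ (z - + w)
    κ≡ z = trans
      (cong₂ (λ a b → - (Λ a - Λ b - (Λ b - Λ (z - + w)))) (lem₁ z (+ w)) (lem₂ z (+ w)))
      (lem₃ (Λ (z + + w)) (Λ z) (Λ (z - + w)))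
      where
      lem₁ : ∀ z w → z - w + w + w ≡ z + w
      lem₁ = solve-∀
      lem₂ : ∀ z w → z - w + w ≡ z
      lem₂ = solve-∀
      lem₃ : ∀ a b c → - (a - b - (b - c)) ≡ b + b - a - c
      lem₃ = solve-∀

    Λ-even : ∀ z → Λ (- z) ≡ Λ z
    Λ-even z = cong (λ k → + (w ∸ k)) (ℤ.∣-i∣≡∣i∣ z)

    κ-even : ∀ z → κ (- z) ≡ κ z
    κ-even z = begin
      κ (- z)                                           ≡⟨ κ≡ (- z) ⟩
      Λ (- z) + Λ (- z) - Λ (- z + + w) - Λ (- z - + w)
        ≡⟨ cong₂ (λ a b → Λ (- z) + Λ (- z) - Λ a - Λ b) (lem₁ z (+ w)) (lem₂ z (+ w)) ⟩
      Λ (- z) + Λ (- z) - Λ (- (z - + w)) - Λ (- (z + + w))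
        ≡⟨ cong₂ (λ a b → a + a - b - Λ (- (z + + w))) (Λ-even z) (Λ-even (z - + w)) ⟩
      Λ z + Λ z - Λ (z - + w) - Λ (- (z + + w))
        ≡⟨ cong (λ a → Λ z + Λ z - Λ (z - + w) - a) (Λ-even (z + + w)) ⟩
      Λ z + Λ z - Λ (z - + w) - Λ (z + + w)             ≡⟨ lem₃ (Λ z + Λ z) (Λ (z - + w)) (Λ (z + + w)) ⟩
      Λ z + Λ z - Λ (z + + w) - Λ (z - + w)             ≡⟨ κ≡ z ⟨
      κ z                                               ∎
      where
      open ≡-Reasoning
      lem₁ : ∀ z w → - z + w ≡ - (z - w)
      lem₁ = solve-∀
      lem₂ : ∀ z w → - z - w ≡ - (z + w)
      lem₂ = solve-∀
      lem₃ : ∀ a b c → a - b - c ≡ a - c - b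
      lem₃ = solve-∀

    κ0 : κ 0ℤ ≡ + w + + w
    κ0 = begin
      κ 0ℤ                                          ≡⟨ κ≡ 0ℤ ⟩
      + w + + w - Λ (0ℤ + + w) - Λ (0ℤ - + w)
        ≡⟨ cong₂ (λ a b → + w + + w - a - b) (Λ≡0 {0ℤ + + w} ℕ.≤-refl)
             (Λ≡0 {0ℤ - + w} (ℕ.≤-reflexive (sym (trans (cong ∣_∣ (ℤ.+-identityˡ (- + w))) (ℤ.∣-i∣≡∣i∣ (+ w)))))) ⟩
      + w + + w - 0ℤ - 0ℤ                           ≡⟨ lem (+ w + + w) ⟩
      + w + + w                                     ∎
      where
      open ≡-Reasoning
      lem : ∀ a → a - 0ℤ - 0ℤ ≡ a
      lem = solve-∀

    κ-far : ∀ z → 2 ℕ.* w ℕ.≤ ∣ z ∣ → κ z ≡ 0ℤ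
    κ-far z 2w≤z = begin
      κ z                                       ≡⟨ κ≡ z ⟩
      Λ z + Λ z - Λ (z + + w) - Λ (z - + w)
        ≡⟨ cong₂ (λ a b → a + a - b - Λ (z - + w)) (Λ≡0 {z} (ℕ.≤-trans (ℕ.m≤m+n w _) 2w≤z)) (Λ≡0 {z + + w} far₊) ⟩
      0ℤ + 0ℤ - 0ℤ - Λ (z - + w)                ≡⟨ cong (λ a → 0ℤ + 0ℤ - 0ℤ - a) (Λ≡0 {z - + w} far₋) ⟩
      0ℤ                                        ∎
      where
      open ≡-Reasoning
      close : ∀ y → z ≡ y + + w → w ℕ.≤ ∣ y ∣
      close y z≡ = ℕ.+-cancelʳ-≤ w w ∣ y ∣ (ℕ.≤-trans (ℕ.≤-reflexive (cong (w ℕ.+_) (sym (ℕ.+-identityʳ w))))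
        (ℕ.≤-trans 2w≤z (ℕ.≤-trans (ℕ.≤-reflexive (cong ∣_∣ z≡)) (ℤ.∣i+j∣≤∣i∣+∣j∣ y (+ w)))))
      close′ : ∀ y → z ≡ y - + w → w ℕ.≤ ∣ y ∣
      close′ y z≡ = ℕ.+-cancelʳ-≤ w w ∣ y ∣ (ℕ.≤-trans (ℕ.≤-reflexive (cong (w ℕ.+_) (sym (ℕ.+-identityʳ w))))
        (ℕ.≤-trans 2w≤z (ℕ.≤-trans (ℕ.≤-reflexive (cong ∣_∣ z≡)) (ℤ.∣i-j∣≤∣i∣+∣j∣ y (+ w)))))
      far₊ : w ℕ.≤ ∣ z + + w ∣
      far₊ = close′ (z + + w) (lem z (+ w))
        where
        lem : ∀ z w → z ≡ z + w - w
        lem = solve-∀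
      far₋ : w ℕ.≤ ∣ z - + w ∣
      far₋ = close (z - + w) (lem z (+ w))
        where
        lem : ∀ z w → z ≡ z - w + w
        lem = solve-∀

  -- Incidence of a difference vector with the three boundary directions.

  δ : ℤ → ℕ
  δ (+ zero)  = 1
  δ (+ suc _) = 0
  δ -[1+ _ ]  = 0

  δ≢ : ∀ {z} → z ≢ 0ℤ → δ z ≡ 0
  δ≢ {+ zero}   z≢0 = ⊥-elim (z≢0 refl)
  δ≢ {+ suc _}  z≢0 = refl
  δ≢ { -[1+ _ ]} z≢0 = refl

  δ-neg : ∀ z → δ (- z) ≡ δ z
  δ-neg (+ zero)  = refl
  δ-neg (+ suc _) = refl
  δ-neg -[1+ _ ]  = refl

  ∣a-2b+c∣≤ : ∀ a b c → ∣ a - + 2 * b + c ∣ ℕ.≤ ∣ a ∣ ℕ.+ 2 ℕ.* ∣ b ∣ ℕ.+ ∣ c ∣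
  ∣a-2b+c∣≤ a b c = begin
    ∣ a - + 2 * b + c ∣                     ≤⟨ ℤ.∣i+j∣≤∣i∣+∣j∣ (a - + 2 * b) c ⟩
    ∣ a - + 2 * b ∣ ℕ.+ ∣ c ∣               ≤⟨ ℕ.+-monoˡ-≤ ∣ c ∣ (ℤ.∣i-j∣≤∣i∣+∣j∣ a (+ 2 * b)) ⟩
    ∣ a ∣ ℕ.+ ∣ + 2 * b ∣ ℕ.+ ∣ c ∣         ≡⟨ cong (λ k → ∣ a ∣ ℕ.+ k ℕ.+ ∣ c ∣) (ℤ.∣i*j∣≡∣i∣*∣j∣ (+ 2) b) ⟩
    ∣ a ∣ ℕ.+ 2 ℕ.* ∣ b ∣ ℕ.+ ∣ c ∣         ∎
    where open ℕ.≤-Reasoning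

  nonneg-∣∣ : ∀ {i n} → 0ℤ ≤ i → i ≤ + n → ∣ i ∣ ℕ.≤ n
  nonneg-∣∣ {+ _} _ (+≤+ i≤n) = i≤n

  A²-neg-shift : ∀ n d h φ z → A n d (A n d (λ y → - φ (y + h))) z ≡ - A n d (A n d φ) (z + h)
  A²-neg-shift n d h φ z = trans (A-cong n d (once φ) z) (once (A n d φ) z)
    where
    once : ∀ φ z → A n d (λ y → - φ (y + h)) z ≡ - A n d φ (z + h)
    once φ z = begin
      A n d (λ y → - φ (y + h)) z
        ≡⟨ A-cong n d (λ y → lem (φ (y + h))) z ⟩
      -- Negation is cast as a linear combination with a zero second coefficient, the form that
      -- `A-linear` handles.
      A n d (λ y → - 1ℤ * φ (y + h) + 0ℤ * φ (y + h)) z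
        ≡⟨ A-linear n d (- 1ℤ) 0ℤ (λ y → φ (y + h)) (λ y → φ (y + h)) z ⟩
      - 1ℤ * A n d (λ y → φ (y + h)) z + 0ℤ * A n d (λ y → φ (y + h)) z
        ≡⟨ lem (A n d (λ y → φ (y + h)) z) ⟨
      - A n d (λ y → φ (y + h)) z
        ≡⟨ cong -_ (A-shift n d h φ z) ⟩
      - A n d φ (z + h) ∎
      where
      open ≡-Reasoning
      lem : ∀ a → - a ≡ - 1ℤ * a + 0ℤ * a
      lem = solve-∀

  -- The three conditions are the zeros of `M dy + s dx` at s = 0, M, 2 M; the weights are the
  -- absolute values of the coefficients 1, -2, 1 of a second difference.
  incidence : ℤ → ℤ → ℕ
  incidence dx dy = δ dy ℕ.+ 2 ℕ.* δ (dy + dx) ℕ.+ δ (dy + dx + dx)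

  incidence-neg : ∀ dx dy → incidence (- dx) (- dy) ≡ incidence dx dy
  incidence-neg dx dy = cong₂ ℕ._+_
    (cong₂ (λ a b → a ℕ.+ 2 ℕ.* b) (δ-neg dy) (trans (cong δ (lem₁ dx dy)) (δ-neg (dy + dx))))
    (trans (cong δ (lem₂ dx dy)) (δ-neg (dy + dx + dx)))
    where
    lem₁ : ∀ x y → - y + - x ≡ - (y + x)
    lem₁ = solve-∀
    lem₂ : ∀ x y → - y + - x + - x ≡ - (y + x + x)
    lem₂ = solve-∀

  -- The averaged kernel: exact telescoping and off-diagonal bounds.

  module KernelSum (w : ℕ) where

    open Kernel w

    M : ℕ
    M = 4 ℕ.* w

    K : ℤ → ℤ → ℤ
    K dx dy = sum {M} (λ a → sum {M} (λ b → κ (+ M * dy + + (toℕ a ℕ.+ toℕ b) * dx)))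

    -- The term `- w + t` lies between -w and w, while a nonzero multiple of `M` is at least 4 w
    -- away from 0.
    far : ∀ q t → q ≢ 0ℤ → t ℕ.≤ 2 ℕ.* w → w ℕ.≤ ∣ + M * q - + w + + t ∣
    far (+ zero)  t q≢0 t≤2w = ⊥-elim (q≢0 refl)
    far (+ suc k) t q≢0 t≤2w = ℕ.≤-trans
      (ℕ.≤-trans (ℕ.m≤m+n w (2 ℕ.* w ℕ.+ 4 ℕ.* w ℕ.* k ℕ.+ t)) (ℕ.≤-reflexive (lem₁ w k t)))
      (ℕ.≤-reflexive (cong ∣_∣ eq))
      where
      lem₁ : ∀ w k t → w ℕ.+ (2 ℕ.* w ℕ.+ 4 ℕ.* w ℕ.* k ℕ.+ t) ≡ 3 ℕ.* w ℕ.+ 4 ℕ.* w ℕ.* k ℕ.+ t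
      lem₁ = ℕ-Solver.solve-∀
      lem₂ : ∀ w k t → + 3 * w + + 4 * w * k + t ≡ + 4 * w * (1ℤ + k) - w + t
      lem₂ = solve-∀
      eq : + (3 ℕ.* w ℕ.+ 4 ℕ.* w ℕ.* k ℕ.+ t) ≡ + M * + suc k - + w + + t
      eq = trans (cong₂ (λ a b → a + b + + t) (ℤ.pos-* 3 w)
                   (trans (ℤ.pos-* (4 ℕ.* w) k) (cong (_* + k) (ℤ.pos-* 4 w))))
           (trans (lem₂ (+ w) (+ k) (+ t)) (cong (λ a → a * + suc k - + w + + t) (sym (ℤ.pos-* 4 w))))
    far -[1+ k ]  t q≢0 t≤2w = ℕ.≤-trans
      (ℕ.≤-trans (ℕ.m≤m+n w (2 ℕ.* w ℕ.+ 4 ℕ.* w ℕ.* k ℕ.+ s)) (ℕ.≤-reflexive (lem₁ w k s)))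
      (ℕ.≤-reflexive (trans (sym (ℤ.∣-i∣≡∣i∣ (+ (3 ℕ.* w ℕ.+ 4 ℕ.* w ℕ.* k ℕ.+ s)))) (cong ∣_∣ eq)))
      where
      -- Reflecting t to 2 w - t brings the negative case to the form of the positive one, with
      -- absolute value 3 w + 4 w k + s.
      s = 2 ℕ.* w ∸ t
      lem₁ : ∀ w k t → w ℕ.+ (2 ℕ.* w ℕ.+ 4 ℕ.* w ℕ.* k ℕ.+ t) ≡ 3 ℕ.* w ℕ.+ 4 ℕ.* w ℕ.* k ℕ.+ t
      lem₁ = ℕ-Solver.solve-∀
      lem₂ : ∀ w k t s → - (+ 3 * w + + 4 * w * k + s) ≡ + 4 * w * - (1ℤ + k) - w + t + (+ 2 * w - (s + t))
      lem₂ = solve-∀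
      lem₃ : ∀ a b → a + (b - b) ≡ a
      lem₃ = solve-∀
      s+t : + s + + t ≡ + 2 * + w
      s+t = trans (cong +_ (ℕ.m∸n+n≡m t≤2w)) (ℤ.pos-* 2 w)
      eq : - + (3 ℕ.* w ℕ.+ 4 ℕ.* w ℕ.* k ℕ.+ s) ≡ + M * -[1+ k ] - + w + + t
      eq = trans (cong₂ (λ a b → - (a + b + + s)) (ℤ.pos-* 3 w)
                   (trans (ℤ.pos-* (4 ℕ.* w) k) (cong (_* + k) (ℤ.pos-* 4 w))))
           (trans (lem₂ (+ w) (+ k) (+ t) (+ s))
           (trans (cong (λ a → + 4 * + w * -[1+ k ] - + w + + t + (+ 2 * + w - a)) s+t)
           (trans (lem₃ (+ 4 * + w * -[1+ k ] - + w + + t) (+ 2 * + w))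
             (cong (λ a → a * -[1+ k ] - + w + + t) (sym (ℤ.pos-* 4 w))))))

    K≡A² : ∀ d dy → K d dy ≡ A M d (A M d κ) (+ M * dy)
    K≡A² d dy = sym (trans (A≡sum M d (A M d κ) (+ M * dy)) (sum-cong M λ a →
      trans (A≡sum M d κ (+ M * dy + + toℕ a * d)) (sum-cong M λ b →
        cong κ (lem (+ M * dy) (+ toℕ a) (+ toℕ b) d))))
      where
      lem : ∀ z a b d → z + a * d + b * d ≡ z + (a + b) * d
      lem = solve-∀

    module _ (d e : ℕ) (ed≡w : e ℕ.* d ≡ w) where

      S : ℤ → ℤ
      S = A e (+ d) (A e (+ d) Λ)

      -- The arguments of Λ are `M * q - w + (i + j) * d` with `(i + j) * d` at most 2 w. They stay
      -- within w of `M * q`, so by `far` they miss the support of Λ unless q = 0, and there each of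
      -- the e² values is at most w.
      ∣S∣≤ : ∀ q z → z ≡ + M * q - + w → ∣ S z ∣ ℕ.≤ e ℕ.* e ℕ.* w ℕ.* δ q
      ∣S∣≤ q z refl = ℕ.≤-trans
        (nonneg-∣∣ (A-nonneg e (+ d) _ z (λ y → A-nonneg e (+ d) Λ y 0≤Λ))
          (ℤ.≤-trans (A-≤ e (+ d) _ z (+ e * + (w ℕ.* δ q)) λ {i} i<e →
            A-≤ e (+ d) Λ _ (+ (w ℕ.* δ q)) λ {j} j<e →
              ℤ.≤-trans (ℤ.≤-reflexive (cong Λ (lem z (+ i) (+ j) (+ d))))
                (bound i j i<e j<e))
            (ℤ.≤-reflexive (trans (cong (+ e *_) (sym (ℤ.pos-* e (w ℕ.* δ q)))) (sym (ℤ.pos-* e _))))))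
        (ℕ.≤-reflexive (lem₂ e w (δ q)))
        where
        lem : ∀ z i j d → z + i * d + j * d ≡ z + (i + j) * d
        lem = solve-∀
        lem₂ : ∀ e w x → e ℕ.* (e ℕ.* (w ℕ.* x)) ≡ e ℕ.* e ℕ.* w ℕ.* x
        lem₂ = ℕ-Solver.solve-∀
        t≤2w : ∀ i j → i ℕ.< e → j ℕ.< e → (i ℕ.+ j) ℕ.* d ℕ.≤ 2 ℕ.* w
        t≤2w i j i<e j<e = begin
          (i ℕ.+ j) ℕ.* d   ≤⟨ ℕ.*-monoˡ-≤ d (ℕ.+-mono-≤ (ℕ.<⇒≤ i<e) (ℕ.<⇒≤ j<e)) ⟩
          (e ℕ.+ e) ℕ.* d   ≡⟨ lem₃ e d ⟩
          2 ℕ.* (e ℕ.* d)   ≡⟨ cong (2 ℕ.*_) ed≡w ⟩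
          2 ℕ.* w           ∎
          where
          open ℕ.≤-Reasoning
          lem₃ : ∀ e d → (e ℕ.+ e) ℕ.* d ≡ 2 ℕ.* (e ℕ.* d)
          lem₃ = ℕ-Solver.solve-∀
        bound : ∀ i j → i ℕ.< e → j ℕ.< e → Λ (z + (+ i + + j) * + d) ≤ + (w ℕ.* δ q)
        bound i j i<e j<e with q ℤ.≟ 0ℤ
        ... | yes refl = ℤ.≤-trans (Λ≤w (z + (+ i + + j) * + d)) (ℤ.≤-reflexive (cong +_ (sym (ℕ.*-identityʳ w))))
        ... | no q≢0 = ℤ.≤-trans (ℤ.≤-reflexive (Λ≡0 {z + (+ i + + j) * + d}
          (subst (λ t → w ℕ.≤ ∣ z + t ∣) (ℤ.pos-* (i ℕ.+ j) d) (far q _ q≢0 (t≤2w i j i<e j<e))))) (+≤+ z≤n)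

      -- As w is e steps of length d, the sums over a and b are traded against the two differences
      -- inside κ. What remains is a second difference with step `M * d`, taken at the points
      -- belonging to a + b = 0, M and 2 M.
      K≡S : ∀ dy → let N = + M * + d; z₀ = + M * dy - + w in
        K (+ d) dy ≡ - (S (z₀ + N + N) - + 2 * S (z₀ + N) + S z₀)
      K≡S dy = begin
          K (+ d) dy
            ≡⟨ K≡A² (+ d) dy ⟩
          A M (+ d) (A M (+ d) κ) (+ M * dy)
            ≡⟨ A²-neg-shift M (+ d) (- + w) (Δ (+ w) (Δ (+ w) Λ)) (+ M * dy) ⟩
          - A M (+ d) (A M (+ d) (Δ (+ w) (Δ (+ w) Λ))) z₀
            ≡⟨ cong (λ u → - A M (+ d) (A M (+ d) (Δ u (Δ u Λ))) z₀) w≡ ⟩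
          - A M (+ d) (A M (+ d) (Δ (+ e * + d) (Δ (+ e * + d) Λ))) z₀
            ≡⟨ cong -_ (A²-telescope M e (+ d) Λ z₀) ⟩
          - A e (+ d) (A e (+ d) (Δ N (Δ N Λ))) z₀
            ≡⟨ cong -_ (trans (AeΔ (Δ N Λ) z₀) (cong₂ _-_ (AeΔ Λ z₁) (AeΔ Λ z₀))) ⟩
          - (S z₂ - S z₁ - (S z₁ - S z₀))
            ≡⟨ cong -_ (lem₄ (S z₂) (S z₁) (S z₀)) ⟩
          - (S z₂ - + 2 * S z₁ + S z₀) ∎
        where
        open ≡-Reasoning
        N = + M * + d
        z₀ = + M * dy - + w
        z₁ = z₀ + N
        z₂ = z₀ + N + N
        lem₄ : ∀ a b c → a - b - (b - c) ≡ a - + 2 * b + c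
        lem₄ = solve-∀
        w≡ : + w ≡ + e * + d
        w≡ = trans (cong +_ (sym ed≡w)) (ℤ.pos-* e d)
        AeΔ : ∀ φ z → A e (+ d) (A e (+ d) (Δ N φ)) z ≡ Δ N (A e (+ d) (A e (+ d) φ)) z
        AeΔ φ z = trans (A-cong e (+ d) (A-Δ e (+ d) N φ) z) (A-Δ e (+ d) N (A e (+ d) φ) z)

      ∣K∣≤ : ∀ dy → ∣ K (+ d) dy ∣ ℕ.≤ e ℕ.* e ℕ.* w ℕ.* incidence (+ d) dy
      ∣K∣≤ dy = begin
        ∣ K (+ d) dy ∣
          ≡⟨ cong ∣_∣ (K≡S dy) ⟩
        ∣ - (S z₂ - + 2 * S z₁ + S z₀) ∣
          ≡⟨ ℤ.∣-i∣≡∣i∣ (S z₂ - + 2 * S z₁ + S z₀) ⟩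
        ∣ S z₂ - + 2 * S z₁ + S z₀ ∣
          ≤⟨ ∣a-2b+c∣≤ (S z₂) (S z₁) (S z₀) ⟩
        ∣ S z₂ ∣ ℕ.+ 2 ℕ.* ∣ S z₁ ∣ ℕ.+ ∣ S z₀ ∣
          ≤⟨ ℕ.+-mono-≤ (ℕ.+-mono-≤ (∣S∣≤ (dy + + d + + d) z₂ (lem₂ (+ M) dy (+ d) (+ w)))
               (ℕ.*-monoʳ-≤ 2 (∣S∣≤ (dy + + d) z₁ (lem₁ (+ M) dy (+ d) (+ w))))) (∣S∣≤ dy z₀ refl) ⟩
        c ℕ.* δ (dy + + d + + d) ℕ.+ 2 ℕ.* (c ℕ.* δ (dy + + d)) ℕ.+ c ℕ.* δ dy
          ≡⟨ lem₃ c (δ (dy + + d + + d)) (δ (dy + + d)) (δ dy) ⟩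
        c ℕ.* incidence (+ d) dy ∎
        where
        open ℕ.≤-Reasoning
        c = e ℕ.* e ℕ.* w
        N = + M * + d
        z₀ = + M * dy - + w
        z₁ = z₀ + N
        z₂ = z₀ + N + N
        lem₁ : ∀ M y d w → M * y - w + M * d ≡ M * (y + d) - w
        lem₁ = solve-∀
        lem₂ : ∀ M y d w → M * y - w + M * d + M * d ≡ M * (y + d + d) - w
        lem₂ = solve-∀
        lem₃ : ∀ c x y z → c ℕ.* x ℕ.+ 2 ℕ.* (c ℕ.* y) ℕ.+ c ℕ.* z ≡ c ℕ.* (z ℕ.+ 2 ℕ.* y ℕ.+ x)
        lem₃ = ℕ-Solver.solve-∀

    K-neg : ∀ dx dy → K (- dx) (- dy) ≡ K dx dy
    K-neg dx dy = sum-cong M λ a → sum-cong M λ b →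
      trans (cong κ (lem (+ M) dy (+ (toℕ a ℕ.+ toℕ b)) dx)) (κ-even (+ M * dy + + (toℕ a ℕ.+ toℕ b) * dx))
      where
      lem : ∀ m y s x → m * - y + s * - x ≡ - (m * y + s * x)
      lem = solve-∀

    -- For points in one column the averaging has no effect, but the argument is a nonzero multiple
    -- of 4 w, outside the support of κ.
    K-vertical : ∀ {dy} → dy ≢ 0ℤ → K 0ℤ dy ≡ 0ℤ
    K-vertical {dy} dy≢0 = trans (sum-cong M λ a → trans (sum-cong M λ b →
        trans (cong κ (lem (+ M * dy) (+ (toℕ a ℕ.+ toℕ b)))) (κ-far (+ M * dy) 2w≤)) (sum-zero M))
      (sum-zero M)
      where
      lem : ∀ z s → z + s * 0ℤ ≡ z
      lem = solve-∀
      2w≤ : 2 ℕ.* w ℕ.≤ ∣ + M * dy ∣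
      2w≤ = begin
        2 ℕ.* w            ≤⟨ ℕ.*-monoˡ-≤ w (s≤s (s≤s (z≤n {2}))) ⟩
        M                  ≤⟨ ℕ.m≤m*n M ∣ dy ∣ {{ℕ.≢-nonZero (dy≢0 ∘ ℤ.∣i∣≡0⇒i≡0)}} ⟩
        M ℕ.* ∣ dy ∣       ≡⟨ ℤ.∣i*j∣≡∣i∣*∣j∣ (+ M) dy ⟨
        ∣ + M * dy ∣       ∎
        where open ℕ.≤-Reasoning

    K-diagonal : K 0ℤ 0ℤ ≡ + M * (+ M * (+ w + + w))
    K-diagonal = trans (sum-cong M λ a → trans (sum-cong M λ b →
        trans (cong κ (lem (+ M) (+ (toℕ a ℕ.+ toℕ b)))) κ0) (sum-const M _)) (sum-const M _)
      where
      lem : ∀ z s → z * 0ℤ + s * 0ℤ ≡ 0ℤ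
      lem = solve-∀

  -- Summing the incidence weights over the rows of the grid.

  sum-neg : ∀ {n} (f : Fin n → ℤ) → - sum f ≡ sum (λ i → - f i)
  sum-neg {zero}  f = refl
  sum-neg {suc n} f =
    trans (ℤ.neg-distrib-+ (f zero) (sum (f ∘ suc))) (cong (_+_ (- f zero)) (sum-neg (f ∘ suc)))

  sum-scale : ∀ n c (f : Fin n → ℤ) → sum (λ i → c * f i) ≡ c * sum f
  sum-scale n c f = sym (*-distribˡ-sum c f)

  sum-linear : ∀ n α β (f g : Fin n → ℤ) → sum (λ i → α * f i + β * g i) ≡ α * sum f + β * sum g
  sum-linear n α β f g = trans (∑-distrib-+ (λ i → α * f i) (λ i → β * g i))
    (cong₂ _+_ (sum-scale n α f) (sum-scale n β g))

  sum-δ-negative : ∀ n k → sum {n} (λ i → + δ (-[1+ k ] - + toℕ i)) ≡ 0ℤ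
  sum-δ-negative n k = trans (sum-cong n λ i → cong +_ (δ≢ (negative (toℕ i)))) (sum-zero n)
    where
    negative : ∀ i → -[1+ k ] - + i ≢ 0ℤ
    negative zero    ()
    negative (suc i) ()

  sum-δ-≤ : ∀ n t → sum {n} (λ i → + δ (t - + toℕ i)) ≤ 1ℤ
  sum-δ-≤ zero    t = +≤+ z≤n
  sum-δ-≤ (suc n) t@(-[1+ k ]) = ℤ.≤-trans (ℤ.≤-reflexive (sum-δ-negative (suc n) k)) (+≤+ z≤n)
  sum-δ-≤ (suc n) (+ zero)  = ℤ.≤-reflexive (cong (_+_ 1ℤ)
    (trans (sum-cong n λ i → cong (λ z → + δ z) (lem (+ toℕ i))) (sum-δ-negative n 0)))
    where
    lem : ∀ i → 0ℤ - (1ℤ + i) ≡ - 1ℤ - i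
    lem = solve-∀
  sum-δ-≤ (suc n) (+ suc t) = ℤ.≤-trans (ℤ.≤-reflexive (trans (ℤ.+-identityˡ _)
    (sum-cong n λ i → cong (λ z → + δ z) (lem (+ t) (+ toℕ i))))) (sum-δ-≤ n (+ t))
    where
    lem : ∀ t i → 1ℤ + t - (1ℤ + i) ≡ t - i
    lem = solve-∀

  -- With the column fixed, each of the three conditions singles out at most one row, and the
  -- weights 1, 2, 1 add up to 4.
  sum-incidence-≤ : ∀ n dx t → sum {n} (λ i → + incidence dx (t - + toℕ i)) ≤ + 4
  sum-incidence-≤ n dx t = begin
    sum {n} (λ i → + incidence dx (t - + toℕ i))
      ≡⟨ sum-cong n (λ i → trans
           (cong₂ (λ a b → + δ (t - + toℕ i) + a + + δ b) (trans (ℤ.pos-* 2 (δ (t - + toℕ i + dx)))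
             (cong (λ z → + 2 * + δ z) (lem₁ t (+ toℕ i) dx))) (lem₂ t (+ toℕ i) dx))
           (lem₃ (+ δ (t - + toℕ i)) (+ δ (t + dx - + toℕ i)) (+ δ (t + dx + dx - + toℕ i)))) ⟩
    sum {n} (λ i → 1ℤ * (1ℤ * + δ (t - + toℕ i) + + 2 * + δ (t + dx - + toℕ i)) + 1ℤ * + δ (t + dx + dx - + toℕ i))
      ≡⟨ sum-linear n 1ℤ 1ℤ (λ i → 1ℤ * + δ (t - + toℕ i) + + 2 * + δ (t + dx - + toℕ i)) _ ⟩
    1ℤ * sum {n} (λ i → 1ℤ * + δ (t - + toℕ i) + + 2 * + δ (t + dx - + toℕ i)) + 1ℤ * s (t + dx + dx)
      ≡⟨ cong (λ a → 1ℤ * a + 1ℤ * s (t + dx + dx)) (sum-linear n 1ℤ (+ 2) (λ i → + δ (t - + toℕ i)) _) ⟩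
    1ℤ * (1ℤ * s t + + 2 * s (t + dx)) + 1ℤ * s (t + dx + dx)
      ≡⟨ lem₄ (s t) (s (t + dx)) (s (t + dx + dx)) ⟩
    s t + (s (t + dx) + s (t + dx)) + s (t + dx + dx)
      ≤⟨ ℤ.+-mono-≤ (ℤ.+-mono-≤ (sum-δ-≤ n t) (ℤ.+-mono-≤ (sum-δ-≤ n (t + dx)) (sum-δ-≤ n (t + dx))))
           (sum-δ-≤ n (t + dx + dx)) ⟩
    + 4 ∎
    where
    open ℤ.≤-Reasoning
    s : ℤ → ℤ
    s t = sum {n} (λ i → + δ (t - + toℕ i))
    lem₁ : ∀ t i d → t - i + d ≡ t + d - i
    lem₁ = solve-∀
    lem₂ : ∀ t i d → t - i + d + d ≡ t + d + d - i
    lem₂ = solve-∀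
    lem₃ : ∀ a b c → a + + 2 * b + c ≡ 1ℤ * (1ℤ * a + + 2 * b) + 1ℤ * c
    lem₃ = solve-∀
    lem₄ : ∀ a b c → 1ℤ * (1ℤ * a + + 2 * b) + 1ℤ * c ≡ a + (b + b) + c
    lem₄ = solve-∀

  -- The bounded sum of 1/d², scaled by w² to integers.

  module Quotients (m : ℕ) where

    w : ℕ
    w = m !

    -- w / 0 is taken to be 0, so that the diagonal contributes nothing below.
    e : ℕ → ℕ
    e zero    = 0
    e (suc d) = w ℕ./ suc d

    e-spec : ∀ {d} → d ℕ.< m → e (suc d) ℕ.* suc d ≡ w
    e-spec {d} d<m = ℕ.m/n*n≡m (ℕ.∣-trans (ℕ.m∣m*n (d !)) (ℕ.m≤n⇒m!∣n! d<m))

    -- 1 / (k + 1)² ≤ 1 / k - 1 / (k + 1).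
    e²-step : ∀ {k} → suc k ℕ.< m → e (2 ℕ.+ k) ℕ.* e (2 ℕ.+ k) ℕ.+ w ℕ.* e (2 ℕ.+ k) ℕ.≤ w ℕ.* e (suc k)
    e²-step {k} k<m = begin
      f ℕ.* f ℕ.+ w ℕ.* f                 ≤⟨ ℕ.+-monoˡ-≤ (w ℕ.* f) (ℕ.*-monoˡ-≤ f f≤g) ⟩
      g ℕ.* f ℕ.+ w ℕ.* f                 ≡⟨ cong (λ u → g ℕ.* f ℕ.+ u ℕ.* f) (e-spec (ℕ.<⇒≤ k<m)) ⟨
      g ℕ.* f ℕ.+ g ℕ.* suc k ℕ.* f       ≡⟨ lem f g k ⟩
      f ℕ.* (2 ℕ.+ k) ℕ.* g               ≡⟨ cong (ℕ._* g) (e-spec k<m) ⟩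
      w ℕ.* g                             ∎
      where
      open ℕ.≤-Reasoning
      f = e (2 ℕ.+ k)
      g = e (suc k)
      f≤g : f ℕ.≤ g
      f≤g = ℕ.*-cancelʳ-≤ f g (suc k) (ℕ.≤-trans (ℕ.*-monoʳ-≤ f (ℕ.n≤1+n (suc k)))
        (ℕ.≤-reflexive (trans (e-spec k<m) (sym (e-spec (ℕ.<⇒≤ k<m))))))
      lem : ∀ f g k → g ℕ.* f ℕ.+ g ℕ.* suc k ℕ.* f ≡ f ℕ.* (2 ℕ.+ k) ℕ.* g
      lem = ℕ-Solver.solve-∀

    e² : ℕ → ℕ
    e² d = e d ℕ.* e d

    e1 : 0 ℕ.< m → e 1 ≡ w
    e1 0<m = trans (sym (ℕ.*-identityʳ (e 1))) (e-spec 0<m)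

    -- Divided by w², the estimate Σ 1/d² ≤ 1/(k + 1) over d > k + 1; `e²-step` telescopes.
    tail-bound : ∀ n k → suc k ℕ.+ n ℕ.≤ m → sum {n} (λ i → + e² (2 ℕ.+ k ℕ.+ toℕ i)) ≤ + (w ℕ.* e (suc k))
    tail-bound zero    k _ = +≤+ z≤n
    tail-bound (suc n) k h = begin
      + e² (2 ℕ.+ k ℕ.+ 0) + sum {n} (λ i → + e² (2 ℕ.+ k ℕ.+ suc (toℕ i)))
        ≡⟨ cong₂ _+_ (cong (λ u → + e² u) (ℕ.+-identityʳ (2 ℕ.+ k)))
             (sum-cong n λ i → cong (λ u → + e² u) (ℕ.+-suc (2 ℕ.+ k) (toℕ i))) ⟩
      + e² (2 ℕ.+ k) + sum {n} (λ i → + e² (3 ℕ.+ k ℕ.+ toℕ i))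
        ≤⟨ ℤ.+-monoʳ-≤ (+ e² (2 ℕ.+ k)) (tail-bound n (suc k) h′) ⟩
      + (e² (2 ℕ.+ k) ℕ.+ w ℕ.* e (2 ℕ.+ k))
        ≤⟨ +≤+ (e²-step (ℕ.≤-trans (ℕ.m≤m+n _ n) h′)) ⟩
      + (w ℕ.* e (suc k)) ∎
      where
      open ℤ.≤-Reasoning
      h′ : 2 ℕ.+ k ℕ.+ n ℕ.≤ m
      h′ = subst (ℕ._≤ m) (ℕ.+-suc (suc k) n) h

    -- The 2 is 1 from d = 1 and 1 from the tail d ≥ 2. The term d = 0 is zero by the convention for
    -- `e`.
    forward-bound : ∀ n → n ℕ.≤ m → sum {n} (λ i → + e² (toℕ i)) ≤ + (2 ℕ.* (w ℕ.* w))
    forward-bound zero          _ = +≤+ z≤n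
    forward-bound (suc zero)    _ = +≤+ z≤n
    forward-bound (suc (suc n)) h = begin
      0ℤ + (+ e² 1 + sum {n} (λ i → + e² (2 ℕ.+ toℕ i)))   ≡⟨ ℤ.+-identityˡ _ ⟩
      + e² 1 + sum {n} (λ i → + e² (2 ℕ.+ toℕ i))          ≤⟨ ℤ.+-monoʳ-≤ (+ e² 1) (tail-bound n 0 (ℕ.<⇒≤ h)) ⟩
      + (e 1 ℕ.* e 1 ℕ.+ w ℕ.* e 1)                        ≡⟨ cong (λ f → + (f ℕ.* f ℕ.+ w ℕ.* f)) (e1 (ℕ.≤-trans (s≤s z≤n) h)) ⟩
      + (w ℕ.* w ℕ.+ w ℕ.* w)                              ≡⟨ cong (λ u → + (w ℕ.* w ℕ.+ u)) (ℕ.+-identityʳ (w ℕ.* w)) ⟨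
      + (2 ℕ.* (w ℕ.* w))                                  ∎
      where open ℤ.≤-Reasoning

    -- The contribution of the columns to the left of column p, at distances 1 to p.
    backward : ℕ → ℕ
    backward zero    = 0
    backward (suc p) = e² (suc p) ℕ.+ backward p

    -- The extra term `w * e (suc p)` is the budget left for larger distances; `e²-step` pays the
    -- next square out of it, which carries the induction.
    backward-bound : ∀ p → p ℕ.< m → backward (suc p) ℕ.+ w ℕ.* e (suc p) ℕ.≤ 2 ℕ.* (w ℕ.* w)
    backward-bound zero 0<m = ℕ.≤-reflexive (trans
      (cong (λ f → f ℕ.* f ℕ.+ 0 ℕ.+ w ℕ.* f) (e1 0<m)) (lem (w ℕ.* w)))
      where
      lem : ∀ u → u ℕ.+ 0 ℕ.+ u ≡ 2 ℕ.* u
      lem = ℕ-Solver.solve-∀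
    backward-bound (suc p) p<m = begin
      e² (2 ℕ.+ p) ℕ.+ backward (suc p) ℕ.+ w ℕ.* e (2 ℕ.+ p)
        ≡⟨ lem (e² (2 ℕ.+ p)) (backward (suc p)) (w ℕ.* e (2 ℕ.+ p)) ⟩
      backward (suc p) ℕ.+ (e² (2 ℕ.+ p) ℕ.+ w ℕ.* e (2 ℕ.+ p))
        ≤⟨ ℕ.+-monoʳ-≤ (backward (suc p)) (e²-step p<m) ⟩
      backward (suc p) ℕ.+ w ℕ.* e (suc p)
        ≤⟨ backward-bound p (ℕ.<⇒≤ p<m) ⟩
      2 ℕ.* (w ℕ.* w) ∎
      where
      open ℕ.≤-Reasoning
      lem : ∀ a b c → a ℕ.+ b ℕ.+ c ≡ b ℕ.+ (a ℕ.+ c)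
      lem = ℕ-Solver.solve-∀

    backward-≤ : ∀ p → p ℕ.≤ m → backward p ℕ.≤ 2 ℕ.* (w ℕ.* w)
    backward-≤ zero    _   = z≤n
    backward-≤ (suc p) p<m = ℕ.≤-trans (ℕ.m≤m+n _ _) (backward-bound p p<m)

    -- Dropping the first column moves its square into `backward` and lowers p and n together, until
    -- p = 0 leaves a purely forward sum.
    two-sided : ∀ p n → n ℕ.≤ m → sum {n} (λ i → + e² ∣ + p - + toℕ i ∣) ≤ + (2 ℕ.* (w ℕ.* w)) + + backward p
    two-sided zero    n h = begin
      sum {n} (λ i → + e² ∣ 0ℤ - + toℕ i ∣)
        ≡⟨ sum-cong n (λ i → cong (λ u → + e² u) (trans (cong ∣_∣ (ℤ.+-identityˡ (- + toℕ i))) (ℤ.∣-i∣≡∣i∣ (+ toℕ i)))) ⟩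
      sum {n} (λ i → + e² (toℕ i))   ≤⟨ forward-bound n h ⟩
      + (2 ℕ.* (w ℕ.* w))            ≡⟨ ℤ.+-identityʳ _ ⟨
      + (2 ℕ.* (w ℕ.* w)) + 0ℤ       ∎
      where open ℤ.≤-Reasoning
    two-sided (suc p) zero    h = +≤+ z≤n
    two-sided (suc p) (suc n) h = begin
      + e² (suc p ℕ.+ 0) + sum {n} (λ i → + e² ∣ + suc p - + suc (toℕ i) ∣)
        ≡⟨ cong₂ _+_ (cong (λ u → + e² u) (ℕ.+-identityʳ (suc p)))
             (sum-cong n λ i → cong (λ u → + e² ∣ u ∣) (lem (+ p) (+ toℕ i))) ⟩
      + e² (suc p) + sum {n} (λ i → + e² ∣ + p - + toℕ i ∣)
        ≤⟨ ℤ.+-monoʳ-≤ (+ e² (suc p)) (two-sided p n (ℕ.<⇒≤ h)) ⟩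
      + e² (suc p) + (+ (2 ℕ.* (w ℕ.* w)) + + backward p)
        ≡⟨ lem′ (+ e² (suc p)) (+ (2 ℕ.* (w ℕ.* w))) (+ backward p) ⟩
      + (2 ℕ.* (w ℕ.* w)) + + backward (suc p) ∎
      where
      open ℤ.≤-Reasoning
      lem : ∀ p i → 1ℤ + p - (1ℤ + i) ≡ p - i
      lem = solve-∀
      lem′ : ∀ a b c → a + (b + c) ≡ b + (a + c)
      lem′ = solve-∀

    sum-e²-≤ : ∀ p → p ℕ.≤ m → sum {m} (λ i → + e² ∣ + p - + toℕ i ∣) ≤ + (4 ℕ.* (w ℕ.* w))
    sum-e²-≤ p p≤m = ℤ.≤-trans (two-sided p m ℕ.≤-refl) (+≤+ (ℕ.≤-trans
      (ℕ.+-monoʳ-≤ (2 ℕ.* (w ℕ.* w)) (backward-≤ p p≤m)) (ℕ.≤-reflexive (lem (w ℕ.* w)))))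
      where
      lem : ∀ u → 2 ℕ.* u ℕ.+ 2 ℕ.* u ≡ 4 ℕ.* u
      lem = ℕ-Solver.solve-∀

    open KernelSum w

    -- Zero whenever dx is, as `e 0` = 0. This suits both uses: the diagonal is not to be counted,
    -- and pairs in one column have kernel zero by `K-vertical`.
    B : ℤ → ℤ → ℕ
    B dx dy = e² ∣ dx ∣ ℕ.* w ℕ.* incidence dx dy

    -- The factors are 4 from the incidences, w from the height of Λ and 4 w² from the squares,
    -- together 16 w³ = w M². This is half of `K-diagonal`, and it is the reason for `M` = 4 w.
    sum-B-≤ : ∀ x y → x ℕ.≤ m → sum {m} (λ i → sum {m} (λ j → + B (+ x - + toℕ i) (+ y - + toℕ j))) ≤ + w * (+ M * + M)
    sum-B-≤ x y x≤m = begin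
      sum {m} (λ i → sum {m} (λ j → + B (+ x - + toℕ i) (+ y - + toℕ j)))
        ≤⟨ sum-mono-≤ {m} (λ i → ℤ.≤-trans (ℤ.≤-reflexive (trans (sum-cong m λ j → ℤ.pos-* (c i) _)
             (sum-scale m (+ c i) (λ j → + incidence (+ x - + toℕ i) (+ y - + toℕ j)))))
             (ℤ.≤-trans (ℤ.*-monoˡ-≤-nonNeg (+ c i) (sum-incidence-≤ m (+ x - + toℕ i) (+ y)))
               (ℤ.≤-reflexive (trans (cong (_* + 4) (ℤ.pos-* (e² ∣ + x - + toℕ i ∣) w))
                 (lem₁ (+ e² ∣ + x - + toℕ i ∣) (+ w)))))) ⟩
      sum {m} (λ i → + 4 * + w * + e² ∣ + x - + toℕ i ∣)
        ≡⟨ sum-scale m (+ 4 * + w) (λ i → + e² ∣ + x - + toℕ i ∣) ⟩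
      + 4 * + w * sum {m} (λ i → + e² ∣ + x - + toℕ i ∣)
        ≡⟨ cong (_* sum {m} (λ i → + e² ∣ + x - + toℕ i ∣)) (sym (ℤ.pos-* 4 w)) ⟩
      + M * sum {m} (λ i → + e² ∣ + x - + toℕ i ∣)
        ≤⟨ ℤ.*-monoˡ-≤-nonNeg (+ M) (sum-e²-≤ x x≤m) ⟩
      + M * + (4 ℕ.* (w ℕ.* w))
        ≡⟨ cong (+ M *_) (trans (cong +_ (sym (ℕ.*-assoc 4 w w))) (ℤ.pos-* M w)) ⟩
      + M * (+ M * + w)
        ≡⟨ lem₂ (+ M) (+ w) ⟩
      + w * (+ M * + M) ∎
      where
      open ℤ.≤-Reasoning
      c : Fin m → ℕ
      c i = e² ∣ + x - + toℕ i ∣ ℕ.* w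
      lem₁ : ∀ u w → u * w * + 4 ≡ + 4 * w * u
      lem₁ = solve-∀
      lem₂ : ∀ M w → M * (M * w) ≡ w * (M * M)
      lem₂ = solve-∀

    ∣K∣≤B : ∀ dx dy → ¬ (dx ≡ 0ℤ × dy ≡ 0ℤ) → ∣ dx ∣ ℕ.≤ m → ∣ K dx dy ∣ ℕ.≤ B dx dy
    ∣K∣≤B (+ zero)  dy ≢0 _   = ℕ.≤-reflexive (cong ∣_∣ (K-vertical {dy} (λ dy≡0 → ≢0 (refl , dy≡0))))
    ∣K∣≤B (+ suc d) dy ≢0 d<m = ∣K∣≤ (suc d) (e (suc d)) (e-spec d<m) dy
    ∣K∣≤B -[1+ d ]  dy ≢0 d<m = begin
      ∣ K -[1+ d ] dy ∣            ≡⟨ cong ∣_∣ (K-neg -[1+ d ] dy) ⟨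
      ∣ K (+ suc d) (- dy) ∣       ≤⟨ ∣K∣≤ (suc d) (e (suc d)) (e-spec d<m) (- dy) ⟩
      B (+ suc d) (- dy)           ≡⟨ cong (e² (suc d) ℕ.* w ℕ.*_) (incidence-neg -[1+ d ] dy) ⟩
      B -[1+ d ] dy                ∎
      where open ℕ.≤-Reasoning

  -- Expanding sums of squares into quadratic forms.

  square-sum : ∀ n (f : Fin n → ℤ) → sum f * sum f ≡ sum {n} (λ p → sum {n} (λ q → f p * f q))
  square-sum n f = trans (*-distribʳ-sum (sum f) f) (sum-cong n λ p → *-distribˡ-sum (f p) f)

  sum-pairs-swap : ∀ k n (X : Fin n → Fin n → ℤ) (F : Fin k → Fin n → Fin n → ℤ) →
    sum {k} (λ c → sum {n} (λ p → sum {n} (λ q → X p q * F c p q))) ≡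
    sum {n} (λ p → sum {n} (λ q → X p q * sum {k} (λ c → F c p q)))
  sum-pairs-swap k n X F = trans (∑-comm {k} {n} (λ c p → sum {n} (λ q → X p q * F c p q)))
    (sum-cong n λ p → trans (∑-comm {k} {n} (λ c q → X p q * F c p q))
      (sum-cong n λ q → sum-scale k (X p q) (λ c → F c p q)))

  gram : ∀ k n (χ : Fin n → ℤ) (g : Fin k → Fin n → ℤ) →
    sum {k} (λ c → sum {n} (λ p → χ p * g c p) * sum {n} (λ p → χ p * g c p)) ≡
    sum {n} (λ p → sum {n} (λ q → χ p * χ q * sum {k} (λ c → g c p * g c q)))
  gram k n χ g = trans
    (sum-cong k λ c → trans (square-sum n (λ p → χ p * g c p))
      (sum-cong n λ p → sum-cong n λ q → lem (χ p) (g c p) (χ q) (g c q)))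
    (sum-pairs-swap k n (λ p q → χ p * χ q) (λ c p q → g c p * g c q))
    where
    lem : ∀ a b c d → a * b * (c * d) ≡ a * c * (b * d)
    lem = solve-∀

  sum-product-diff : ∀ n (a b a′ b′ : Fin n → ℤ) →
    sum {n} (λ i → (a i - b i) * (a′ i - b′ i)) ≡
    sum {n} (λ i → a i * a′ i) - sum {n} (λ i → a i * b′ i)
      - sum {n} (λ i → b i * a′ i) + sum {n} (λ i → b i * b′ i)
  sum-product-diff zero    a b a′ b′ = refl
  sum-product-diff (suc n) a b a′ b′ = trans
    (cong (_+_ ((a zero - b zero) * (a′ zero - b′ zero)))
      (sum-product-diff n (a ∘ suc) (b ∘ suc) (a′ ∘ suc) (b′ ∘ suc)))
    (lem (a zero) (b zero) (a′ zero) (b′ zero) (S a a′) (S a b′) (S b a′) (S b b′))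
    where
    S : (f g : Fin (suc n) → ℤ) → ℤ
    S f g = sum {n} (λ i → f (suc i) * g (suc i))
    lem : ∀ a b a′ b′ w x y z → (a - b) * (a′ - b′) + (w - x - y + z) ≡
      a * a′ + w - (a * b′ + x) - (b * a′ + y) + (b * b′ + z)
    lem = solve-∀

  -- The threshold indicators [c ≤ v] and their autocorrelations.

  θ : ℕ → ℕ → ℤ
  θ zero    v       = 1ℤ
  θ (suc c) zero    = 0ℤ
  θ (suc c) (suc v) = θ c v

  θ-≤ : ∀ {c v} → c ℕ.≤ v → θ c v ≡ 1ℤ
  θ-≤ z≤n       = refl
  θ-≤ (s≤s c≤v) = θ-≤ c≤v

  θ-> : ∀ {c v} → v ℕ.< c → θ c v ≡ 0ℤ
  θ-> {suc c} {zero}  _         = refl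
  θ-> {suc c} {suc v} (s≤s v<c) = θ-> v<c

  θ-shift : ∀ k c v → θ (k ℕ.+ c) (k ℕ.+ v) ≡ θ c v
  θ-shift zero    c v = refl
  θ-shift (suc k) c v = θ-shift k c v

  -- The product is 1 exactly at the thresholds 0, ..., `α ⊓ β`, all of them below n; counting 0
  -- gives the `suc`.
  sum-θ*θ : ∀ n α β → α ℕ.< n → β ℕ.< n → sum {n} (λ c → θ (toℕ c) α * θ (toℕ c) β) ≡ + suc (α ⊓ β)
  sum-θ*θ (suc n) zero    β       _         _         = cong (_+_ 1ℤ) (sum-zero n)
  sum-θ*θ (suc n) (suc α) zero    _         _         =
    cong (_+_ 1ℤ) (trans (sum-cong n λ c → ℤ.*-zeroʳ (θ (toℕ c) α)) (sum-zero n))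
  sum-θ*θ (suc n) (suc α) (suc β) (s≤s α<n) (s≤s β<n) = cong (_+_ 1ℤ) (sum-θ*θ n α β α<n β<n)

  module Autocorrelation (w : ℕ) where

    open Kernel w
    open KernelSum w

    -- The overlap of the integer intervals (v, v + w] and (v + t, v + t + w], written by inclusion
    -- and exclusion in the counts of `sum-θ*θ`.
    common : ∀ v t → + suc ((w ℕ.+ v) ⊓ (w ℕ.+ (v ℕ.+ t))) - + suc ((w ℕ.+ v) ⊓ (v ℕ.+ t))
      - + suc (v ⊓ (w ℕ.+ (v ℕ.+ t))) + + suc (v ⊓ (v ℕ.+ t)) ≡ + (w ∸ t)
    common v t
      rewrite ℕ.m≤n⇒m⊓n≡m (ℕ.+-monoʳ-≤ w (ℕ.m≤m+n v t))
            | ℕ.m≤n⇒m⊓n≡m (ℕ.≤-trans (ℕ.m≤m+n v t) (ℕ.m≤n+m (v ℕ.+ t) w))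
            | ℕ.m≤n⇒m⊓n≡m (ℕ.m≤m+n v t)
            | ℕ.+-comm w v
            | sym (ℕ.+-distribˡ-⊓ v w t) = begin
      1ℤ + (+ v + + w) - (1ℤ + (+ v + + (w ⊓ t))) - (1ℤ + + v) + (1ℤ + + v)
        ≡⟨ cong (λ u → 1ℤ + (+ v + u) - (1ℤ + (+ v + + (w ⊓ t))) - (1ℤ + + v) + (1ℤ + + v)) w≡ ⟩
      1ℤ + (+ v + (+ (w ⊓ t) + + (w ∸ t))) - (1ℤ + (+ v + + (w ⊓ t))) - (1ℤ + + v) + (1ℤ + + v)
        ≡⟨ lem (+ v) (+ (w ⊓ t)) (+ (w ∸ t)) ⟩
      + (w ∸ t) ∎
      where
      open ≡-Reasoning
      w≡ : + w ≡ + (w ⊓ t) + + (w ∸ t)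
      w≡ = cong +_ (sym (trans (cong (ℕ._+ (w ∸ t)) (ℕ.⊓-comm w t)) (ℕ.m⊓n+n∸m≡n t w)))
      lem : ∀ v a b → 1ℤ + (v + (a + b)) - (1ℤ + (v + a)) - (1ℤ + v) + (1ℤ + v) ≡ b
      lem = solve-∀

    common-sym : ∀ a b → + suc ((w ℕ.+ a) ⊓ (w ℕ.+ b)) - + suc ((w ℕ.+ a) ⊓ b)
      - + suc (a ⊓ (w ℕ.+ b)) + + suc (a ⊓ b) ≡
      + suc ((w ℕ.+ b) ⊓ (w ℕ.+ a)) - + suc ((w ℕ.+ b) ⊓ a)
      - + suc (b ⊓ (w ℕ.+ a)) + + suc (b ⊓ a)
    common-sym a b
      rewrite ℕ.⊓-comm (w ℕ.+ b) (w ℕ.+ a) | ℕ.⊓-comm (w ℕ.+ b) a | ℕ.⊓-comm b (w ℕ.+ a) | ℕ.⊓-comm b a =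
      lem (+ suc ((w ℕ.+ a) ⊓ (w ℕ.+ b))) (+ suc ((w ℕ.+ a) ⊓ b)) (+ suc (a ⊓ (w ℕ.+ b))) (+ suc (a ⊓ b))
      where
      lem : ∀ a b c d → a - b - c + d ≡ a - c - b + d
      lem = solve-∀

    common-Λ : ∀ v v′ → + suc ((w ℕ.+ v) ⊓ (w ℕ.+ v′)) - + suc ((w ℕ.+ v) ⊓ v′)
      - + suc (v ⊓ (w ℕ.+ v′)) + + suc (v ⊓ v′) ≡ Λ (+ v - + v′)
    common-Λ v v′ with ℕ.≤-total v v′
    ... | inj₁ v≤v′ with v′ ∸ v | ℕ.m+[n∸m]≡n v≤v′
    ...   | t | refl = trans (common v t) (trans (sym (Λ-even (+ t))) (cong Λ (lem (+ v) (+ t))))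
      where
      lem : ∀ v t → - t ≡ v - (v + t)
      lem = solve-∀
    common-Λ v v′ | inj₂ v′≤v with v ∸ v′ | ℕ.m+[n∸m]≡n v′≤v
    ...   | t | refl = trans (common-sym (v′ ℕ.+ t) v′) (trans (common v′ t) (cong Λ (lem (+ v′) (+ t))))
      where
      lem : ∀ v t → t ≡ v + t - v
      lem = solve-∀

    -- The indicator of v < c ≤ v + w.
    I : ℕ → ℕ → ℤ
    I c v = θ c (w ℕ.+ v) - θ c v

    sum-I*I : ∀ n v v′ → w ℕ.+ v ℕ.< n → w ℕ.+ v′ ℕ.< n →
      sum {n} (λ c → I (toℕ c) v * I (toℕ c) v′) ≡ Λ (+ v - + v′)
    sum-I*I n v v′ v<n v′<n = trans
      (sum-product-diff n (λ c → θ (toℕ c) (w ℕ.+ v)) (λ c → θ (toℕ c) v)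
                          (λ c → θ (toℕ c) (w ℕ.+ v′)) (λ c → θ (toℕ c) v′))
      (trans (cong₂ _+_ (cong₂ _-_ (cong₂ _-_
          (sum-θ*θ n (w ℕ.+ v) (w ℕ.+ v′) v<n v′<n)
          (sum-θ*θ n (w ℕ.+ v) v′ v<n (small v′<n)))
          (sum-θ*θ n v (w ℕ.+ v′) (small v<n) v′<n))
          (sum-θ*θ n v v′ (small v<n) (small v′<n)))
        (common-Λ v v′))
      where
      small : ∀ {v} → w ℕ.+ v ℕ.< n → v ℕ.< n
      small {v} = ℕ.≤-<-trans (ℕ.m≤n+m v w)

    -- -1 for v < c ≤ v + w and +1 for v + w < c ≤ v + 2 w. As a function of c this is the second
    -- difference with step w of the threshold indicator at level v + 2 w.
    G : ℕ → ℕ → ℤ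
    G c v = I c (w ℕ.+ v) - I c v

    sum-G*G : ∀ n v v′ → w ℕ.+ (w ℕ.+ v) ℕ.< n → w ℕ.+ (w ℕ.+ v′) ℕ.< n →
      sum {n} (λ c → G (toℕ c) v * G (toℕ c) v′) ≡ κ (+ v - + v′)
    sum-G*G n v v′ v<n v′<n = trans
      (sum-product-diff n (λ c → I (toℕ c) (w ℕ.+ v)) (λ c → I (toℕ c) v)
                          (λ c → I (toℕ c) (w ℕ.+ v′)) (λ c → I (toℕ c) v′))
      (trans (cong₂ _+_ (cong₂ _-_ (cong₂ _-_
          (trans (sum-I*I n (w ℕ.+ v) (w ℕ.+ v′) v<n v′<n) (cong Λ (lem₁ (+ w) (+ v) (+ v′))))
          (trans (sum-I*I n (w ℕ.+ v) v′ v<n (small v′<n)) (cong Λ (lem₂ (+ w) (+ v) (+ v′)))))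
          (trans (sum-I*I n v (w ℕ.+ v′) (small v<n) v′<n) (cong Λ (lem₃ (+ w) (+ v) (+ v′)))))
          (sum-I*I n v v′ (small v<n) (small v′<n)))
        (trans (lem₄ (Λ z) (Λ (z + + w)) (Λ (z - + w))) (sym (κ≡ z))))
      where
      z = + v - + v′
      small : ∀ {v} → w ℕ.+ (w ℕ.+ v) ℕ.< n → w ℕ.+ v ℕ.< n
      small {v} = ℕ.≤-<-trans (ℕ.m≤n+m (w ℕ.+ v) w)
      lem₁ : ∀ w v v′ → w + v - (w + v′) ≡ v - v′
      lem₁ = solve-∀
      lem₂ : ∀ w v v′ → w + v - v′ ≡ v - v′ + w
      lem₂ = solve-∀
      lem₃ : ∀ w v v′ → v - (w + v′) ≡ v - v′ - w
      lem₃ = solve-∀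
      lem₄ : ∀ a b c → a - b - c + a ≡ a + a - b - c
      lem₄ = solve-∀

  neg-≤-∣∣ : ∀ i {n} → ∣ i ∣ ℕ.≤ n → - + n ≤ i
  neg-≤-∣∣ (+ _)         _         = ℤ.≤-trans (ℤ.neg-mono-≤ (+≤+ z≤n)) (+≤+ z≤n)
  neg-≤-∣∣ -[1+ k ] {suc n} (s≤s k≤n) = -≤- k≤n

  -- Row by row: `χ p * χ p` = 1 turns the diagonal entry into a, and whatever the signs, the other
  -- entries cost at most the row sum of B. The coloring drops out of the bound.
  dominance : ∀ n (χ : Fin n → ℤ) (K : Fin n → Fin n → ℤ) (B : Fin n → Fin n → ℕ) (a b : ℤ) →
    (∀ p → ∣ χ p ∣ ≡ 1) → (∀ p → K p p ≡ a) → (∀ p → B p p ≡ 0) →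
    (∀ p q → p ≢ q → ∣ K p q ∣ ℕ.≤ B p q) → (∀ p → sum {n} (λ q → + B p q) ≤ b) →
    + n * (a - b) ≤ sum {n} (λ p → sum {n} (λ q → χ p * χ q * K p q))
  dominance zero    χ K B a b _ _ _ _ _ = +≤+ z≤n
  dominance n@(suc n-1) χ K B a b ∣χ∣≡1 Kpp Bpp ∣K∣≤B ΣB≤b = sum-const-≤ {n} (a - b) row
    where
    open ℤ.≤-Reasoning
    unit : ∀ i → ∣ i ∣ ≡ 1 → i * i ≡ 1ℤ
    unit (+ suc zero)  refl = refl
    unit -[1+ zero ] refl = refl
    row : ∀ p → a - b ≤ sum {n} (λ q → χ p * χ q * K p q)
    row p = begin
      a - b
        ≤⟨ ℤ.+-monoʳ-≤ a (ℤ.neg-mono-≤ (ΣB≤b p)) ⟩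
      a - sum {n} (λ q → + B p q)
        ≡⟨ cong (λ s → a - s) (trans (sum-remove {i = p} (λ q → + B p q))
             (trans (cong (λ u → + u + sum {n-1} (λ j → + B p (punchIn p j))) (Bpp p)) (ℤ.+-identityˡ _))) ⟩
      a - sum {n-1} (λ j → + B p (punchIn p j))
        ≡⟨ cong (_+_ a) (sum-neg (λ j → + B p (punchIn p j))) ⟩
      a + sum {n-1} (λ j → - + B p (punchIn p j))
        ≤⟨ ℤ.+-mono-≤ (ℤ.≤-reflexive diagonal) (sum-mono-≤ {n-1} (λ j → neg-≤-∣∣ _ (off j))) ⟩
      χ p * χ p * K p p + sum {n-1} (λ j → χ p * χ (punchIn p j) * K p (punchIn p j))
        ≡⟨ sum-remove {i = p} (λ q → χ p * χ q * K p q) ⟨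
      sum {n} (λ q → χ p * χ q * K p q) ∎
      where
      diagonal : a ≡ χ p * χ p * K p p
      diagonal = trans (sym (trans (ℤ.*-identityˡ (K p p)) (Kpp p)))
        (cong (_* K p p) (sym (unit (χ p) (∣χ∣≡1 p))))
      off : ∀ j → ∣ χ p * χ (punchIn p j) * K p (punchIn p j) ∣ ℕ.≤ B p (punchIn p j)
      off j = ℕ.≤-trans (ℕ.≤-reflexive (trans (ℤ.∣i*j∣≡∣i∣*∣j∣ (χ p * χ (punchIn p j)) (K p (punchIn p j)))
        (trans (cong (ℕ._* ∣ K p (punchIn p j) ∣) (trans (ℤ.∣i*j∣≡∣i∣*∣j∣ (χ p) (χ (punchIn p j)))
          (cong₂ ℕ._*_ (∣χ∣≡1 p) (∣χ∣≡1 (punchIn p j))))) (ℕ.*-identityˡ _))))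
        (∣K∣≤B p (punchIn p j) (punchInᵢ≢i p j ∘ sym))

  square-≤ : ∀ i {n} → ∣ i ∣ ℕ.≤ n → i * i ≤ + (n ℕ.* n)
  square-≤ i {n} i≤n = ℤ.≤-trans (ℤ.≤-reflexive (square i)) (+≤+ (ℕ.*-mono-≤ i≤n i≤n))
    where
    square : ∀ i → i * i ≡ + (∣ i ∣ ℕ.* ∣ i ∣)
    square (+ k)    = sym (ℤ.pos-* k k)
    square -[1+ k ] = refl

  -- The quadratic form of a coloring of the grid, bounded from both sides.

  module Grid (m : ℕ) .{{_ : ℕ.NonZero m}} where

    open Quotients m
    open KernelSum w
    open Kernel w
    open Autocorrelation w

    n : ℕ
    n = m ℕ.* m

    col row : Fin n → ℕ
    col p = toℕ (proj₁ (remQuot {m} m p))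
    row p = toℕ (proj₂ (remQuot {m} m p))

    col<m : ∀ p → col p ℕ.< m
    col<m p = toℕ<n (proj₁ (remQuot {m} m p))

    row<m : ∀ p → row p ℕ.< m
    row<m p = toℕ<n (proj₂ (remQuot {m} m p))

    height : ℕ → Fin n → ℕ
    height s p = M ℕ.* row p ℕ.+ s ℕ.* col p

    -- The lift by 2 w puts the whole support of the second difference at natural thresholds c, so
    -- that sums over c ≥ 0 lose nothing.
    level : ℕ → Fin n → ℕ
    level s p = w ℕ.+ (w ℕ.+ height s p)

    -- Levels are at most 2 w + 3 M m ≤ 14 w m. Rounding up to 16 makes the final constant 16 · 4² =
    -- 256 a square.
    R : ℕ
    R = 16 ℕ.* (w ℕ.* m)

    instance
      w≢0 : ℕ.NonZero w
      w≢0 = m ℕ.!≢0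

    dx dy : Fin n → Fin n → ℤ
    dx p q = + col p - + col q
    dy p q = + row p - + row q

    same : ∀ {p q} → dx p q ≡ 0ℤ × dy p q ≡ 0ℤ → p ≡ q
    same {p} {q} (dx≡0 , dy≡0) = trans (sym (combine-remQuot {m} m p))
      (trans (cong₂ (combine {m} {m}) (toℕ-injective (ℤ.+-injective (ℤ.i-j≡0⇒i≡j (+ col p) (+ col q) dx≡0)))
                            (toℕ-injective (ℤ.+-injective (ℤ.i-j≡0⇒i≡j (+ row p) (+ row q) dy≡0))))
        (combine-remQuot {m} m q))

    ∣dx∣≤m : ∀ p q → ∣ dx p q ∣ ℕ.≤ m
    ∣dx∣≤m p q = ℕ.≤-trans (ℕ.≤-reflexive (cong ∣_∣ (ℤ.m-n≡m⊖n (col p) (col q))))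
      (ℕ.≤-trans (ℤ.∣m⊝n∣≤m⊔n (col p) (col q)) (ℕ.⊔-lub (ℕ.<⇒≤ (col<m p)) (ℕ.<⇒≤ (col<m q))))

    sum-grid-B : ∀ p → sum {n} (λ q → + B (dx p q) (dy p q)) ≤ + w * (+ M * + M)
    sum-grid-B p = ℤ.≤-trans (ℤ.≤-reflexive (trans (sum-combine m m (λ q → + B (dx p q) (dy p q)))
      (sum-cong m λ i → sum-cong m λ j → cong (λ (k , l) → + B (+ col p - + toℕ k) (+ row p - + toℕ l))
        (remQuot-combine i j)))) (sum-B-≤ (col p) (row p) (ℕ.<⇒≤ (col<m p)))

    level<R : ∀ {a b} p → a ℕ.< M → b ℕ.< M → level (a ℕ.+ b) p ℕ.< R
    level<R {a} {b} p a<M b<M = begin-strict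
      w ℕ.+ (w ℕ.+ (M ℕ.* row p ℕ.+ (a ℕ.+ b) ℕ.* col p))
        ≤⟨ ℕ.+-monoʳ-≤ w (ℕ.+-monoʳ-≤ w (ℕ.+-mono-≤ (ℕ.*-monoʳ-≤ M (ℕ.<⇒≤ (row<m p)))
             (ℕ.*-mono-≤ (ℕ.+-mono-≤ (ℕ.<⇒≤ a<M) (ℕ.<⇒≤ b<M)) (ℕ.<⇒≤ (col<m p))))) ⟩
      w ℕ.+ (w ℕ.+ (M ℕ.* m ℕ.+ (M ℕ.+ M) ℕ.* m))
        ≡⟨ lem₁ w m ⟩
      w ℕ.+ w ℕ.+ 12 ℕ.* (w ℕ.* m)
        ≤⟨ ℕ.+-monoˡ-≤ (12 ℕ.* (w ℕ.* m)) (ℕ.+-mono-≤ (ℕ.m≤m*n w m) (ℕ.m≤m*n w m)) ⟩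
      w ℕ.* m ℕ.+ w ℕ.* m ℕ.+ 12 ℕ.* (w ℕ.* m)
        <⟨ ℕ.m<m+n _ (ℕ.>-nonZero⁻¹ (w ℕ.* m) {{ℕ.m*n≢0 w m}}) ⟩
      w ℕ.* m ℕ.+ w ℕ.* m ℕ.+ 12 ℕ.* (w ℕ.* m) ℕ.+ w ℕ.* m
        ≤⟨ ℕ.m≤m+n _ (w ℕ.* m) ⟩
      w ℕ.* m ℕ.+ w ℕ.* m ℕ.+ 12 ℕ.* (w ℕ.* m) ℕ.+ w ℕ.* m ℕ.+ w ℕ.* m
        ≡⟨ lem₂ (w ℕ.* m) ⟩
      R ∎
      where
      open ℕ.≤-Reasoning
      lem₁ : ∀ w m → w ℕ.+ (w ℕ.+ (4 ℕ.* w ℕ.* m ℕ.+ (4 ℕ.* w ℕ.+ 4 ℕ.* w) ℕ.* m)) ≡ w ℕ.+ w ℕ.+ 12 ℕ.* (w ℕ.* m)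
      lem₁ = ℕ-Solver.solve-∀
      lem₂ : ∀ u → u ℕ.+ u ℕ.+ 12 ℕ.* u ℕ.+ u ℕ.+ u ≡ 16 ℕ.* u
      lem₂ = ℕ-Solver.solve-∀

    module _ (χ : Fin n → ℤ) (∣χ∣≡1 : ∀ p → ∣ χ p ∣ ≡ 1) where

      H : ℕ → ℕ → ℤ
      H s c = sum {n} (λ p → χ p * θ c (level s p))

      H″ : ℕ → ℕ → ℤ
      H″ s c = sum {n} (λ p → χ p * G c (height s p))

      -- By `θ-shift`, lowering all levels by w is the same as raising the threshold by w, so the
      -- pattern `G` combines three parallel half-planes.
      H″≡ : ∀ s c → H″ s c ≡ H s c - + 2 * H s (w ℕ.+ c) + H s (w ℕ.+ (w ℕ.+ c))
      H″≡ s c = begin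
        H″ s c
          ≡⟨ sum-cong n (λ p → trans (cong₂ (λ a b → χ p * (θ c (level s p) - a - (a - b)))
               (sym (θ-shift w c _)) (sym (trans (θ-shift w (w ℕ.+ c) _) (θ-shift w c (height s p)))))
               (lem₁ (χ p) (θ c (level s p)) (θ (w ℕ.+ c) (level s p)) (θ (w ℕ.+ (w ℕ.+ c)) (level s p)))) ⟩
        sum {n} (λ p → 1ℤ * (1ℤ * f c p + - + 2 * f (w ℕ.+ c) p) + 1ℤ * f (w ℕ.+ (w ℕ.+ c)) p)
          ≡⟨ sum-linear n 1ℤ 1ℤ (λ p → 1ℤ * f c p + - + 2 * f (w ℕ.+ c) p) _ ⟩
        1ℤ * sum {n} (λ p → 1ℤ * f c p + - + 2 * f (w ℕ.+ c) p) + 1ℤ * H s (w ℕ.+ (w ℕ.+ c))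
          ≡⟨ cong (λ a → 1ℤ * a + 1ℤ * H s (w ℕ.+ (w ℕ.+ c))) (sum-linear n 1ℤ (- + 2) (f c) _) ⟩
        1ℤ * (1ℤ * H s c + - + 2 * H s (w ℕ.+ c)) + 1ℤ * H s (w ℕ.+ (w ℕ.+ c))
          ≡⟨ lem₂ (H s c) (H s (w ℕ.+ c)) (H s (w ℕ.+ (w ℕ.+ c))) ⟩
        H s c - + 2 * H s (w ℕ.+ c) + H s (w ℕ.+ (w ℕ.+ c)) ∎
        where
        open ≡-Reasoning
        f : ℕ → Fin n → ℤ
        f c p = χ p * θ c (level s p)
        lem₁ : ∀ x a b c → x * (a - b - (b - c)) ≡ 1ℤ * (1ℤ * (x * a) + - + 2 * (x * b)) + 1ℤ * (x * c)
        lem₁ = solve-∀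
        lem₂ : ∀ a b c → 1ℤ * (1ℤ * a + - + 2 * b) + 1ℤ * c ≡ a - + 2 * b + c
        lem₂ = solve-∀

      energy : ℤ
      energy = sum {M} λ a → sum {M} λ b → sum {R} λ c →
        H″ (toℕ a ℕ.+ toℕ b) (toℕ c) * H″ (toℕ a ℕ.+ toℕ b) (toℕ c)

      -- For each direction `gram` and `sum-G*G` give κ at a difference of heights, which is linear
      -- in `dx` and `dy`; the sums over b and a are then moved inside.
      energy≡ : energy ≡ sum {n} (λ p → sum {n} (λ q → χ p * χ q * K (dx p q) (dy p q)))
      energy≡ = trans (sum-cong M λ a → trans (sum-cong M λ b → trans
          (gram R n χ (λ c p → G (toℕ c) (height (toℕ a ℕ.+ toℕ b) p)))
          (sum-cong n λ p → sum-cong n λ q → cong (χ p * χ q *_) (autocorrelation a b p q)))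
          (sum-pairs-swap M n (λ p q → χ p * χ q) (λ b p q → k a b p q)))
        (sum-pairs-swap M n (λ p q → χ p * χ q) (λ a p q → sum {M} (λ b → k a b p q)))
        where
        k : Fin M → Fin M → Fin n → Fin n → ℤ
        k a b p q = κ (+ M * dy p q + + (toℕ a ℕ.+ toℕ b) * dx p q)
        lem : ∀ M s y y′ x x′ → M * y + s * x - (M * y′ + s * x′) ≡ M * (y - y′) + s * (x - x′)
        lem = solve-∀
        pos-height : ∀ s p → + height s p ≡ + M * + row p + + s * + col p
        pos-height s p = cong₂ _+_ (ℤ.pos-* M (row p)) (ℤ.pos-* s (col p))
        autocorrelation : ∀ a b p q → let s = toℕ a ℕ.+ toℕ b in
          sum {R} (λ c → G (toℕ c) (height s p) * G (toℕ c) (height s q)) ≡ k a b p q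
        autocorrelation a b p q = trans
          (sum-G*G R (height s p) (height s q) (level<R p (toℕ<n a) (toℕ<n b)) (level<R q (toℕ<n a) (toℕ<n b)))
          (cong κ (trans (cong₂ _-_ (pos-height s p) (pos-height s q))
            (lem (+ M) (+ s) (+ row p) (+ row q) (+ col p) (+ col q))))
          where s = toℕ a ℕ.+ toℕ b

      energy≥ : + n * (+ w * (+ M * + M)) ≤ energy
      energy≥ = ℤ.≤-trans (ℤ.≤-reflexive (cong (+ n *_) (lem (+ M) (+ w))))
        (ℤ.≤-trans (dominance n χ (λ p q → K (dx p q) (dy p q)) (λ p q → B (dx p q) (dy p q))
            (+ M * (+ M * (+ w + + w))) (+ w * (+ M * + M)) ∣χ∣≡1
            (λ p → trans (cong₂ K (ℤ.+-inverseʳ (+ col p)) (ℤ.+-inverseʳ (+ row p))) K-diagonal)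
            (λ p → cong (λ u → B u (dy p p)) (ℤ.+-inverseʳ (+ col p)))
            (λ p q p≢q → ∣K∣≤B (dx p q) (dy p q) (p≢q ∘ same) (∣dx∣≤m p q))
            sum-grid-B)
          (ℤ.≤-reflexive (sym energy≡)))
        where
        lem : ∀ M w → w * (M * M) ≡ M * (M * (w + w)) - w * (M * M)
        lem = solve-∀

      -- `H″` at c < `R` refers to the thresholds c, c + w and c + 2 w, hence the longer range of c
      -- in the hypothesis. The coefficients 1, -2, 1 turn D into 4 D.
      energy≤ : ∀ D → (∀ s c → s ℕ.< M ℕ.+ M → c ℕ.< w ℕ.+ (w ℕ.+ R) → ∣ H s c ∣ ℕ.≤ D) →
        energy ≤ + M * (+ M * (+ R * + (4 ℕ.* D ℕ.* (4 ℕ.* D))))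
      energy≤ D H≤D = sum-≤-const {M} _ λ a → sum-≤-const {M} _ λ b → sum-≤-const {R} _ λ c →
        square-≤ (H″ (toℕ a ℕ.+ toℕ b) (toℕ c)) (bound (toℕ a ℕ.+ toℕ b) (toℕ c) (ℕ.+-mono-< (toℕ<n a) (toℕ<n b)) (toℕ<n c))
        where
        bound : ∀ s c → s ℕ.< M ℕ.+ M → c ℕ.< R → ∣ H″ s c ∣ ℕ.≤ 4 ℕ.* D
        bound s c s< c<R = begin
          ∣ H″ s c ∣
            ≡⟨ cong ∣_∣ (H″≡ s c) ⟩
          ∣ H s c - + 2 * H s (w ℕ.+ c) + H s (w ℕ.+ (w ℕ.+ c)) ∣
            ≤⟨ ∣a-2b+c∣≤ (H s c) (H s (w ℕ.+ c)) (H s (w ℕ.+ (w ℕ.+ c))) ⟩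
          ∣ H s c ∣ ℕ.+ 2 ℕ.* ∣ H s (w ℕ.+ c) ∣ ℕ.+ ∣ H s (w ℕ.+ (w ℕ.+ c)) ∣
            ≤⟨ ℕ.+-mono-≤ (ℕ.+-mono-≤
                 (H≤D s c s< (ℕ.<-≤-trans c<R (ℕ.≤-trans (ℕ.m≤n+m R w) (ℕ.m≤n+m _ w))))
                 (ℕ.*-monoʳ-≤ 2 (H≤D s _ s< (ℕ.+-monoʳ-< w (ℕ.<-≤-trans c<R (ℕ.m≤n+m R w))))))
                 (H≤D s _ s< (ℕ.+-monoʳ-< w (ℕ.+-monoʳ-< w c<R))) ⟩
          D ℕ.+ 2 ℕ.* D ℕ.+ D
            ≡⟨ lem D ⟩
          4 ℕ.* D ∎
          where
          open ℕ.≤-Reasoning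
          lem : ∀ D → D ℕ.+ 2 ℕ.* D ℕ.+ D ≡ 4 ℕ.* D
          lem = ℕ-Solver.solve-∀

      -- The two bounds give n w M² ≤ M² R (4 D)². With n = m² and `R` = 16 w m the factor w M² m
      -- cancels, and the factorial with it.
      halfplane-discrepancy : ∀ D →
        (∀ s c → s ℕ.< M ℕ.+ M → c ℕ.< w ℕ.+ (w ℕ.+ R) → ∣ H s c ∣ ℕ.≤ D) → m ℕ.≤ 256 ℕ.* (D ℕ.* D)
      halfplane-discrepancy D H≤D = ℕ.*-cancelˡ-≤ (w ℕ.* (M ℕ.* M) ℕ.* m)
        {{ℕ.m*n≢0 _ m {{ℕ.m*n≢0 w _ {{w≢0}} {{ℕ.m*n≢0 M M {{M≢0}} {{M≢0}}}}}}}} (begin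
          w ℕ.* (M ℕ.* M) ℕ.* m ℕ.* m                      ≡⟨ lem₁ w M m ⟩
          n ℕ.* (w ℕ.* (M ℕ.* M))                          ≤⟨ ℤ.drop‿+≤+ inequality ⟩
          M ℕ.* (M ℕ.* (R ℕ.* (4 ℕ.* D ℕ.* (4 ℕ.* D))))    ≡⟨ lem₂ M w m D ⟩
          w ℕ.* (M ℕ.* M) ℕ.* m ℕ.* (256 ℕ.* (D ℕ.* D))    ∎)
        where
        open ℕ.≤-Reasoning
        M≢0 : ℕ.NonZero M
        M≢0 = ℕ.m*n≢0 4 w
        lem₁ : ∀ w M m → w ℕ.* (M ℕ.* M) ℕ.* m ℕ.* m ≡ m ℕ.* m ℕ.* (w ℕ.* (M ℕ.* M))
        lem₁ = ℕ-Solver.solve-∀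
        lem₂ : ∀ M w m D → M ℕ.* (M ℕ.* (16 ℕ.* (w ℕ.* m) ℕ.* (4 ℕ.* D ℕ.* (4 ℕ.* D)))) ≡
          w ℕ.* (M ℕ.* M) ℕ.* m ℕ.* (256 ℕ.* (D ℕ.* D))
        lem₂ = ℕ-Solver.solve-∀
        inequality : + (n ℕ.* (w ℕ.* (M ℕ.* M))) ≤ + (M ℕ.* (M ℕ.* (R ℕ.* (4 ℕ.* D ℕ.* (4 ℕ.* D)))))
        inequality = ℤ.≤-trans
          (ℤ.≤-reflexive (trans (ℤ.pos-* n _) (cong (+ n *_) (trans (ℤ.pos-* w _) (cong (+ w *_) (ℤ.pos-* M M))))))
          (ℤ.≤-trans energy≥ (ℤ.≤-trans (energy≤ D H≤D) (ℤ.≤-reflexive (sym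
            (trans (ℤ.pos-* M _) (cong (+ M *_) (trans (ℤ.pos-* M _) (cong (+ M *_) (ℤ.pos-* R _)))))))))

open import Defs
open import Data.Bool.Base using (true; false; if_then_else_; not)
open import Data.Empty using (⊥-elim)
open import Data.Fin.Base using (Fin; zero; suc; toℕ)
open import Data.Fin.Properties using (toℕ<n; toℕ-injective)
open import Data.Fin.Subset using (Subset; _∈_; Nonempty; ⊤; ⊥)
open import Data.Fin.Subset.Properties using (∈⊤; nonempty?; Empty-unique)
open import Data.Integer.Base as ℤ using (ℤ; +_; -[1+_]; 0ℤ; 1ℤ)
import Data.Integer.Properties as ℤ
open import Data.Integer.Tactic.RingSolver using (solve-∀)
open import Data.Nat.Base as ℕ using (ℕ; zero; suc; z≤n; s≤s; _≥_)
import Data.Nat.DivMod as ℕ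
import Data.Nat.Properties as ℕ
import Data.Nat.Tactic.RingSolver as ℕ-Solver
open import Data.Product using (Σ-syntax; ∃-syntax; ∃!; _×_; _,_; proj₁; proj₂)
open import Data.Rational as ℚ using (ℚ; 0ℚ; 1ℚ; ½)
import Data.Rational.Properties as ℚ
open import Data.Rational.Solver using (module +-*-Solver)
import Data.Rational.Unnormalised as ℚᵘ
import Data.Rational.Unnormalised.Properties as ℚᵘ
open import Data.Sum.Base using (inj₁; inj₂)
import Data.Unit.Base as Unit
open import Data.Vec.Base using (Vec; []; _∷_; lookup; tabulate)
open import Data.Vec.Properties using (lookup∘tabulate; lookup⇒[]=; []=⇒lookup; lookup-replicate)
open import Function.Base using (_∘_)
open import Function.Bundles using (_⇔_; mk⇔; Equivalence)
open import Relation.Binary.PropositionalEquality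
  using (_≡_; _≢_; refl; sym; trans; cong; cong₂; subst; subst₂; module ≡-Reasoning)
open import Relation.Nullary using (¬_; Dec; yes; no)
open import Relation.Nullary.Decidable using (does; dec-true; dec-false)
open import Relation.Unary using (Pred)
open import Algebra.Properties.Semiring.Sum ℤ.+-*-semiring
  using (sum; ∑-distrib-+; sum-cong-≗; sum-replicate-zero)
open +-*-Solver using (solve; con; _:+_; _:*_; _:-_; :-_; _:=_)

-- Integers in ℚ and ℝ, and nonnegativity in ℝ.

ι : ℤ → ℚ
ι z = z ℚ./ 1

ι-toℚᵘ : ∀ z → ℚ.toℚᵘ (ι z) ℚᵘ.≃ ℚᵘ.mkℚᵘ z 0
ι-toℚᵘ z = ℚ.toℚᵘ-fromℚᵘ (ℚᵘ.mkℚᵘ z 0)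

ι-+ : ∀ a b → ι (a ℤ.+ b) ≡ ι a ℚ.+ ι b
ι-+ a b = ℚ.toℚᵘ-injective (ℚᵘ.≃-trans (ι-toℚᵘ (a ℤ.+ b)) (ℚᵘ.≃-trans (ℚᵘ.*≡* (lem a b))
  (ℚᵘ.≃-sym (ℚᵘ.≃-trans (ℚ.toℚᵘ-homo-+ (ι a) (ι b)) (ℚᵘ.+-cong (ι-toℚᵘ a) (ι-toℚᵘ b))))))
  where
  lem : ∀ a b → (a ℤ.+ b) ℤ.* 1ℤ ≡ (a ℤ.* 1ℤ ℤ.+ b ℤ.* 1ℤ) ℤ.* 1ℤ
  lem = solve-∀

ι-* : ∀ a b → ι (a ℤ.* b) ≡ ι a ℚ.* ι b
ι-* a b = ℚ.toℚᵘ-injective (ℚᵘ.≃-trans (ι-toℚᵘ (a ℤ.* b)) (ℚᵘ.≃-trans (ℚᵘ.*≡* refl)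
  (ℚᵘ.≃-sym (ℚᵘ.≃-trans (ℚ.toℚᵘ-homo-* (ι a) (ι b)) (ℚᵘ.*-cong (ι-toℚᵘ a) (ι-toℚᵘ b))))))

ι-mono-≤ : ∀ {a b} → a ℤ.≤ b → ι a ℚ.≤ ι b
ι-mono-≤ {a} {b} a≤b = ℚ.toℚᵘ-cancel-≤ (ℚᵘ.≤-respˡ-≃ (ℚᵘ.≃-sym (ι-toℚᵘ a))
  (ℚᵘ.≤-respʳ-≃ (ℚᵘ.≃-sym (ι-toℚᵘ b)) (ℚᵘ.*≤* (ℤ.*-monoʳ-≤-nonNeg 1ℤ a≤b))))

ι-cancel-≤ : ∀ {a b} → ι a ℚ.≤ ι b → a ℤ.≤ b
ι-cancel-≤ {a} {b} a≤b = subst₂ ℤ._≤_ (ℤ.*-identityʳ a) (ℤ.*-identityʳ b)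
  (ℚᵘ.drop-*≤* (ℚᵘ.≤-respˡ-≃ (ι-toℚᵘ a) (ℚᵘ.≤-respʳ-≃ (ι-toℚᵘ b) (ℚ.toℚᵘ-mono-≤ a≤b))))

ι≡0⇒≡0 : ∀ {a} → ι a ≡ 0ℚ → a ≡ 0ℤ
ι≡0⇒≡0 eq = ℤ.≤-antisym (ι-cancel-≤ (ℚ.≤-reflexive eq)) (ι-cancel-≤ (ℚ.≤-reflexive (sym eq)))

ι-- : ∀ a b → ι (a ℤ.- b) ≡ ι a ℚ.- ι b
ι-- a b = begin
  ι (a ℤ.- b)                     ≡⟨ lem (ι (a ℤ.- b)) (ι b) ⟩
  ι (a ℤ.- b) ℚ.+ ι b ℚ.- ι b     ≡⟨ cong (ℚ._- ι b) (ι-+ (a ℤ.- b) b) ⟨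
  ι (a ℤ.- b ℤ.+ b) ℚ.- ι b       ≡⟨ cong (λ c → ι c ℚ.- ι b) (lem′ a b) ⟩
  ι a ℚ.- ι b                     ∎
  where
  open ≡-Reasoning
  lem : ∀ p q → p ≡ p ℚ.+ q ℚ.- q
  lem = solve 2 (λ p q → p := p :+ q :- q) refl
  lem′ : ∀ a b → a ℤ.- b ℤ.+ b ≡ a
  lem′ = solve-∀

ℤ→ℝ : ℤ → ℝ
ℤ→ℝ z = fromℚ (ι z)

-- Real identities used below hold termwise, so this reduces them to ring identities in ℚ.
0≤-cong : ∀ x y → (∀ k → seq x k ≡ seq y k) → 0ℝ ≤ x → 0ℝ ≤ y
0≤-cong x y x≗y 0≤x ε 0<ε with 0≤x ε 0<ε
... | N , h = N , λ k N≤k → subst (λ q → 0ℚ ℚ.≤ q ℚ.+ ε) (x≗y k) (h k N≤k)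

0<½*ε : ∀ {ε} → 0ℚ ℚ.< ε → 0ℚ ℚ.< ½ ℚ.* ε
0<½*ε {ε} 0<ε = ℚ.positive⁻¹ _ {{ℚ.pos*pos⇒pos ½ ε {{ℚ.positive 0<ε}}}}

0≤x+y : ∀ x y → 0ℝ ≤ x → 0ℝ ≤ y → 0ℝ ≤ x + y
0≤x+y x y 0≤x 0≤y ε 0<ε with 0≤x _ (0<½*ε 0<ε) | 0≤y _ (0<½*ε 0<ε)
... | M , hx | N , hy = M ℕ.⊔ N , λ k h → subst (0ℚ ℚ.≤_) (lem (seq x k) (seq y k) ε)
  (ℚ.+-mono-≤ (hx k (ℕ.m⊔n≤o⇒m≤o M N h)) (hy k (ℕ.m⊔n≤o⇒n≤o M N h)))
  where
  lem : ∀ a b ε → (a ℚ.+ ½ ℚ.* ε) ℚ.+ (b ℚ.+ ½ ℚ.* ε) ≡ (a ℚ.+ b) ℚ.+ ε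
  lem = solve 3 (λ a b ε → (a :+ con ½ :* ε) :+ (b :+ con ½ :* ε) := (a :+ b) :+ ε) refl

0≤p*q : ∀ {p q} → 0ℚ ℚ.≤ p → 0ℚ ℚ.≤ q → 0ℚ ℚ.≤ p ℚ.* q
0≤p*q {p} {q} 0≤p 0≤q = subst (ℚ._≤ p ℚ.* q) (ℚ.*-zeroˡ q)
  (ℚ.*-monoʳ-≤-nonNeg q {{ℚ.nonNegative 0≤q}} 0≤p)

p≤q⇒0≤q-p : ∀ {p q} → p ℚ.≤ q → 0ℚ ℚ.≤ q ℚ.- p
p≤q⇒0≤q-p {p} {q} p≤q = subst (ℚ._≤ q ℚ.- p) (ℚ.+-inverseʳ p) (ℚ.+-monoˡ-≤ (ℚ.- p) p≤q)

0≤q-p⇒p≤q : ∀ {p q} → 0ℚ ℚ.≤ q ℚ.- p → p ℚ.≤ q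
0≤q-p⇒p≤q {p} {q} h = subst₂ ℚ._≤_ (ℚ.+-identityˡ p) (lem q p) (ℚ.+-monoˡ-≤ p h)
  where
  lem : ∀ q p → q ℚ.- p ℚ.+ p ≡ q
  lem = solve 2 (λ q p → q :- p :+ p := q) refl

eventually-≤ : ∀ x → Σ[ B ∈ ℚ ] 0ℚ ℚ.≤ B × ∃[ N ] ∀ k → N ℕ.≤ k → seq x k ℚ.≤ B
eventually-≤ x with cauchy x 1ℚ (ℚ.positive⁻¹ 1ℚ)
... | N , h = 1ℚ ℚ.+ ℚ.∣ seq x N ∣ , ℚ.+-mono-≤ (ℚ.nonNegative⁻¹ 1ℚ) (ℚ.0≤∣p∣ (seq x N)) , N ,
  λ k N≤k → subst (ℚ._≤ 1ℚ ℚ.+ ℚ.∣ seq x N ∣) (lem (seq x k) (seq x N))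
    (ℚ.+-mono-≤ (ℚ.≤-trans (p≤∣p∣ (seq x k ℚ.- seq x N)) (ℚ.<⇒≤ (h k N N≤k ℕ.≤-refl))) (p≤∣p∣ (seq x N)))
  where
  lem : ∀ a b → a ℚ.- b ℚ.+ b ≡ a
  lem = solve 2 (λ a b → a :- b :+ b := a) refl
  p≤∣p∣ : ∀ p → p ℚ.≤ ℚ.∣ p ∣
  p≤∣p∣ p with ℚ.≤-total 0ℚ p
  ... | inj₁ 0≤p = ℚ.≤-reflexive (sym (ℚ.0≤p⇒∣p∣≡p 0≤p))
  ... | inj₂ p≤0 = ℚ.≤-trans p≤0 (ℚ.0≤∣p∣ p)

-- The choice ε / (D + ε) meets both upper bounds at once, without a minimum.
small-factor : ∀ D ε → 0ℚ ℚ.≤ D → 0ℚ ℚ.< ε →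
  Σ[ δ ∈ ℚ ] 0ℚ ℚ.< δ × δ ℚ.≤ 1ℚ × δ ℚ.* D ℚ.≤ ε
small-factor D ε 0≤D 0<ε = δ , ℚ.positive⁻¹ δ , δ≤1 , δD≤ε
  where
  instance
    ε>0   = ℚ.positive 0<ε
    E>0   = ℚ.positive (ℚ.+-mono-≤-< 0≤D 0<ε)
    E≢0   = ℚ.pos⇒nonZero (D ℚ.+ ε)
    1/E>0 = ℚ.1/pos⇒pos (D ℚ.+ ε)
    δ>0   = ℚ.pos*pos⇒pos (ℚ.1/ (D ℚ.+ ε)) ε
  E = D ℚ.+ ε
  δ = (ℚ.1/ E) ℚ.* ε
  open ℚ.≤-Reasoning
  δE≡ε : δ ℚ.* E ≡ ε
  δE≡ε = begin-equality
    (ℚ.1/ E) ℚ.* ε ℚ.* E      ≡⟨ lem (ℚ.1/ E) ε E ⟩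
    ((ℚ.1/ E) ℚ.* E) ℚ.* ε    ≡⟨ cong (ℚ._* ε) (ℚ.*-inverseˡ E) ⟩
    1ℚ ℚ.* ε                  ≡⟨ ℚ.*-identityˡ ε ⟩
    ε                         ∎
    where
    lem : ∀ a b c → a ℚ.* b ℚ.* c ≡ a ℚ.* c ℚ.* b
    lem = solve 3 (λ a b c → a :* b :* c := a :* c :* b) refl
  δ≤1 : δ ℚ.≤ 1ℚ
  δ≤1 = ℚ.*-cancelʳ-≤-pos E (begin
    δ ℚ.* E      ≡⟨ δE≡ε ⟩
    ε            ≡⟨ ℚ.+-identityˡ ε ⟨
    0ℚ ℚ.+ ε     ≤⟨ ℚ.+-monoˡ-≤ ε 0≤D ⟩
    E            ≡⟨ ℚ.*-identityˡ E ⟨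
    1ℚ ℚ.* E     ∎)
  δD≤ε : δ ℚ.* D ℚ.≤ ε
  δD≤ε = begin
    δ ℚ.* D        ≤⟨ ℚ.*-monoˡ-≤-nonNeg δ {{ℚ.pos⇒nonNeg δ}} (begin
      D ≡⟨ ℚ.+-identityʳ D ⟨ D ℚ.+ 0ℚ ≤⟨ ℚ.+-monoʳ-≤ D (ℚ.<⇒≤ 0<ε) ⟩ D ℚ.+ ε ∎) ⟩
    δ ℚ.* E        ≡⟨ δE≡ε ⟩
    ε              ∎

-- From (a + δ) (b + δ) ≥ 0.
0≤a*b+ε : ∀ a b A B δ ε → a ℚ.≤ A → b ℚ.≤ B → 0ℚ ℚ.≤ a ℚ.+ δ → 0ℚ ℚ.≤ b ℚ.+ δ →
  0ℚ ℚ.≤ δ → δ ℚ.≤ 1ℚ → δ ℚ.* (A ℚ.+ B ℚ.+ 1ℚ) ℚ.≤ ε → 0ℚ ℚ.≤ a ℚ.* b ℚ.+ ε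
0≤a*b+ε a b A B δ ε a≤A b≤B 0≤a+δ 0≤b+δ 0≤δ δ≤1 δD≤ε = begin
  0ℚ
    ≤⟨ ℚ.+-mono-≤ (0≤p*q {a ℚ.+ δ} {b ℚ.+ δ} 0≤a+δ 0≤b+δ) (0≤p*q {δ} {D ℚ.- (a ℚ.+ b ℚ.+ δ)} 0≤δ slack) ⟩
  (a ℚ.+ δ) ℚ.* (b ℚ.+ δ) ℚ.+ δ ℚ.* (D ℚ.- (a ℚ.+ b ℚ.+ δ))
    ≡⟨ lem a b D δ ⟩
  a ℚ.* b ℚ.+ δ ℚ.* D
    ≤⟨ ℚ.+-monoʳ-≤ (a ℚ.* b) δD≤ε ⟩
  a ℚ.* b ℚ.+ ε ∎
  where
  open ℚ.≤-Reasoning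
  D = A ℚ.+ B ℚ.+ 1ℚ
  slack : 0ℚ ℚ.≤ D ℚ.- (a ℚ.+ b ℚ.+ δ)
  slack = p≤q⇒0≤q-p {a ℚ.+ b ℚ.+ δ} {D}
    (ℚ.+-mono-≤ {a ℚ.+ b} {A ℚ.+ B} {δ} {1ℚ} (ℚ.+-mono-≤ {a} {A} {b} {B} a≤A b≤B) δ≤1)
  lem : ∀ a b C δ → (a ℚ.+ δ) ℚ.* (b ℚ.+ δ) ℚ.+ δ ℚ.* (C ℚ.- (a ℚ.+ b ℚ.+ δ)) ≡ a ℚ.* b ℚ.+ δ ℚ.* C
  lem = solve 4 (λ a b C δ → (a :+ δ) :* (b :+ δ) :+ δ :* (C :- (a :+ b :+ δ)) := a :* b :+ δ :* C) refl

-- Terms of a nonnegative real are only eventually above -δ, so a product of terms may be negative;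
-- the eventual upper bounds `A` and `B` keep that error below ε.
0≤x*y : ∀ x y → 0ℝ ≤ x → 0ℝ ≤ y → 0ℝ ≤ x * y
0≤x*y x y 0≤x 0≤y ε 0<ε = go (eventually-≤ x) (eventually-≤ y)
  where
  go : Σ[ A ∈ ℚ ] 0ℚ ℚ.≤ A × ∃[ N ] (∀ k → N ℕ.≤ k → seq x k ℚ.≤ A) →
       Σ[ B ∈ ℚ ] 0ℚ ℚ.≤ B × ∃[ N ] (∀ k → N ℕ.≤ k → seq y k ℚ.≤ B) →
       ∃[ N ] ∀ k → N ℕ.≤ k → 0ℚ ℚ.≤ seq x k ℚ.* seq y k ℚ.+ ε
  go (A , 0≤A , M₁ , hA) (B , 0≤B , N₁ , hB) = (M₁ ℕ.⊔ N₁) ℕ.⊔ (M₂ ℕ.⊔ N₂) , λ k h →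
    let h₁ = ℕ.m⊔n≤o⇒m≤o (M₁ ℕ.⊔ N₁) (M₂ ℕ.⊔ N₂) h
        h₂ = ℕ.m⊔n≤o⇒n≤o (M₁ ℕ.⊔ N₁) (M₂ ℕ.⊔ N₂) h
    in 0≤a*b+ε (seq x k) (seq y k) A B δ ε
         (hA k (ℕ.m⊔n≤o⇒m≤o M₁ N₁ h₁)) (hB k (ℕ.m⊔n≤o⇒n≤o M₁ N₁ h₁))
         (hx k (ℕ.m⊔n≤o⇒m≤o M₂ N₂ h₂)) (hy k (ℕ.m⊔n≤o⇒n≤o M₂ N₂ h₂))
         (ℚ.<⇒≤ 0<δ) (proj₁ (proj₂ (proj₂ small))) (proj₂ (proj₂ (proj₂ small)))
    where
    small : Σ[ δ ∈ ℚ ] 0ℚ ℚ.< δ × δ ℚ.≤ 1ℚ × δ ℚ.* (A ℚ.+ B ℚ.+ 1ℚ) ℚ.≤ ε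
    small = small-factor (A ℚ.+ B ℚ.+ 1ℚ) ε (ℚ.+-mono-≤ (ℚ.+-mono-≤ 0≤A 0≤B) (ℚ.nonNegative⁻¹ 1ℚ)) 0<ε
    δ   = proj₁ small
    0<δ = proj₁ (proj₂ small)
    M₂  = proj₁ (0≤x δ 0<δ)
    hx  = proj₂ (0≤x δ 0<δ)
    N₂  = proj₁ (0≤y δ 0<δ)
    hy  = proj₂ (0≤y δ 0<δ)

≤⇒0≤- : ∀ x y → x ≤ y → 0ℝ ≤ y - x
≤⇒0≤- x y x≤y ε 0<ε with x≤y ε 0<ε
... | N , h = N , λ k N≤k → subst (0ℚ ℚ.≤_) (lem (seq y k) (seq x k) ε) (p≤q⇒0≤q-p (h k N≤k))
  where
  lem : ∀ a b ε → a ℚ.+ ε ℚ.- b ≡ a ℚ.- b ℚ.+ ε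
  lem = solve 3 (λ a b ε → a :+ ε :- b := a :- b :+ ε) refl

0≤-⇒≤ : ∀ x y → 0ℝ ≤ y - x → x ≤ y
0≤-⇒≤ x y 0≤y-x ε 0<ε with 0≤y-x ε 0<ε
... | N , h = N , λ k N≤k → 0≤q-p⇒p≤q (subst (0ℚ ℚ.≤_) (lem (seq y k) (seq x k) ε) (h k N≤k))
  where
  lem : ∀ a b ε → a ℚ.- b ℚ.+ ε ≡ a ℚ.+ ε ℚ.- b
  lem = solve 3 (λ a b ε → a :- b :+ ε := a :+ ε :- b) refl

0≤fromℚ : ∀ {q} → 0ℚ ℚ.≤ q → 0ℝ ≤ fromℚ q
0≤fromℚ {q} 0≤q ε 0<ε = 0 , λ _ _ → ℚ.+-mono-≤ 0≤q (ℚ.<⇒≤ 0<ε)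

0≤ℤ→ℝ : ∀ {z} → 0ℤ ℤ.≤ z → 0ℝ ≤ ℤ→ℝ z
0≤ℤ→ℝ 0≤z = 0≤fromℚ (ι-mono-≤ 0≤z)

0≤ℤ→ℝ⁻¹ : ∀ {z} → 0ℝ ≤ ℤ→ℝ z → 0ℤ ℤ.≤ z
0≤ℤ→ℝ⁻¹ {+ _}      _ = ℤ.+≤+ z≤n
-- The tolerance ½ separates: a negative integer is at most -1, and -1 + ½ < 0.
0≤ℤ→ℝ⁻¹ { -[1+ k ]} 0≤z with 0≤z ½ (ℚ.positive⁻¹ ½)
... | N , h = ⊥-elim (ℚ.<-irrefl refl (ℚ.≤-<-trans
  (ℚ.≤-trans (h N ℕ.≤-refl) (ℚ.+-monoˡ-≤ ½ (ι-mono-≤ { -[1+ k ]} {ℤ.- 1ℤ} (ℤ.-≤- z≤n))))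
  (ℚ.negative⁻¹ (ι (ℤ.- 1ℤ) ℚ.+ ½))))

-- Being zero, split into two nonnegativity claims, to which `0≤x+y` and `0≤x*y` apply.
Null : ℝ → Set
Null x = 0ℝ ≤ x × 0ℝ ≤ - x

Null-cong : ∀ x y → (∀ k → seq x k ≡ seq y k) → Null x → Null y
Null-cong x y x≗y (0≤x , 0≤-x) =
  0≤-cong x y x≗y 0≤x , 0≤-cong (- x) (- y) (λ k → cong ℚ.-_ (x≗y k)) 0≤-x

Null-+ : ∀ x y → Null x → Null y → Null (x + y)
Null-+ x y (0≤x , 0≤-x) (0≤y , 0≤-y) = 0≤x+y x y 0≤x 0≤y ,
  0≤-cong (- x + - y) (- (x + y)) (λ k → sym (ℚ.neg-distrib-+ (seq x k) (seq y k))) (0≤x+y (- x) (- y) 0≤-x 0≤-y)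

Null-* : ∀ q x → Null x → Null (fromℚ q * x)
Null-* q x (0≤x , 0≤-x) with ℚ.≤-total 0ℚ q
... | inj₁ 0≤q = 0≤x*y (fromℚ q) x (0≤fromℚ 0≤q) 0≤x ,
  0≤-cong (fromℚ q * - x) (- (fromℚ q * x)) (λ k → sym (ℚ.neg-distribʳ-* q (seq x k)))
    (0≤x*y (fromℚ q) (- x) (0≤fromℚ 0≤q) 0≤-x)
... | inj₂ q≤0 = 0≤-cong (fromℚ (ℚ.- q) * - x) (fromℚ q * x) (λ k → lem q (seq x k))
    (0≤x*y (fromℚ (ℚ.- q)) (- x) 0≤-q 0≤-x) ,
  0≤-cong (fromℚ (ℚ.- q) * x) (- (fromℚ q * x)) (λ k → sym (ℚ.neg-distribˡ-* q (seq x k)))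
    (0≤x*y (fromℚ (ℚ.- q)) x 0≤-q 0≤x)
  where
  0≤-q = 0≤fromℚ (ℚ.neg-antimono-≤ q≤0)
  lem : ∀ q x → ℚ.- q ℚ.* ℚ.- x ≡ q ℚ.* x
  lem = solve 2 (λ q x → :- q :* :- x := q :* x) refl

≃⇒Null : ∀ x y → x ≃ y → Null (x - y)
≃⇒Null x y (x≤y , y≤x) = ≤⇒0≤- y x y≤x ,
  0≤-cong (y - x) (- (x - y)) (λ k → lem (seq y k) (seq x k)) (≤⇒0≤- x y x≤y)
  where
  lem : ∀ a b → a ℚ.- b ≡ ℚ.- (b ℚ.- a)
  lem = solve 2 (λ a b → a :- b := :- (b :- a)) refl

Null⇒≃0 : ∀ x → Null x → x ≃ 0ℝ
Null⇒≃0 x (0≤x , 0≤-x) =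
  0≤-⇒≤ x 0ℝ (0≤-cong (- x) (0ℝ - x) (λ k → sym (ℚ.+-identityˡ (ℚ.- seq x k))) 0≤-x) ,
  0≤-⇒≤ 0ℝ x (0≤-cong x (x - 0ℝ) (λ k → sym (ℚ.+-identityʳ (seq x k))) 0≤x)

Null-cancel : ∀ z x → z ≢ 0ℤ → Null (ℤ→ℝ z * x) → Null x
Null-cancel z x z≢0 null = Null-cong (fromℚ (ℚ.1/ ι z) * (ℤ→ℝ z * x)) x
  (λ k → trans (sym (ℚ.*-assoc (ℚ.1/ ι z) (ι z) (seq x k)))
    (trans (cong (ℚ._* seq x k) (ℚ.*-inverseˡ (ι z))) (ℚ.*-identityˡ (seq x k))))
  (Null-* (ℚ.1/ ι z) (ℤ→ℝ z * x) null)
  where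
  instance
    ιz≢0 : ℚ.NonZero (ι z)
    ιz≢0 = ℚ.≢-nonZero (z≢0 ∘ ι≡0⇒≡0)

ℤ→ℝ-injective : ∀ {a b} → ℤ→ℝ a ≃ ℤ→ℝ b → a ≡ b
ℤ→ℝ-injective {a} {b} (a≤b , b≤a) = ℤ.≤-antisym (cancel a b a≤b) (cancel b a b≤a)
  where
  cancel : ∀ a b → ℤ→ℝ a ≤ ℤ→ℝ b → a ℤ.≤ b
  cancel a b a≤b = ℤ.0≤i-j⇒j≤i (0≤ℤ→ℝ⁻¹ (0≤-cong (ℤ→ℝ b - ℤ→ℝ a) (ℤ→ℝ (b ℤ.- a)) (λ _ → sym (ι-- b a))
    (≤⇒0≤- (ℤ→ℝ a) (ℤ→ℝ b) a≤b)))

ι-neg : ∀ a → ι (ℤ.- a) ≡ ℚ.- ι a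
ι-neg a = trans (cong ι (sym (ℤ.+-identityˡ (ℤ.- a)))) (trans (ι-- 0ℤ a) (ℚ.+-identityˡ (ℚ.- ι a)))

-- Half-planes with integer coefficients.

affine : ℤ → ℤ → ℤ → Point → ℝ
affine α β γ (x , y) = ℤ→ℝ α * x + ℤ→ℝ β * y + ℤ→ℝ γ

HalfPlane : ℤ → ℤ → ℤ → Pred Point _
HalfPlane α β γ q = 0ℝ ≤ affine α β γ q

halfPlane-resp : ∀ α β γ p q → q ≃ₚ p → HalfPlane α β γ p → HalfPlane α β γ q
halfPlane-resp α β γ p@(x , y) q@(x′ , y′) (x′≃x , y′≃y) 0≤p =
  0≤-cong (affine α β γ p + (ℤ→ℝ α * (x′ - x) + ℤ→ℝ β * (y′ - y))) (affine α β γ q)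
    (λ k → lem (ι α) (ι β) (ι γ) (seq x k) (seq y k) (seq x′ k) (seq y′ k))
    (0≤x+y (affine α β γ p) (ℤ→ℝ α * (x′ - x) + ℤ→ℝ β * (y′ - y)) 0≤p
      (0≤x+y (ℤ→ℝ α * (x′ - x)) (ℤ→ℝ β * (y′ - y))
        (proj₁ (Null-* (ι α) (x′ - x) (≃⇒Null x′ x x′≃x)))
        (proj₁ (Null-* (ι β) (y′ - y) (≃⇒Null y′ y y′≃y)))))
  where
  lem : ∀ α β γ x y x′ y′ → (α ℚ.* x ℚ.+ β ℚ.* y ℚ.+ γ) ℚ.+ (α ℚ.* (x′ ℚ.- x) ℚ.+ β ℚ.* (y′ ℚ.- y))
    ≡ α ℚ.* x′ ℚ.+ β ℚ.* y′ ℚ.+ γ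
  lem = solve 7 (λ α β γ x y x′ y′ → (α :* x :+ β :* y :+ γ) :+ (α :* (x′ :- x) :+ β :* (y′ :- y))
    := α :* x′ :+ β :* y′ :+ γ) refl

-- An affine function takes on a segment the convex combinations of its end values.
halfPlane-convex : ∀ α β γ → Convex (HalfPlane α β γ)
halfPlane-convex α β γ {p@(x₁ , y₁)} {q@(x₂ , y₂)} 0≤p 0≤q {r} (t , 0≤t , t≤1 , r≃) =
  halfPlane-resp α β γ s r r≃
    (0≤-cong ((1ℝ - t) * affine α β γ p + t * affine α β γ q) (affine α β γ s)
      (λ k → lem (ι α) (ι β) (ι γ) (seq t k) (seq x₁ k) (seq y₁ k) (seq x₂ k) (seq y₂ k))
      (0≤x+y ((1ℝ - t) * affine α β γ p) (t * affine α β γ q)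
        (0≤x*y (1ℝ - t) (affine α β γ p) (≤⇒0≤- t 1ℝ t≤1) 0≤p)
        (0≤x*y t (affine α β γ q) 0≤t 0≤q)))
  where
  s : Point
  s = (1ℝ - t) * x₁ + t * x₂ , (1ℝ - t) * y₁ + t * y₂
  lem : ∀ α β γ t x₁ y₁ x₂ y₂ →
    (1ℚ ℚ.- t) ℚ.* (α ℚ.* x₁ ℚ.+ β ℚ.* y₁ ℚ.+ γ) ℚ.+ t ℚ.* (α ℚ.* x₂ ℚ.+ β ℚ.* y₂ ℚ.+ γ) ≡
    α ℚ.* ((1ℚ ℚ.- t) ℚ.* x₁ ℚ.+ t ℚ.* x₂) ℚ.+ β ℚ.* ((1ℚ ℚ.- t) ℚ.* y₁ ℚ.+ t ℚ.* y₂) ℚ.+ γ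
  lem = solve 8 (λ α β γ t x₁ y₁ x₂ y₂ →
    (con 1ℚ :- t) :* (α :* x₁ :+ β :* y₁ :+ γ) :+ t :* (α :* x₂ :+ β :* y₂ :+ γ) :=
    α :* ((con 1ℚ :- t) :* x₁ :+ t :* x₂) :+ β :* ((con 1ℚ :- t) :* y₁ :+ t :* y₂) :+ γ) refl

-- The two affine forms add up to -1, so these closed half-planes are disjoint. Integer points never
-- lie in the strip between them, which is what `complementary` expresses.
opposite-halfPlanes : ∀ α β γ q →
  HalfPlane α β γ q → ¬ HalfPlane (ℤ.- α) (ℤ.- β) (ℤ.- γ ℤ.- 1ℤ) q
opposite-halfPlanes α β γ q@(x , y) 0≤q 0≤q′ = 0≰-1 (0≤ℤ→ℝ⁻¹ {ℤ.- 1ℤ}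
  (0≤-cong (affine α β γ q + affine (ℤ.- α) (ℤ.- β) (ℤ.- γ ℤ.- 1ℤ) q) (ℤ→ℝ (ℤ.- 1ℤ))
    (λ k → sum≡ (seq x k) (seq y k))
    (0≤x+y (affine α β γ q) (affine (ℤ.- α) (ℤ.- β) (ℤ.- γ ℤ.- 1ℤ) q) 0≤q 0≤q′)))
  where
  open ≡-Reasoning
  0≰-1 : ¬ 0ℤ ℤ.≤ ℤ.- 1ℤ
  0≰-1 ()
  lem : ∀ α β γ x y → (α ℚ.* x ℚ.+ β ℚ.* y ℚ.+ γ) ℚ.+ (ℚ.- α ℚ.* x ℚ.+ ℚ.- β ℚ.* y ℚ.+ (ℚ.- γ ℚ.- 1ℚ)) ≡ ℚ.- 1ℚ
  lem = solve 5 (λ α β γ x y → (α :* x :+ β :* y :+ γ) :+ (:- α :* x :+ :- β :* y :+ (:- γ :- con 1ℚ)) := con (ℚ.- 1ℚ)) refl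
  sum≡ : ∀ x y → (ι α ℚ.* x ℚ.+ ι β ℚ.* y ℚ.+ ι γ)
    ℚ.+ (ι (ℤ.- α) ℚ.* x ℚ.+ ι (ℤ.- β) ℚ.* y ℚ.+ ι (ℤ.- γ ℤ.- 1ℤ)) ≡ ι (ℤ.- 1ℤ)
  sum≡ x y = begin
    l ℚ.+ (ι (ℤ.- α) ℚ.* x ℚ.+ ι (ℤ.- β) ℚ.* y ℚ.+ ι (ℤ.- γ ℤ.- 1ℤ))
      ≡⟨ cong (λ a → l ℚ.+ (a ℚ.* x ℚ.+ ι (ℤ.- β) ℚ.* y ℚ.+ ι (ℤ.- γ ℤ.- 1ℤ))) (ι-neg α) ⟩
    l ℚ.+ (ℚ.- ι α ℚ.* x ℚ.+ ι (ℤ.- β) ℚ.* y ℚ.+ ι (ℤ.- γ ℤ.- 1ℤ))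
      ≡⟨ cong (λ b → l ℚ.+ (ℚ.- ι α ℚ.* x ℚ.+ b ℚ.* y ℚ.+ ι (ℤ.- γ ℤ.- 1ℤ))) (ι-neg β) ⟩
    l ℚ.+ (ℚ.- ι α ℚ.* x ℚ.+ ℚ.- ι β ℚ.* y ℚ.+ ι (ℤ.- γ ℤ.- 1ℤ))
      ≡⟨ cong (λ c → l ℚ.+ (ℚ.- ι α ℚ.* x ℚ.+ ℚ.- ι β ℚ.* y ℚ.+ c)) (trans (ι-- (ℤ.- γ) 1ℤ) (cong (ℚ._- 1ℚ) (ι-neg γ))) ⟩
    l ℚ.+ (ℚ.- ι α ℚ.* x ℚ.+ ℚ.- ι β ℚ.* y ℚ.+ (ℚ.- ι γ ℚ.- 1ℚ))
      ≡⟨ lem (ι α) (ι β) (ι γ) x y ⟩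
    ι (ℤ.- 1ℤ) ∎
    where l = ι α ℚ.* x ℚ.+ ι β ℚ.* y ℚ.+ ι γ

-- Convex partitions of integer point sets by a line.

module IntegerPoints {n} (X Y : Fin n → ℤ) (X-injective : ∀ {i j} → X i ≡ X j → i ≡ j) where

  S : PointSet n
  S = record
    { point    = λ i → ℤ→ℝ (X i) , ℤ→ℝ (Y i)
    ; distinct = λ (x≃ , _) → X-injective (ℤ→ℝ-injective x≃)
    }

  value : ℤ → ℤ → ℤ → Fin n → ℤ
  value α β γ i = α ℤ.* X i ℤ.+ β ℤ.* Y i ℤ.+ γ

  value-affine : ∀ α β γ i k → seq (ℤ→ℝ (value α β γ i)) k ≡ seq (affine α β γ (point S i)) k
  value-affine α β γ i k = trans (ι-+ (α ℤ.* X i ℤ.+ β ℤ.* Y i) γ) (cong (ℚ._+ ι γ)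
    (trans (ι-+ (α ℤ.* X i) (β ℤ.* Y i)) (cong₂ ℚ._+_ (ι-* α (X i)) (ι-* β (Y i)))))

  0≤value⇔ : ∀ α β γ i → 0ℤ ℤ.≤ value α β γ i ⇔ HalfPlane α β γ (point S i)
  0≤value⇔ α β γ i = mk⇔
    (λ 0≤v → 0≤-cong v (affine α β γ (point S i)) (value-affine α β γ i) (0≤ℤ→ℝ 0≤v))
    (λ 0≤a → 0≤ℤ→ℝ⁻¹ (0≤-cong (affine α β γ (point S i)) v (λ k → sym (value-affine α β γ i k)) 0≤a))
    where v = ℤ→ℝ (value α β γ i)

  -- Membership is decided on the integer `value`, because the order of ℝ is not decidable.
  side : ℤ → ℤ → ℤ → Subset n
  side α β γ = tabulate (λ i → does (0ℤ ℤ.≤? value α β γ i))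

  ∈side⇔ : ∀ α β γ i → i ∈ side α β γ ⇔ 0ℤ ℤ.≤ value α β γ i
  ∈side⇔ α β γ i = mk⇔ to (λ 0≤v → lookup⇒[]= i (side α β γ) (trans lk (dec-true (0ℤ ℤ.≤? value α β γ i) 0≤v)))
    where
    lk : lookup (side α β γ) i ≡ does (0ℤ ℤ.≤? value α β γ i)
    lk = lookup∘tabulate _ i
    to : i ∈ side α β γ → 0ℤ ℤ.≤ value α β γ i
    to i∈ with 0ℤ ℤ.≤? value α β γ i | trans (sym lk) ([]=⇒lookup i∈)
    ... | yes 0≤v | _  = 0≤v
    ... | no _    | ()

  ∈side⇔∈HalfPlane : ∀ α β γ i → i ∈ side α β γ ⇔ HalfPlane α β γ (point S i)
  ∈side⇔∈HalfPlane α β γ i = mk⇔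
    (Equivalence.to (0≤value⇔ α β γ i) ∘ Equivalence.to (∈side⇔ α β γ i))
    (Equivalence.from (∈side⇔ α β γ i) ∘ Equivalence.from (0≤value⇔ α β γ i))

  side-island : ∀ α β γ → IsIsland S (side α β γ)
  side-island α β γ = HalfPlane α β γ , (λ {p} {q} → halfPlane-convex α β γ {p} {q}) , ∈side⇔∈HalfPlane α β γ

  side-hull : ∀ α β γ {q} → ConvexHull (points S (side α β γ)) q → HalfPlane α β γ q
  side-hull α β γ q∈hull = q∈hull (HalfPlane α β γ) (λ {p} {q} → halfPlane-convex α β γ {p} {q})
    λ {r} (i , i∈ , r≃) → halfPlane-resp α β γ (point S i) r r≃ (Equivalence.to (∈side⇔∈HalfPlane α β γ i) i∈)

  value-opposite : ∀ α β γ i → value (ℤ.- α) (ℤ.- β) (ℤ.- γ ℤ.- 1ℤ) i ≡ ℤ.- value α β γ i ℤ.- 1ℤ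
  value-opposite α β γ i = lem α β γ (X i) (Y i)
    where
    lem : ∀ α β γ x y → ℤ.- α ℤ.* x ℤ.+ ℤ.- β ℤ.* y ℤ.+ (ℤ.- γ ℤ.- 1ℤ) ≡ ℤ.- (α ℤ.* x ℤ.+ β ℤ.* y ℤ.+ γ) ℤ.- 1ℤ
    lem = solve-∀

  χ± : Coloring n → Fin n → ℤ
  χ± χ i = χ i ℤ.◃ 1

  total : Coloring n → ℤ
  total χ = sum (χ± χ)

  disc-⊤ : ∀ χ → disc χ ⊤ ≡ ℤ.∣ total χ ∣
  disc-⊤ χ = cong ℤ.∣_∣ (sum-cong-≗ {n} λ i → cong (λ b → if b then χ± χ i else 0ℤ) (lookup-replicate i true))

  disc-⊥ : ∀ χ → disc χ ⊥ ≡ 0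
  disc-⊥ χ = cong ℤ.∣_∣ (trans
    (sum-cong-≗ {n} λ i → cong (λ b → if b then χ± χ i else 0ℤ) (lookup-replicate i false))
    (sum-replicate-zero n))

  disc-nonempty : ∀ χ A → 0 ℕ.< disc χ A → Nonempty A
  disc-nonempty χ A 0<disc with nonempty? A
  ... | yes A≢∅ = A≢∅
  ... | no  A≡∅ = ⊥-elim (ℕ.<-irrefl (sym (trans (cong (disc χ) (Empty-unique A≡∅)) (disc-⊥ χ))) 0<disc)

  trivialPartition : Nonempty (⊤ {n}) → ConvexPartition S
  trivialPartition ⊤≢∅ = record
    { blocks        = ⊤ ∷ []
    ; nonempty      = λ { zero → ⊤≢∅ }
    ; partition     = λ i → zero , ∈⊤ , λ { {zero} _ → refl }
    ; island        = λ { zero → (λ _ → Unit.⊤) , (λ _ _ _ → Unit.tt) , λ i → mk⇔ (λ _ → Unit.tt) (λ _ → ∈⊤) }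
    ; disjointHulls = λ { {zero} {zero} z≢z → ⊥-elim (z≢z refl) }
    }

  signSum : Coloring n → ℤ → ℤ → ℤ → ℤ
  signSum χ α β γ = sum (λ i → if lookup (side α β γ) i then χ± χ i else 0ℤ)

  module _ (α β γ : ℤ) where

    α′ = ℤ.- α
    β′ = ℤ.- β
    γ′ = ℤ.- γ ℤ.- 1ℤ

    complementary : ∀ z → does (0ℤ ℤ.≤? ℤ.- z ℤ.- 1ℤ) ≡ not (does (0ℤ ℤ.≤? z))
    complementary (+ zero)  = refl
    complementary (+ suc k) = refl
    complementary -[1+ k ]  = refl

    lookup-opposite : ∀ i → lookup (side α′ β′ γ′) i ≡ not (lookup (side α β γ) i)
    lookup-opposite i = trans (lookup∘tabulate _ i) (trans (cong (λ v → does (0ℤ ℤ.≤? v)) (value-opposite α β γ i))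
      (trans (complementary (value α β γ i)) (cong not (sym (lookup∘tabulate _ i)))))

    signSum-opposite : ∀ χ → signSum χ α β γ ℤ.+ signSum χ α′ β′ γ′ ≡ total χ
    signSum-opposite χ = trans (sym (∑-distrib-+ {n} (λ i → if lookup (side α β γ) i then χ± χ i else 0ℤ) _))
      (sum-cong-≗ {n} λ i → trans
        (cong (λ b → (if lookup (side α β γ) i then χ± χ i else 0ℤ) ℤ.+ (if b then χ± χ i else 0ℤ)) (lookup-opposite i))
        (lem (lookup (side α β γ) i) (χ± χ i)))
      where
      lem : ∀ b z → (if b then z else 0ℤ) ℤ.+ (if not b then z else 0ℤ) ≡ z
      lem true  z = ℤ.+-identityʳ z
      lem false z = ℤ.+-identityˡ z

    halfPlanePartition : Nonempty (side α β γ) → Nonempty (side α′ β′ γ′) → ConvexPartition S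
    halfPlanePartition ≢∅ ≢∅′ = record
      { blocks        = sides
      ; nonempty      = λ { zero → ≢∅ ; (suc zero) → ≢∅′ }
      ; partition     = λ i → part i _ refl
      ; island        = λ { zero → side-island α β γ ; (suc zero) → side-island α′ β′ γ′ }
      ; disjointHulls = λ
        { {zero}     {zero}     b≢c → ⊥-elim (b≢c refl)
        ; {zero}     {suc zero} _ {q} (h , h′) → opposite-halfPlanes α β γ q (side-hull α β γ h) (side-hull α′ β′ γ′ h′)
        ; {suc zero} {zero}     _ {q} (h′ , h) → opposite-halfPlanes α β γ q (side-hull α β γ h) (side-hull α′ β′ γ′ h′)
        ; {suc zero} {suc zero} b≢c → ⊥-elim (b≢c refl)
        }
      }
      where
      sides : Vec (Subset n) 2
      sides = side α β γ ∷ side α′ β′ γ′ ∷ []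
      clash : ∀ {i A} {b} → lookup A i ≡ not b → lookup A i ≡ b → {C : Set} → C
      clash {b = true}  p q with () ← trans (sym p) q
      clash {b = false} p q with () ← trans (sym p) q
      part : ∀ i b → lookup (side α β γ) i ≡ b → ∃! _≡_ λ b → i ∈ lookup sides b
      part i true  eq = zero , lookup⇒[]= i (side α β γ) eq , λ
        { {zero}     _  → refl
        ; {suc zero} i∈ → clash {A = side α′ β′ γ′} (trans (lookup-opposite i) (cong not eq)) ([]=⇒lookup i∈)
        }
      part i false eq = suc zero , lookup⇒[]= i (side α′ β′ γ′) (trans (lookup-opposite i) (cong not eq)) , λ
        { {zero}     i∈ → clash {A = side α β γ} eq ([]=⇒lookup i∈)
        ; {suc zero} _  → refl
        }

  -- If the complement has discrepancy less than r, then the whole set has discrepancy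
  -- at least r, and the partition with a single block will do.
  halfPlane⇒partition : ∀ χ α β γ r → 1 ℕ.≤ r → 2 ℕ.* r ℕ.≤ disc χ (side α β γ) →
    Σ[ Π ∈ ConvexPartition S ] r ℕ.≤ discᴾ χ Π
  halfPlane⇒partition χ α β γ r 1≤r 2r≤ with r ℕ.≤? ℤ.∣ total χ ∣
  ... | yes r≤T = trivialPartition (disc-nonempty χ ⊤ (ℕ.≤-trans 1≤r r≤⊤)) , r≤⊤
    where
    r≤⊤ = ℕ.≤-trans r≤T (ℕ.≤-reflexive (sym (disc-⊤ χ)))
  ... | no  r≰T = halfPlanePartition α β γ
      (disc-nonempty χ _ (ℕ.≤-trans 1≤r r≤side)) (disc-nonempty χ _ (ℕ.≤-trans 1≤r r≤opposite)) ,
      ℕ.⊓-glb r≤side r≤opposite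
    where
    open ℕ.≤-Reasoning
    h  = signSum χ α β γ
    h′ = signSum χ (ℤ.- α) (ℤ.- β) (ℤ.- γ ℤ.- 1ℤ)
    r≤side : r ℕ.≤ disc χ (side α β γ)
    r≤side = ℕ.≤-trans (ℕ.m≤m+n r _) 2r≤
    lem : ∀ a b → a ≡ a ℤ.+ b ℤ.- b
    lem = solve-∀
    r≤opposite : r ℕ.≤ ℤ.∣ h′ ∣
    r≤opposite = ℕ.+-cancelˡ-≤ r r ℤ.∣ h′ ∣ (begin
      r ℕ.+ r                             ≡⟨ cong (r ℕ.+_) (ℕ.+-identityʳ r) ⟨
      2 ℕ.* r                             ≤⟨ 2r≤ ⟩
      ℤ.∣ h ∣                             ≡⟨ cong ℤ.∣_∣ (lem h h′) ⟩
      ℤ.∣ h ℤ.+ h′ ℤ.- h′ ∣               ≡⟨ cong (λ t → ℤ.∣ t ℤ.- h′ ∣) (signSum-opposite α β γ χ) ⟩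
      ℤ.∣ total χ ℤ.- h′ ∣                ≤⟨ ℤ.∣i-j∣≤∣i∣+∣j∣ (total χ) h′ ⟩
      ℤ.∣ total χ ∣ ℕ.+ ℤ.∣ h′ ∣          ≤⟨ ℕ.+-monoˡ-≤ ℤ.∣ h′ ∣ (ℕ.<⇒≤ (ℕ.≰⇒> r≰T)) ⟩
      r ℕ.+ ℤ.∣ h′ ∣                      ∎)

  -- Collinearity and determinants.

  det : Fin n → Fin n → Fin n → ℤ
  det i j k = (X j ℤ.- X i) ℤ.* (Y k ℤ.- Y i) ℤ.- (X k ℤ.- X i) ℤ.* (Y j ℤ.- Y i)

  -- The equations a x + b y = c at three points give det * a = det * b = 0.
  det≢0⇒¬Collinear : ∀ {i j k} → det i j k ≢ 0ℤ → ¬ Collinear (point S i) (point S j) (point S k)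
  det≢0⇒¬Collinear {i} {j} {k} det≢0 (a , b , c , ¬a≃0×b≃0 , oni , onj , onk) = ¬a≃0×b≃0
    ( Null⇒≃0 a (Null-cancel (det i j k) a det≢0
        (Null-cong (ℤ→ℝ y₂ * F x₁ y₁ + ℤ→ℝ (ℤ.- y₁) * F x₂ y₂) (ℤ→ℝ (det i j k) * a)
          (λ l → trans (cong (λ t → ι y₂ ℚ.* seq (F x₁ y₁) l ℚ.+ t ℚ.* seq (F x₂ y₂) l) (ι-neg y₁))
            (trans (lemᵃ (seq a l) (seq b l) (ι x₁) (ι y₁) (ι x₂) (ι y₂)) (cong (ℚ._* seq a l) (sym ι-det))))
          (Null-combination y₂ (ℤ.- y₁))))
    , Null⇒≃0 b (Null-cancel (det i j k) b det≢0
        (Null-cong (ℤ→ℝ (ℤ.- x₂) * F x₁ y₁ + ℤ→ℝ x₁ * F x₂ y₂) (ℤ→ℝ (det i j k) * b)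
          (λ l → trans (cong (λ t → t ℚ.* seq (F x₁ y₁) l ℚ.+ ι x₁ ℚ.* seq (F x₂ y₂) l) (ι-neg x₂))
            (trans (lemᵇ (seq a l) (seq b l) (ι x₁) (ι y₁) (ι x₂) (ι y₂)) (cong (ℚ._* seq b l) (sym ι-det))))
          (Null-combination (ℤ.- x₂) x₁))))
    where
    x₁ = X j ℤ.- X i
    y₁ = Y j ℤ.- Y i
    x₂ = X k ℤ.- X i
    y₂ = Y k ℤ.- Y i
    F : ℤ → ℤ → ℝ
    F x y = a * ℤ→ℝ x + b * ℤ→ℝ y
    lem : ∀ a b c x y x′ y′ → a ℚ.* x ℚ.+ b ℚ.* y ℚ.- c ℚ.+ ℚ.- 1ℚ ℚ.* (a ℚ.* x′ ℚ.+ b ℚ.* y′ ℚ.- c) ≡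
      a ℚ.* (x ℚ.- x′) ℚ.+ b ℚ.* (y ℚ.- y′)
    lem = solve 7 (λ a b c x y x′ y′ →
      a :* x :+ b :* y :- c :+ con (ℚ.- 1ℚ) :* (a :* x′ :+ b :* y′ :- c) :=
      a :* (x :- x′) :+ b :* (y :- y′)) refl
    E : Fin n → ℝ
    E l = F (X l) (Y l) - c
    Null-F : ∀ l m → F (X l) (Y l) ≃ c → F (X m) (Y m) ≃ c → Null (F (X l ℤ.- X m) (Y l ℤ.- Y m))
    Null-F l m onl onm = Null-cong (E l + fromℚ (ℚ.- 1ℚ) * E m) (F (X l ℤ.- X m) (Y l ℤ.- Y m))
      (λ t → trans (lem (seq a t) (seq b t) (seq c t) (ι (X l)) (ι (Y l)) (ι (X m)) (ι (Y m)))
        (cong₂ (λ x y → seq a t ℚ.* x ℚ.+ seq b t ℚ.* y) (sym (ι-- (X l) (X m))) (sym (ι-- (Y l) (Y m)))))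
      (Null-+ (E l) (fromℚ (ℚ.- 1ℚ) * E m) (≃⇒Null (F (X l) (Y l)) c onl)
        (Null-* (ℚ.- 1ℚ) (E m) (≃⇒Null (F (X m) (Y m)) c onm)))
    Null-combination : ∀ u v → Null (ℤ→ℝ u * F x₁ y₁ + ℤ→ℝ v * F x₂ y₂)
    Null-combination u v = Null-+ (ℤ→ℝ u * F x₁ y₁) (ℤ→ℝ v * F x₂ y₂)
      (Null-* (ι u) (F x₁ y₁) (Null-F j i onj oni)) (Null-* (ι v) (F x₂ y₂) (Null-F k i onk oni))
    ι-det : ι (det i j k) ≡ ι x₁ ℚ.* ι y₂ ℚ.- ι x₂ ℚ.* ι y₁
    ι-det = trans (ι-- (x₁ ℤ.* y₂) (x₂ ℤ.* y₁)) (cong₂ ℚ._-_ (ι-* x₁ y₂) (ι-* x₂ y₁))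
    lemᵃ : ∀ a b u v u′ v′ → v′ ℚ.* (a ℚ.* u ℚ.+ b ℚ.* v) ℚ.+ ℚ.- v ℚ.* (a ℚ.* u′ ℚ.+ b ℚ.* v′) ≡
      (u ℚ.* v′ ℚ.- u′ ℚ.* v) ℚ.* a
    lemᵃ = solve 6 (λ a b u v u′ v′ → v′ :* (a :* u :+ b :* v) :+ :- v :* (a :* u′ :+ b :* v′) :=
      (u :* v′ :- u′ :* v) :* a) refl
    lemᵇ : ∀ a b u v u′ v′ → ℚ.- u′ ℚ.* (a ℚ.* u ℚ.+ b ℚ.* v) ℚ.+ u ℚ.* (a ℚ.* u′ ℚ.+ b ℚ.* v′) ≡
      (u ℚ.* v′ ℚ.- u′ ℚ.* v) ℚ.* b
    lemᵇ = solve 6 (λ a b u v u′ v′ → :- u′ :* (a :* u :+ b :* v) :+ u :* (a :* u′ :+ b :* v′) :=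
      (u :* v′ :- u′ :* v) :* b) refl

-- The grid point with index i is scaled by Q and moved to (Q col + i, Q row + i²). As
-- Q exceeds every expression in the offsets alone, the position with respect to
-- the lines used is that of the grid point, and a vanishing determinant would make
-- the Vandermonde determinant of three indices divisible by Q.
module PerturbedGrid (m : ℕ) .{{_ : ℕ.NonZero m}} where

  open Discrepancy.Grid m
  open Discrepancy using (θ; θ-≤; θ->; module Quotients; module KernelSum)
  open Quotients m using (w)
  open KernelSum w using (M)

  -- The first two summands bound `offset`, the last bounds the Vandermonde determinant of three
  -- indices; `suc` makes both bounds strict.
  Q : ℕ
  Q = suc (M ℕ.* (n ℕ.* n) ℕ.+ (M ℕ.+ M) ℕ.* n ℕ.+ n ℕ.* n ℕ.* n)

  X Y : Fin n → ℤ
  X p = + (toℕ p ℕ.+ col p ℕ.* Q)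
  Y p = + (toℕ p ℕ.* toℕ p ℕ.+ row p ℕ.* Q)

  n³<Q : n ℕ.* n ℕ.* n ℕ.< Q
  n³<Q = s≤s (ℕ.m≤n+m _ _)

  toℕ<Q : ∀ (p : Fin n) → toℕ p ℕ.< Q
  toℕ<Q p = ℕ.<-≤-trans (toℕ<n p) (ℕ.≤-trans n≤n³ (ℕ.<⇒≤ n³<Q))
    where
    instance
      n≢0 = ℕ.m*n≢0 m m
      n²≢0 = ℕ.m*n≢0 n n
    n≤n³ : n ℕ.≤ n ℕ.* n ℕ.* n
    n≤n³ = ℕ.m≤n*m n (n ℕ.* n)

  X-injective : ∀ {p q} → X p ≡ X q → p ≡ q
  X-injective {p} {q} Xp≡Xq = toℕ-injective (begin
    toℕ p                              ≡⟨ ℕ.m<n⇒m%n≡m (toℕ<Q p) ⟨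
    toℕ p ℕ.% Q                        ≡⟨ ℕ.[m+kn]%n≡m%n (toℕ p) (col p) Q ⟨
    (toℕ p ℕ.+ col p ℕ.* Q) ℕ.% Q      ≡⟨ cong (ℕ._% Q) (ℤ.+-injective Xp≡Xq) ⟩
    (toℕ q ℕ.+ col q ℕ.* Q) ℕ.% Q      ≡⟨ ℕ.[m+kn]%n≡m%n (toℕ q) (col q) Q ⟩
    toℕ q ℕ.% Q                        ≡⟨ ℕ.m<n⇒m%n≡m (toℕ<Q q) ⟩
    toℕ q                              ∎)
    where open ≡-Reasoning

  open IntegerPoints X Y X-injective public

  generalPosition : GeneralPosition S
  generalPosition {i} {j} {k} i≢j j≢k i≢k = det≢0⇒¬Collinear {i} {j} {k} (det≢0 ∘ split)
    where
    I J K cᵢ cⱼ cₖ rᵢ rⱼ rₖ : ℤ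
    I = + toℕ i
    J = + toℕ j
    K = + toℕ k
    cᵢ = + col i
    cⱼ = + col j
    cₖ = + col k
    rᵢ = + row i
    rⱼ = + row j
    rₖ = + row k
    V rest : ℤ
    V = (J ℤ.- I) ℤ.* (K ℤ.- I) ℤ.* (K ℤ.- J)
    rest = (J ℤ.- I) ℤ.* (rₖ ℤ.- rᵢ) ℤ.+ (cⱼ ℤ.- cᵢ) ℤ.* (K ℤ.* K ℤ.- I ℤ.* I ℤ.+ (rₖ ℤ.- rᵢ) ℤ.* + Q)
       ℤ.- (K ℤ.- I) ℤ.* (rⱼ ℤ.- rᵢ) ℤ.- (cₖ ℤ.- cᵢ) ℤ.* (J ℤ.* J ℤ.- I ℤ.* I ℤ.+ (rⱼ ℤ.- rᵢ) ℤ.* + Q)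
    X≡ : ∀ p → X p ≡ + toℕ p ℤ.+ + col p ℤ.* + Q
    X≡ p = cong (ℤ._+_ (+ toℕ p)) (ℤ.pos-* (col p) Q)
    Y≡ : ∀ p → Y p ≡ + toℕ p ℤ.* + toℕ p ℤ.+ + row p ℤ.* + Q
    Y≡ p = cong₂ ℤ._+_ (ℤ.pos-* (toℕ p) (toℕ p)) (ℤ.pos-* (row p) Q)
    diff : ∀ a b c d q → a ℤ.+ c ℤ.* q ℤ.- (b ℤ.+ d ℤ.* q) ≡ a ℤ.- b ℤ.+ (c ℤ.- d) ℤ.* q
    diff = solve-∀
    product : ∀ a₁ c₁ b₁ r₁ a₂ c₂ b₂ r₂ q →
      (a₁ ℤ.+ c₁ ℤ.* q) ℤ.* (b₂ ℤ.+ r₂ ℤ.* q) ℤ.- (a₂ ℤ.+ c₂ ℤ.* q) ℤ.* (b₁ ℤ.+ r₁ ℤ.* q) ≡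
      (a₁ ℤ.* b₂ ℤ.- a₂ ℤ.* b₁) ℤ.+
      (a₁ ℤ.* r₂ ℤ.+ c₁ ℤ.* (b₂ ℤ.+ r₂ ℤ.* q) ℤ.- a₂ ℤ.* r₁ ℤ.- c₂ ℤ.* (b₁ ℤ.+ r₁ ℤ.* q)) ℤ.* q
    product = solve-∀
    vandermonde : ∀ i j k → (j ℤ.- i) ℤ.* (k ℤ.* k ℤ.- i ℤ.* i) ℤ.- (k ℤ.- i) ℤ.* (j ℤ.* j ℤ.- i ℤ.* i) ≡
      (j ℤ.- i) ℤ.* (k ℤ.- i) ℤ.* (k ℤ.- j)
    vandermonde = solve-∀
    det≡ : det i j k ≡ V ℤ.+ rest ℤ.* + Q
    det≡ = trans (cong₂ ℤ._-_
        (cong₂ ℤ._*_ (dX j) (dY k)) (cong₂ ℤ._*_ (dX k) (dY j)))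
      (trans (product (J ℤ.- I) (cⱼ ℤ.- cᵢ) (J ℤ.* J ℤ.- I ℤ.* I) (rⱼ ℤ.- rᵢ)
                      (K ℤ.- I) (cₖ ℤ.- cᵢ) (K ℤ.* K ℤ.- I ℤ.* I) (rₖ ℤ.- rᵢ) (+ Q))
        (cong (λ v → v ℤ.+ rest ℤ.* + Q) (vandermonde I J K)))
      where
      dX : ∀ p → X p ℤ.- X i ≡ + toℕ p ℤ.- I ℤ.+ (+ col p ℤ.- cᵢ) ℤ.* + Q
      dX p = trans (cong₂ ℤ._-_ (X≡ p) (X≡ i)) (diff (+ toℕ p) I (+ col p) cᵢ (+ Q))
      dY : ∀ p → Y p ℤ.- Y i ≡ + toℕ p ℤ.* + toℕ p ℤ.- I ℤ.* I ℤ.+ (+ row p ℤ.- rᵢ) ℤ.* + Q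
      dY p = trans (cong₂ ℤ._-_ (Y≡ p) (Y≡ i)) (diff (+ toℕ p ℤ.* + toℕ p) (I ℤ.* I) (+ row p) rᵢ (+ Q))
    split : det i j k ≡ 0ℤ → V ≡ ℤ.- (rest ℤ.* + Q)
    split det≡0 = trans (lem V (rest ℤ.* + Q)) (trans (cong (ℤ._- rest ℤ.* + Q) (trans (sym det≡) det≡0)) (ℤ.+-identityˡ _))
      where
      lem : ∀ a b → a ≡ a ℤ.+ b ℤ.- b
      lem = solve-∀
    distance : ∀ (p q : Fin n) → ℤ.∣ + toℕ p ℤ.- + toℕ q ∣ ℕ.≤ n
    distance p q = ℕ.≤-trans (ℕ.≤-reflexive (cong ℤ.∣_∣ (ℤ.m-n≡m⊖n (toℕ p) (toℕ q))))
      (ℕ.≤-trans (ℤ.∣m⊝n∣≤m⊔n (toℕ p) (toℕ q)) (ℕ.⊔-lub (ℕ.<⇒≤ (toℕ<n p)) (ℕ.<⇒≤ (toℕ<n q))))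
    distance≢0 : ∀ {p q : Fin n} → p ≢ q → ℕ.NonZero ℤ.∣ + toℕ p ℤ.- + toℕ q ∣
    distance≢0 {p} {q} p≢q = ℕ.≢-nonZero (p≢q ∘ toℕ-injective ∘ ℤ.+-injective ∘ ℤ.i-j≡0⇒i≡j (+ toℕ p) (+ toℕ q) ∘ ℤ.∣i∣≡0⇒i≡0)
    ∣V∣≡ : ℤ.∣ V ∣ ≡ ℤ.∣ J ℤ.- I ∣ ℕ.* ℤ.∣ K ℤ.- I ∣ ℕ.* ℤ.∣ K ℤ.- J ∣
    ∣V∣≡ = trans (ℤ.∣i*j∣≡∣i∣*∣j∣ ((J ℤ.- I) ℤ.* (K ℤ.- I)) (K ℤ.- J))
      (cong (ℕ._* ℤ.∣ K ℤ.- J ∣) (ℤ.∣i*j∣≡∣i∣*∣j∣ (J ℤ.- I) (K ℤ.- I)))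
    ∣V∣<Q : ℤ.∣ V ∣ ℕ.< Q
    ∣V∣<Q = ℕ.≤-<-trans (ℕ.≤-trans (ℕ.≤-reflexive ∣V∣≡)
      (ℕ.*-mono-≤ (ℕ.*-mono-≤ (distance j i) (distance k i)) (distance k j))) n³<Q
    ∣V∣≢0 : ℕ.NonZero ℤ.∣ V ∣
    ∣V∣≢0 = subst ℕ.NonZero (sym ∣V∣≡) (ℕ.m*n≢0 _ _
      {{ℕ.m*n≢0 _ _ {{distance≢0 (i≢j ∘ sym)}} {{distance≢0 (i≢k ∘ sym)}}}} {{distance≢0 (j≢k ∘ sym)}})
    det≢0 : V ≢ ℤ.- (rest ℤ.* + Q)
    det≢0 V≡ with ℤ.∣ rest ∣ | trans (cong ℤ.∣_∣ V≡) (trans (ℤ.∣-i∣≡∣i∣ (rest ℤ.* + Q)) (ℤ.∣i*j∣≡∣i∣*∣j∣ rest (+ Q)))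
    ... | zero  | ∣V∣≡0  = ℕ.≢-nonZero⁻¹ ℤ.∣ V ∣ {{∣V∣≢0}} ∣V∣≡0
    ... | suc t | ∣V∣≡Qt = ℕ.<⇒≱ ∣V∣<Q (subst (Q ℕ.≤_) (sym ∣V∣≡Qt) (ℕ.m≤m+n Q _))

  -- What the perturbation (i, i²) adds to the linear form s x + M y.
  offset : ℕ → Fin n → ℕ
  offset s p = s ℕ.* toℕ p ℕ.+ M ℕ.* (toℕ p ℕ.* toℕ p)

  offset<Q : ∀ {s} p → s ℕ.< M ℕ.+ M → offset s p ℕ.< Q
  offset<Q {s} p s<2M = s≤s (begin
    s ℕ.* toℕ p ℕ.+ M ℕ.* (toℕ p ℕ.* toℕ p)
      ≤⟨ ℕ.+-mono-≤ (ℕ.*-mono-≤ (ℕ.<⇒≤ s<2M) p≤n) (ℕ.*-monoʳ-≤ M (ℕ.*-mono-≤ p≤n p≤n)) ⟩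
    (M ℕ.+ M) ℕ.* n ℕ.+ M ℕ.* (n ℕ.* n)
      ≡⟨ ℕ.+-comm ((M ℕ.+ M) ℕ.* n) _ ⟩
    M ℕ.* (n ℕ.* n) ℕ.+ (M ℕ.+ M) ℕ.* n
      ≤⟨ ℕ.m≤m+n _ _ ⟩
    M ℕ.* (n ℕ.* n) ℕ.+ (M ℕ.+ M) ℕ.* n ℕ.+ n ℕ.* n ℕ.* n ∎)
    where
    open ℕ.≤-Reasoning
    p≤n = ℕ.<⇒≤ (toℕ<n p)

  -- The threshold c scaled by `Q`; the summand with `w + w` is the lift in `level`.
  constant : ℕ → ℤ
  constant c = + (Q ℕ.* (w ℕ.+ w)) ℤ.- + (Q ℕ.* c)

  value≡ : ∀ s c p → value (+ s) (+ M) (constant c) p ≡ + (Q ℕ.* level s p ℕ.+ offset s p) ℤ.- + (Q ℕ.* c)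
  value≡ s c p = trans (cong₂ (λ a b → a ℤ.+ b ℤ.+ constant c)
      (sym (ℤ.pos-* s (toℕ p ℕ.+ col p ℕ.* Q))) (sym (ℤ.pos-* M (toℕ p ℕ.* toℕ p ℕ.+ row p ℕ.* Q))))
    (trans (assoc (+ (s ℕ.* (toℕ p ℕ.+ col p ℕ.* Q))) (+ (M ℕ.* (toℕ p ℕ.* toℕ p ℕ.+ row p ℕ.* Q)))
                  (+ (Q ℕ.* (w ℕ.+ w))) (+ (Q ℕ.* c)))
      (cong (λ k → + k ℤ.- + (Q ℕ.* c)) (lem s M (toℕ p) (col p) (row p) Q w)))
    where
    assoc : ∀ a b c d → a ℤ.+ b ℤ.+ (c ℤ.- d) ≡ a ℤ.+ b ℤ.+ c ℤ.- d
    assoc = solve-∀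
    lem : ∀ s M i x y Q w → s ℕ.* (i ℕ.+ x ℕ.* Q) ℕ.+ M ℕ.* (i ℕ.* i ℕ.+ y ℕ.* Q) ℕ.+ Q ℕ.* (w ℕ.+ w) ≡
      Q ℕ.* (w ℕ.+ (w ℕ.+ (M ℕ.* y ℕ.+ s ℕ.* x))) ℕ.+ (s ℕ.* i ℕ.+ M ℕ.* (i ℕ.* i))
    lem = ℕ-Solver.solve-∀

  -- Since 0 ≤ `offset` < `Q`, the inequality Q c ≤ Q · level + offset holds exactly when c ≤ level:
  -- the perturbation carries no point across the line.
  signSum≡H : ∀ χ (∣χ∣≡1 : ∀ p → ℤ.∣ χ± χ p ∣ ≡ 1) s c → s ℕ.< M ℕ.+ M →
    signSum χ (+ s) (+ M) (constant c) ≡ H (χ± χ) ∣χ∣≡1 s c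
  signSum≡H χ _ s c s<2M = sum-cong-≗ {n} λ p → trans
    (cong (λ b → if b then χ± χ p else 0ℤ) (trans (lookup∘tabulate _ p) (cong (λ v → does (0ℤ ℤ.≤? v)) (value≡ s c p))))
    (term p)
    where
    term : ∀ p → (if does (0ℤ ℤ.≤? + (Q ℕ.* level s p ℕ.+ offset s p) ℤ.- + (Q ℕ.* c)) then χ± χ p else 0ℤ) ≡
      χ± χ p ℤ.* θ c (level s p)
    term p with c ℕ.≤? level s p
    ... | yes c≤ = trans
      (cong (λ b → if b then χ± χ p else 0ℤ) (dec-true (0ℤ ℤ.≤? _) (ℤ.i≤j⇒0≤j-i
        (ℤ.+≤+ (ℕ.≤-trans (ℕ.*-monoʳ-≤ Q c≤) (ℕ.m≤m+n _ _))))))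
      (trans (sym (ℤ.*-identityʳ (χ± χ p))) (cong (ℤ._*_ (χ± χ p)) (sym (θ-≤ c≤))))
    ... | no  c≰ = trans
      (cong (λ b → if b then χ± χ p else 0ℤ) (dec-false (0ℤ ℤ.≤? _) (λ 0≤ → ℕ.<⇒≱ below (ℤ.drop‿+≤+ (ℤ.0≤i-j⇒j≤i 0≤)))))
      (trans (sym (ℤ.*-zeroʳ (χ± χ p))) (cong (ℤ._*_ (χ± χ p)) (sym (θ-> (ℕ.≰⇒> c≰)))))
      where
      open ℕ.≤-Reasoning
      below : Q ℕ.* level s p ℕ.+ offset s p ℕ.< Q ℕ.* c
      below = begin-strict
        Q ℕ.* level s p ℕ.+ offset s p   <⟨ ℕ.+-monoʳ-< (Q ℕ.* level s p) (offset<Q p s<2M) ⟩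
        Q ℕ.* level s p ℕ.+ Q            ≡⟨ ℕ.+-comm _ Q ⟩
        Q ℕ.+ Q ℕ.* level s p            ≡⟨ ℕ.*-suc Q (level s p) ⟨
        Q ℕ.* suc (level s p)            ≤⟨ ℕ.*-monoʳ-≤ Q (ℕ.≰⇒> c≰) ⟩
        Q ℕ.* c                          ∎

  -- If all these half-planes had discrepancy at most D = 2 r - 1, then m ≤ 256 D² would follow. As
  -- s and c range over finite sets, a decidable search turns the contradiction into an actual
  -- half-plane.
  partition-of-discrepancy : ∀ r D → 1 ℕ.≤ r → suc D ≡ 2 ℕ.* r → 256 ℕ.* (D ℕ.* D) ℕ.< m →
    ∀ χ → Σ[ Π ∈ ConvexPartition S ] r ℕ.≤ discᴾ χ Π
  partition-of-discrepancy r D 1≤r 1+D≡2r 256D²<m χ =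
    search (ℕ.anyUpTo? (λ s → ℕ.anyUpTo? (λ c → 2 ℕ.* r ℕ.≤? ℤ.∣ h s c ∣) C) (M ℕ.+ M))
    where
    C = w ℕ.+ (w ℕ.+ R)
    ∣χ∣≡1 : ∀ p → ℤ.∣ χ± χ p ∣ ≡ 1
    ∣χ∣≡1 p = ℤ.abs-◃ (χ p) 1
    h : ℕ → ℕ → ℤ
    h = H (χ± χ) ∣χ∣≡1
    search : Dec (∃[ s ] s ℕ.< M ℕ.+ M × ∃[ c ] c ℕ.< C × 2 ℕ.* r ℕ.≤ ℤ.∣ h s c ∣) →
      Σ[ Π ∈ ConvexPartition S ] r ℕ.≤ discᴾ χ Π
    search (yes (s , s<2M , c , _ , 2r≤H)) = halfPlane⇒partition χ (+ s) (+ M) (constant c) r 1≤r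
      (subst (2 ℕ.* r ℕ.≤_) (cong ℤ.∣_∣ (sym (signSum≡H χ ∣χ∣≡1 s c s<2M))) 2r≤H)
    search (no ∄) = ⊥-elim (ℕ.<⇒≱ 256D²<m (halfplane-discrepancy (χ± χ) ∣χ∣≡1 D λ s c s<2M c<C →
      ℕ.s≤s⁻¹ (ℕ.≤-trans (ℕ.≰⇒> (λ 2r≤ → ∄ (s , s<2M , c , c<C , 2r≤))) (ℕ.≤-reflexive (sym 1+D≡2r)))))

-- Fourth roots of perfect fourth powers, and the choice of constants.

⌊⁴√⌋-≤ : ∀ b k → ⌊⁴√ b ℕ.* b ℕ.* (b ℕ.* b) ℕ.* suc k ℕ.^ 4 ⌋ ℕ.≤ b ℕ.* suc k
⌊⁴√⌋-≤ b k = ℕ.≮⇒≥ λ lt → ℕ.<-irrefl refl (begin-strict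
  (b ℕ.* suc k) ℕ.^ 4                          <⟨ ℕ.^-monoˡ-< 4 lt ⟩
  ⌊⁴√ N ⌋ ℕ.^ 4                                ≤⟨ proj₁ (⌊⁴√⌋-spec N) ⟩
  N                                            ≡⟨ lem b (suc k) ⟩
  (b ℕ.* suc k) ℕ.^ 4                          ∎)
  where
  open ℕ.≤-Reasoning
  N = b ℕ.* b ℕ.* (b ℕ.* b) ℕ.* suc k ℕ.^ 4
  lem : ∀ b K → b ℕ.* b ℕ.* (b ℕ.* b) ℕ.* (K ℕ.* (K ℕ.* (K ℕ.* (K ℕ.* 1)))) ≡
    b ℕ.* K ℕ.* (b ℕ.* K ℕ.* (b ℕ.* K ℕ.* (b ℕ.* K ℕ.* 1)))
  lem = ℕ-Solver.solve-∀

/-≤-ι : ∀ x k b → x ℕ.≤ b ℕ.* suc k → + x ℚ./ suc k ℚ.≤ ι (+ b)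
/-≤-ι x k b x≤ = ℚ.toℚᵘ-cancel-≤ (ℚᵘ.≤-respˡ-≃ (ℚᵘ.≃-sym (ℚ.toℚᵘ-fromℚᵘ (ℚᵘ.mkℚᵘ (+ x) k)))
  (ℚᵘ.≤-respʳ-≃ (ℚᵘ.≃-sym (ι-toℚᵘ (+ b)))
  (ℚᵘ.*≤* (subst₂ ℤ._≤_ (sym (ℤ.*-identityʳ (+ x))) (ℤ.pos-* b (suc k)) (ℤ.+≤+ x≤)))))

1/32 : ℚ
1/32 = + 1 ℚ./ 32

-- Every term of the root of b⁴ is at most b = 32 r, and 1/32 of that is r.
scaled-fourthRoot-≤ : ∀ r d → let b = 32 ℕ.* r in r ℕ.≤ d →
  fromℚ 1/32 * (b ℕ.* b ℕ.* (b ℕ.* b)) ^¼ ≤ fromℕ d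
scaled-fourthRoot-≤ r d r≤d ε 0<ε = 0 , λ k _ → begin
  1/32 ℚ.* fourthRootSeq n k
    ≤⟨ ℚ.*-monoˡ-≤-nonNeg 1/32 (/-≤-ι ⌊⁴√ n ℕ.* suc k ℕ.^ 4 ⌋ k b (⌊⁴√⌋-≤ b k)) ⟩
  1/32 ℚ.* ι (+ b)
    ≡⟨ cong (1/32 ℚ.*_) (trans (cong ι (ℤ.pos-* 32 r)) (ι-* (+ 32) (+ r))) ⟩
  1/32 ℚ.* (ι (+ 32) ℚ.* ι (+ r))
    ≡⟨ ℚ.*-assoc 1/32 (ι (+ 32)) (ι (+ r)) ⟨
  1ℚ ℚ.* ι (+ r)
    ≡⟨ ℚ.*-identityˡ (ι (+ r)) ⟩
  ι (+ r)
    ≤⟨ ι-mono-≤ (ℤ.+≤+ r≤d) ⟩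
  ι (+ d)
    ≡⟨ ℚ.+-identityʳ (ι (+ d)) ⟨
  ι (+ d) ℚ.+ 0ℚ
    ≤⟨ ℚ.+-monoʳ-≤ (ι (+ d)) (ℚ.<⇒≤ 0<ε) ⟩
  ι (+ d) ℚ.+ ε ∎
  where
  open ℚ.≤-Reasoning
  b = 32 ℕ.* r
  n = b ℕ.* b ℕ.* (b ℕ.* b)

0<1/32 : 0ℝ < fromℚ 1/32
0<1/32 = 1/32 , ℚ.positive⁻¹ 1/32 , 0 , λ _ _ → ℚ.≤-reflexive (ℚ.+-identityˡ 1/32)

-- The side of the grid is m = b², so n = b⁴. The choice b = 32 r comes from 256 D² < 256 (2 r)² =
-- (32 r)² = m with D = 2 r - 1.
coarse-grid : ∀ r → 1 ℕ.≤ r → let b = 32 ℕ.* r; n = b ℕ.* b ℕ.* (b ℕ.* b) in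
  Σ[ S ∈ PointSet n ] GeneralPosition S × (∀ χ → CoarsenessAtLeast S χ (fromℚ 1/32 * n ^¼))
coarse-grid r@(suc r-1) 1≤r = S , generalPosition , λ χ →
  let Π , r≤ = partition-of-discrepancy r D 1≤r 1+D≡2r 256D²<m χ
  in Π , scaled-fourthRoot-≤ r (discᴾ χ Π) r≤
  where
  b = 32 ℕ.* r
  instance
    m≢0 : ℕ.NonZero (b ℕ.* b)
    m≢0 = ℕ.m*n≢0 b b
  open PerturbedGrid (b ℕ.* b)
  D = ℕ.pred (2 ℕ.* r)
  1+D≡2r : suc D ≡ 2 ℕ.* r
  1+D≡2r = refl
  256D²<m : 256 ℕ.* (D ℕ.* D) ℕ.< b ℕ.* b
  256D²<m = ℕ.<-≤-trans (ℕ.*-monoʳ-< 256 (ℕ.*-mono-< D<2r D<2r)) (ℕ.≤-reflexive (lem r))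
    where
    D<2r : D ℕ.< 2 ℕ.* r
    D<2r = ℕ.≤-reflexive 1+D≡2r
    lem : ∀ r → 256 ℕ.* (2 ℕ.* r ℕ.* (2 ℕ.* r)) ≡ 32 ℕ.* r ℕ.* (32 ℕ.* r)
    lem = ℕ-Solver.solve-∀

n≤n⁴ : ∀ n → .{{ℕ.NonZero n}} → n ℕ.≤ n ℕ.* n ℕ.* (n ℕ.* n)
n≤n⁴ n = ℕ.≤-trans (ℕ.m≤m*n n n) (ℕ.m≤m*n (n ℕ.* n) (n ℕ.* n) {{ℕ.m*n≢0 n n}})

theorem4 : Σ[ C ∈ ℝ ] 0ℝ < C ×
    (∀ (N : ℕ) → ∃[ n ] n ≥ N ×
    (Σ[ S ∈ PointSet n ] GeneralPosition S ×
    (∀ (χ : Coloring n) → CoarsenessAtLeast S χ (C * n ^¼))))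
theorem4 = fromℚ 1/32 , 0<1/32 , λ N →
  let b = 32 ℕ.* suc N in
  b ℕ.* b ℕ.* (b ℕ.* b) ,
  ℕ.≤-trans (ℕ.n≤1+n N) (ℕ.≤-trans (ℕ.m≤n*m (suc N) 32) (n≤n⁴ b)) ,
  coarse-grid (suc N) (s≤s z≤n)
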